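{- For each integer $m\ge 2$ there exists a family of instances of the online allocation model (with full compatibility and product-specific bonus functions) with $m$ products, parameterized by $p\in(0,1)$, such that $$\lim_{p\to 0}\frac{\mathrm{OPT}_{\mathrm{on}}(p)}{\mathbb E_p[U(L)]}=\frac{\binom{m-1}{\lfloor (m-1)/2\rfloor}}{2^{m-1}}\ \sim\ \sqrt{\frac{2}{\pi(m-1)}}\qquad(\text{asymptotics as } m\to\infty),$$ where $\mathrm{OPT}_{\mathrm{on}}(p)$ and $\mathbb E_p[U(L)]$ denote, respectively, the optimal online value and the expected offline benchmark for the instance with parameter $p$. In particular, this limiting ratio converges to $0$ as $m\to\infty$.
   Context: Model. An instance consists of products $\mathcal I=\{1,\dots,m\}$, capacities $b_i\in\mathbb Z_+$, base rewards $r_i\ge 0$, bonus functions $f_i:\mathbb Z_+\to\mathbb R_+$ that are nonnegative and nondecreasing with $f_i(0)=0$ (possibly different across products), a horizon of $T$ periods and arrival probabilities $p_1,\dots,p_T\in[0,1]$. In period $t$ a customer arrives with probability $p_t$, independently across periods; $L$ is the total number of arrivals. Each arriving customer must be immediately and irrevocably assigned to a product with remaining capacity or rejected; every customer may be assigned to every product (full compatibility). The $k$-th sale of product $i$ yields reward $r_i+f_i(k)$, so $n$ sales yield $R_i(n)=n r_i+\sum_{k=1}^n f_i(k)$, $R_i(0)=0$. An online algorithm $\pi$ knows all parameters of the instance, but its decision in each period depends only on the arrivals observed so far, its past decisions and internal randomization independent of the arrivals. $\mathrm{Rev}^\pi$ is its random total reward and $\mathrm{OPT}_{\mathrm{on}}=\sup_\pi\mathbb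 E[\mathrm{Rev}^\pi]$ over all online algorithms. Offline benchmark: $U(\ell)=\max\{\sum_{i\in\mathcal I}R_i(x_i): \boldsymbol x\in\mathbb Z_+^m,\ x_i\le b_i\ \forall i,\ \sum_i x_i\le \ell\}$ for $\ell\in\mathbb Z_+$. -}

module Defs where

open import Algebra.Apartness.Bundles using (HeytingCommutativeRing; HeytingField)
open import Algebra.Bundles using (CommutativeRing; Semiring)
import Algebra.Definitions.RawMonoid as RawMonoidDefs
import Algebra.Definitions.RawSemiring as RawSemiringDefs
open import Data.Bool using (Bool; true; false)
import Data.Bool as Bool
open import Data.Fin using (Fin; zero; suc; toℕ; cast)
import Data.Fin as Fin
open import Data.List using (List; []; _∷_; length; filter; map; foldr; upTo; cartesianProductWith)
open import Data.Maybe using (Maybe; just; nothing)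
open import Data.Maybe.Properties using (≡-dec)
open import Data.Nat using (ℕ; zero; suc; z≤n; s≤s; _≤?_)
import Data.Nat as ℕ
import Data.Nat.Properties as ℕ
open import Data.Nat.Combinatorics using (_C_)
open import Data.Product using (Σ-syntax; ∃-syntax; _×_; proj₁; proj₂)
open import Data.Sum using (_⊎_; inj₂)
open import Data.Vec using (Vec; []; _∷_)
import Data.Vec as Vec
open import Function using (_∘_; _⇔_; Equivalence)
open import Level using () renaming (_⊔_ to _⊔ˡ_; suc to lsuc)
open import Relation.Binary.Core using (Rel)
open import Relation.Binary.PropositionalEquality using (_≡_)
open import Relation.Binary.Lattice.Definitions using (Supremum)
open import Relation.Binary.Structures using (IsStrictPartialOrder)
open import Relation.Nullary using (¬_)

-- The real numbers, axiomatised up to isomorphism as a Cauchy-complete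
-- Archimedean ordered field.  The axioms are the constructive ones, so the
-- Bishop/Cauchy reals are a model without any appeal to excluded middle; with
-- excluded middle they characterise the classical reals.
record RealField c ℓ₁ ℓ₂ : Set (lsuc (c ⊔ˡ ℓ₁ ⊔ˡ ℓ₂)) where
  infix  4 _<_ _≤_
  infixl 6 _⊔_

  field
    heytingField : HeytingField c ℓ₁ ℓ₂

  open HeytingField heytingField public hiding (zero)

  open CommutativeRing (HeytingCommutativeRing.commutativeRing heytingCommutativeRing) public
    using (semiring; +-rawMonoid)
  open Semiring semiring public using (rawSemiring)
  open RawMonoidDefs +-rawMonoid public using (sum) renaming (_×_ to _·_)
  open RawSemiringDefs rawSemiring public using (_^_)

  fromℕ : ℕ → Carrier
  fromℕ n = n · 1#

  field
    _<_                  : Rel Carrier ℓ₂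
    isStrictPartialOrder : IsStrictPartialOrder _≈_ _<_
    #⇔<⊎>                : ∀ {x y} → x # y ⇔ (x < y ⊎ y < x)
    0<1                  : 0# < 1#
    +-monoˡ-<            : ∀ z {x y} → x < y → x + z < y + z
    *-pos                : ∀ {x y} → 0# < x → 0# < y → 0# < x * y

  _≤_ : Rel Carrier ℓ₂
  x ≤ y = ¬ (y < x)

  field
    _⊔_         : Carrier → Carrier → Carrier
    ⊔-supremum  : Supremum _≤_ _⊔_
    archimedean : ∀ x → ∃[ n ] x < fromℕ n

  ∣_∣ : Carrier → Carrier
  ∣ x ∣ = x ⊔ (- x)

  IsCauchy : (ℕ → Carrier) → Set (c ⊔ˡ ℓ₂)
  IsCauchy s = ∀ ε → 0# < ε →
    ∃[ N ] (∀ j k → N ℕ.≤ j → N ℕ.≤ k → ∣ s j - s k ∣ < ε)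

  infix 4 _⟶_
  _⟶_ : (ℕ → Carrier) → Carrier → Set (c ⊔ˡ ℓ₂)
  s ⟶ x = ∀ ε → 0# < ε → ∃[ N ] (∀ k → N ℕ.≤ k → ∣ s k - x ∣ < ε)

  field
    complete : ∀ s → IsCauchy s → ∃[ x ] s ⟶ x

module Analysis {c ℓ₁ ℓ₂} (ℝ : RealField c ℓ₁ ℓ₂) where
  open RealField ℝ
  private module < = IsStrictPartialOrder isStrictPartialOrder

  -- The library inverts differences, so the inverse of y is that of y - 0#.
  infix 7 _/_⟨_⟩
  _/_⟨_⟩ : ∀ x y → 0# < y → Carrier
  x / y ⟨ 0<y ⟩ = x * proj₁ (#⇒invertible (Equivalence.from #⇔<⊎> (inj₂ 0<y)))

  fromℕ-pos : ∀ n → 0 ℕ.< n → 0# < fromℕ n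
  fromℕ-pos (suc zero)    _ = <.<-respʳ-≈ (sym (+-identityʳ 1#)) 0<1
  fromℕ-pos (suc (suc n)) _ = <.trans (fromℕ-pos (suc n) (s≤s z≤n))
    (<.<-respˡ-≈ (+-identityˡ _) (+-monoˡ-< (fromℕ (suc n)) 0<1))

  -- The approximation clause is the constructively standard form of
  -- "no smaller upper bound".
  IsSup : ∀ {a} {A : Set a} → (A → Carrier) → Carrier → Set (a ⊔ˡ c ⊔ˡ ℓ₂)
  IsSup g v = (∀ a → g a ≤ v) × (∀ ε → 0# < ε → ∃[ a ] v - ε < g a)

  OpenUnit : Set (c ⊔ˡ ℓ₂)
  OpenUnit = Σ[ p ∈ Carrier ] (0# < p × p < 1#)

  -- Limit as p tends to 0 within (0,1).
  infix 4 _⟶₀_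
  _⟶₀_ : (OpenUnit → Carrier) → Carrier → Set (c ⊔ˡ ℓ₂)
  g ⟶₀ l = ∀ ε → 0# < ε →
    ∃[ δ ] (0# < δ × (∀ p → proj₁ p < δ → ∣ g p - l ∣ < ε))

  -- Asymptotic equivalence: u - v = o(v).
  infix 4 _∼_
  _∼_ : (ℕ → Carrier) → (ℕ → Carrier) → Set (c ⊔ˡ ℓ₂)
  u ∼ v = ∀ ε → 0# < ε → ∃[ N ] (∀ k → N ℕ.≤ k → ∣ u k - v k ∣ ≤ ε * ∣ v k ∣)

  IsSqrt : Carrier → Carrier → Set (ℓ₁ ⊔ˡ ℓ₂)
  IsSqrt s x = 0# ≤ s × s * s ≈ x

  leibniz : ℕ → Carrier
  leibniz n = fromℕ 4 * sum {n} λ k → let d = suc (2 ℕ.* toℕ k) in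
    (- 1#) ^ toℕ k / fromℕ d ⟨ fromℕ-pos d (s≤s z≤n) ⟩

  -- π is the sum of Leibniz's series 4 (1 - 1/3 + 1/5 - ...).
  IsPi : Carrier → Set (c ⊔ˡ ℓ₂)
  IsPi π = leibniz ⟶ π

  limitRatio : ℕ → Carrier
  limitRatio m = let n = m ℕ.∸ 1 in
    fromℕ (n C ℕ.⌊ n /2⌋) / fromℕ (2 ℕ.^ n) ⟨ fromℕ-pos (2 ℕ.^ n) (ℕ.m^n>0 2 n) ⟩

module Allocation {c ℓ₁ ℓ₂} (ℝ : RealField c ℓ₁ ℓ₂) where
  open RealField ℝ
  open Analysis ℝ

  record Instance (m : ℕ) : Set (c ⊔ˡ ℓ₂ ⊔ˡ ℓ₁) where
    field
      capacity           : Fin m → ℕ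
      baseReward         : Fin m → Carrier
      baseReward-nonneg  : ∀ i → 0# ≤ baseReward i
      bonus              : Fin m → ℕ → Carrier
      bonus-zero         : ∀ i → bonus i 0 ≈ 0#
      bonus-nonneg       : ∀ i k → 0# ≤ bonus i k
      bonus-mono         : ∀ i {k l} → k ℕ.≤ l → bonus i k ≤ bonus i l
      horizon            : ℕ
      arrivalProb        : Fin horizon → Carrier
      arrivalProb-nonneg : ∀ t → 0# ≤ arrivalProb t
      arrivalProb-≤1     : ∀ t → arrivalProb t ≤ 1#

    reward : Fin m → ℕ → Carrier
    reward i n = n · baseReward i + sum {n} λ k → bonus i (suc (toℕ k))

    totalReward : (Fin m → ℕ) → Carrier
    totalReward x = sum λ i → reward i (x i)

  -- Expectation of g over independent Bernoulli arrivals.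
  𝔼 : ∀ {T} → (Fin T → Carrier) → (Vec Bool T → Carrier) → Carrier
  𝔼 {zero}  p g = g []
  𝔼 {suc T} p g = p zero * 𝔼 (p ∘ suc) (g ∘ (true ∷_))
                + (1# - p zero) * 𝔼 (p ∘ suc) (g ∘ (false ∷_))

  arrivals : ∀ {T} → Vec Bool T → ℕ
  arrivals = Vec.count (Bool._≟ true)

  allocationsWithin : ∀ {m} → (Fin m → ℕ) → List (Vec ℕ m)
  allocationsWithin {zero}  b = [] ∷ []
  allocationsWithin {suc m} b =
    cartesianProductWith _∷_ (upTo (suc (b zero))) (allocationsWithin (b ∘ suc))

  -- Starting the maximum at 0# changes nothing: rewards are nonnegative and
  -- the zero allocation, of reward 0#, is always feasible.
  U : ∀ {m} → Instance m → ℕ → Carrier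
  U I ℓ = foldr _⊔_ 0#
    (map (λ x → totalReward (Vec.lookup x))
      (filter (λ x → Vec.sum x ≤? ℓ) (allocationsWithin capacity)))
    where open Instance I

  𝔼U : ∀ {m} → Instance m → Carrier
  𝔼U I = 𝔼 (Instance.arrivalProb I) λ a → U I (arrivals a)

  -- just i assigns the customer to product i, nothing rejects.
  Decision : ℕ → Set
  Decision m = Maybe (Fin m)

  -- One entry per elapsed period, most recent first: nothing if no customer
  -- arrived, just d if one arrived and decision d was taken.
  History : ℕ → Set
  History m = List (Maybe (Decision m))

  sold : ∀ {m} → History m → Fin m → ℕ
  sold h i = length (filter (λ o → ≡-dec (≡-dec Fin._≟_) o (just (just i))) h)

  -- Internal randomisation enters through the conditional law decide h of the
  -- decision for a customer arriving right after the history h.  Any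
  -- randomisation independent of the arrivals, even one shared between
  -- periods, yields such conditional laws.
  record Policy {m} (I : Instance m) : Set (c ⊔ˡ ℓ₁ ⊔ˡ ℓ₂) where
    open Instance I
    field
      decide          : History m → Decision m → Carrier
      decide-nonneg   : ∀ h d → 0# ≤ decide h d
      decide-total    : ∀ h → decide h nothing + sum (λ i → decide h (just i)) ≈ 1#
      decide-feasible : ∀ h i → capacity i ℕ.≤ sold h i → decide h (just i) ≈ 0#

  module _ {m} {I : Instance m} (π : Policy I) where
    open Instance I
    open Policy π

    -- Expected final reward given the history h, when the arrival
    -- probabilities of the remaining periods are p.
    𝔼Rev-from : ∀ {T} → (Fin T → Carrier) → History m → Carrier
    𝔼Rev-from {zero}  p h = totalReward (sold h)
    𝔼Rev-from {suc T} p h =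
        (1# - p zero) * 𝔼Rev-from (p ∘ suc) (nothing ∷ h)
      + p zero * ( decide h nothing * 𝔼Rev-from (p ∘ suc) (just nothing ∷ h)
                 + sum λ i → decide h (just i) * 𝔼Rev-from (p ∘ suc) (just (just i) ∷ h))

    𝔼Rev : Carrier
    𝔼Rev = 𝔼Rev-from arrivalProb []

  IsOPT : ∀ {m} → Instance m → Carrier → Set (c ⊔ˡ ℓ₁ ⊔ˡ ℓ₂)
  IsOPT I v = IsSup (𝔼Rev {I = I}) v

  record _≈ᴵ_ {m} (I J : Instance m) : Set (c ⊔ˡ ℓ₁ ⊔ˡ ℓ₂) where
    private
      module I = Instance I
      module J = Instance J
    field
      capacity-≡    : ∀ i → I.capacity i ≡ J.capacity i
      baseReward-≈  : ∀ i → I.baseReward i ≈ J.baseReward i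
      bonus-≈       : ∀ i k → I.bonus i k ≈ J.bonus i k
      horizon-≡     : I.horizon ≡ J.horizon
      arrivalProb-≈ : ∀ t → I.arrivalProb t ≈ J.arrivalProb (cast horizon-≡ t)

  -- Parameters are compared with _≈_, so a family indexed by real numbers must
  -- respect it.
  record Family (m : ℕ) : Set (c ⊔ˡ ℓ₁ ⊔ˡ ℓ₂) where
    field
      at      : OpenUnit → Instance m
      at-cong : ∀ {p q} → proj₁ p ≈ proj₁ q → at p ≈ᴵ at q

module Submission where

-- The instance for p has products 0, …, n (n = m - 1) and n + 1 periods: one
-- sure arrival followed by n arrivals of probability p.  Product i has capacity
-- i + 1 and pays p^(-i), up to scaling, on its last unit only.  With 1 + k
-- arrivals the benchmark earns about p^(-k), so every k contributes about C(n,k)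
-- to its expectation, in total 2ⁿ.  An online algorithm has to commit the first
-- customer to some product i and then earns about C(n,i): any other product j
-- needs j + 1 further arrivals, which have probability O(p^(j+1)), one power of
-- p too many for its reward.  So i = ⌊n/2⌋ is optimal.
--
-- For the asymptotics let S(a) = Σ_k ∏_{j<k} (a-1-2j)/(a+3+2j), so that
-- S(0) = π/4 is Leibniz's series.  Creative telescoping gives
-- (a+2) S(a+2) = (a+3) S(a), which evaluates S at even a as a rational multiple
-- of π and at odd a, where the sum is finite, as a rational number.  The
-- comparison S(2n) ≤ S(2n+1) ≤ S(2n+2) is then Wallis's product with error
-- bounds, and yields 2/(π(n+2)) ≤ (C(n,⌊n/2⌋)/2ⁿ)² ≤ 2/(πn).

-- The axioms for the reals are constructive, and this shapes much of the development. Comparison is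
-- undecidable, so no decision of maximal value can be picked; the Bellman value is shown to be the
-- supremum through policies that lose arbitrarily little in each period. Square roots are not given
-- either and are built as limits.
--
-- Neither the online optimum nor the benchmark is computed. Both are enclosed between multiples of
-- pⁿ that agree up to O(p). Online, the upper bound is a potential that adds, over all products,
-- the union bounds for completing them; the lower bound serves a single product greedily. Offline,
-- the number 2ⁿ does not arise from summing binomials: the relevant expectation is a product over
-- the periods, equal to (p(2-p))ⁿ.
--
-- As π is given by Leibniz's series, the integrals that usually lead to Wallis's product are not at
-- hand. The parameter a replaces them: a step of two in a is a contiguous relation, so Leibniz's
-- series at a = 0 propagates to all even a, while the neighbouring odd a carry the rational
-- quantities to compare with.

open import Defs
open import Algebra.Apartness.Bundles using (HeytingCommutativeRing)
import Algebra.Apartness.Properties.HeytingCommutativeRing as HCRProperties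
open import Algebra.Bundles using (CommutativeRing)
import Algebra.Properties.CommutativeSemiring.Exp as Exp
import Algebra.Properties.Ring as RingProperties
import Algebra.Properties.Semiring.Mult as Mult
import Algebra.Properties.Semiring.Mult.TCOptimised as Mult′
import Algebra.Properties.Semiring.Sum as SemiringSum
import Algebra.Solver.Ring as RingSolver
open import Algebra.Solver.Ring.AlmostCommutativeRing using (fromCommutativeRing; _-Raw-AlmostCommutative⟶_)
open import Data.Bool using (Bool; true; false; if_then_else_)
import Data.Bool as Bool
open import Data.Bool.Properties using (T-≡)
open import Data.Empty using (⊥-elim)
open import Data.Fin using (Fin; zero; suc; toℕ; fromℕ<)
import Data.Fin as Fin
import Data.Fin.Properties as Fin
open import Data.Integer using (ℤ; +_; -[1+_]; _⊖_; _◃_)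
import Data.Integer as ℤ
import Data.Integer.Properties as ℤ
open import Data.List using (List; []; _∷_; length; filter; foldr; map; upTo)
open import Data.List.Membership.Propositional using (_∈_)
open import Data.List.Membership.Propositional.Properties
  using (∈-cartesianProductWith⁺; ∈-cartesianProductWith⁻; ∈-upTo⁺; ∈-upTo⁻; ∈-filter⁺; ∈-filter⁻)
import Data.List.Properties as List
open import Data.List.Relation.Unary.Any using (here; there)
open import Data.Maybe using (Maybe; just; nothing)
import Data.Maybe as Maybe
open import Data.Maybe.Properties using (≡-dec; just-injective)
open import Data.Nat using (ℕ; zero; suc; z≤n; s≤s)
import Data.Nat as ℕ
open import Data.Nat.Combinatorics using (_C_; nCk≡nC[n∸k]; nC1≡n; nCk+nC[k+1]≡[n+1]C[k+1]; k>n⇒nCk≡0)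
import Data.Nat.Properties as ℕ
open import Data.Nat.Tactic.RingSolver using (solve-∀)
open import Data.Product using (Σ-syntax; ∃-syntax; _×_; _,_; proj₁; proj₂)
import Data.Sign as Sign
open import Data.Sum using (_⊎_; inj₁; inj₂; [_,_]′)
open import Data.Vec using (Vec; []; _∷_; lookup; replicate)
import Data.Vec as Vec
import Data.Vec.Properties as Vec
open import Function using (_∘_; case_of_; id; Equivalence)
open import Relation.Binary.PropositionalEquality as ≡ using (_≡_)
open import Relation.Binary.Structures using (IsStrictPartialOrder)
open import Relation.Nullary using (¬_; Dec; yes; no)
open import Relation.Nullary.Decidable using (dec-true; dec-false)

-- Arithmetic and order in a constructive ordered field

module OrderedField {c ℓ₁ ℓ₂} (ℝ : RealField c ℓ₁ ℓ₂) where
  open RealField ℝ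
  open Analysis ℝ
  private
    module < = IsStrictPartialOrder isStrictPartialOrder
    commutativeRing : CommutativeRing c ℓ₁
    commutativeRing = HeytingCommutativeRing.commutativeRing heytingCommutativeRing
    module R = CommutativeRing commutativeRing
    module M′ = Mult′ semiring
  open RingProperties R.ring public using (-0#≈0#; -‿involutive; -‿distribˡ-*; -‿distribʳ-*; -‿+-comm)
  open R public using (commutativeSemiring)
  open HCRProperties heytingCommutativeRing using (invertibleʳ⇒#; x-0≈x)
  open Mult semiring using (×-homo-+; ×1-homo-*)

  -- Coefficients for the ring solver are integers because equality of reals is undecidable. With
  -- this form of multiple, the integer 1 denotes `1#` by reduction, whereas `fromℕ 1` is `1# + 0#`.
  ⟦_⟧ℤ : ℤ → Carrier
  ⟦ + n ⟧ℤ      = n M′.× 1#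
  ⟦ -[1+ n ] ⟧ℤ = - ⟦ + suc n ⟧ℤ

  module Solver where
    private
      ι : ℕ → Carrier
      ι n = n M′.× 1#

      -‿cong₂ : ∀ {x y u v} → x ≈ y → u ≈ v → x - u ≈ y - v
      -‿cong₂ p q = +-cong p (-‿cong q)

      cancel : ∀ x y z → (x + y) - (x + z) ≈ y - z
      cancel x y z = trans (+-congˡ (sym (-‿+-comm x z))) (trans (+-assoc x y _)
        (trans (+-congˡ (trans (sym (+-assoc y _ _)) (trans (+-congʳ (+-comm y _)) (+-assoc _ y _))))
        (trans (sym (+-assoc x _ _)) (trans (+-congʳ (-‿inverseʳ x)) (+-identityˡ _)))))

      ⊖-homo : ∀ m n → ⟦ m ⊖ n ⟧ℤ ≈ ι m - ι n
      ⊖-homo m       zero    = sym (trans (+-congˡ -0#≈0#) (+-identityʳ _))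
      ⊖-homo zero    (suc n) = sym (+-identityˡ _)
      ⊖-homo (suc m) (suc n) = trans (reflexive (≡.cong ⟦_⟧ℤ (ℤ.[1+m]⊖[1+n]≡m⊖n m n)))
        (trans (⊖-homo m n) (trans (sym (cancel 1# (ι m) (ι n)))
          (-‿cong₂ (sym (M′.1+× m 1#)) (sym (M′.1+× n 1#)))))

      -ι≈ : ∀ n → ⟦ ℤ.- (+ n) ⟧ℤ ≈ - ι n
      -ι≈ zero    = sym -0#≈0#
      -ι≈ (suc n) = refl

      ◃⁻ : ∀ n → ⟦ Sign.- ◃ n ⟧ℤ ≈ - ι n
      ◃⁻ zero    = sym -0#≈0#
      ◃⁻ (suc n) = refl

      ◃⁺ : ∀ n → ⟦ Sign.+ ◃ n ⟧ℤ ≈ ι n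
      ◃⁺ zero    = refl
      ◃⁺ (suc n) = refl

      +-homo : ∀ x y → ⟦ x ℤ.+ y ⟧ℤ ≈ ⟦ x ⟧ℤ + ⟦ y ⟧ℤ
      +-homo (+ m)      (+ n)      = M′.×-homo-+ 1# m n
      +-homo (+ m)      -[1+ n ]   = ⊖-homo m (suc n)
      +-homo -[1+ m ]   (+ n)      = trans (⊖-homo n (suc m)) (+-comm _ _)
      +-homo -[1+ m ]   -[1+ n ]   = trans (-‿cong (trans
        (reflexive (≡.cong ι (≡.cong suc (≡.sym (ℕ.+-suc m n)))))
        (M′.×-homo-+ 1# (suc m) (suc n)))) (sym (-‿+-comm _ _))

      *-homo : ∀ x y → ⟦ x ℤ.* y ⟧ℤ ≈ ⟦ x ⟧ℤ * ⟦ y ⟧ℤ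
      *-homo (+ m)      (+ n)      = trans (◃⁺ (m ℕ.* n)) (M′.×1-homo-* m n)
      *-homo (+ m)      -[1+ n ]   = trans (◃⁻ (m ℕ.* suc n))
        (trans (-‿cong (M′.×1-homo-* m (suc n))) (-‿distribʳ-* _ _))
      *-homo -[1+ m ]   (+ n)      = trans (◃⁻ (suc m ℕ.* n))
        (trans (-‿cong (M′.×1-homo-* (suc m) n)) (-‿distribˡ-* _ _))
      *-homo -[1+ m ]   -[1+ n ]   = trans (◃⁺ (suc m ℕ.* suc n)) (trans (M′.×1-homo-* (suc m) (suc n))
        (trans (sym (-‿involutive _)) (trans (-‿cong (-‿distribˡ-* _ _)) (-‿distribʳ-* _ _))))

      -‿homo : ∀ x → ⟦ ℤ.- x ⟧ℤ ≈ - ⟦ x ⟧ℤ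
      -‿homo (+ n)    = -ι≈ n
      -‿homo -[1+ n ] = sym (-‿involutive _)

      morphism : ℤ.+-*-rawRing -Raw-AlmostCommutative⟶ fromCommutativeRing commutativeRing
      morphism = record
        { ⟦_⟧ = ⟦_⟧ℤ ; +-homo = +-homo ; *-homo = *-homo ; -‿homo = -‿homo ; 0-homo = refl ; 1-homo = refl }

      _coeff≟_ : ∀ x y → Maybe (⟦ x ⟧ℤ ≈ ⟦ y ⟧ℤ)
      x coeff≟ y with x ℤ.≟ y
      ... | yes ≡.refl = just refl
      ... | no  _      = nothing

    open RingSolver ℤ.+-*-rawRing (fromCommutativeRing commutativeRing) morphism _coeff≟_ public

    -- Denotes fromℕ n itself, which is not the value of the coefficient n.
    nat : ∀ {k} → ℕ → Polynomial k
    nat n = n :× con (+ 1)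

    :1 : ∀ {k} → Polynomial k
    :1 = con (+ 1)

    :0 : ∀ {k} → Polynomial k
    :0 = con (+ 0)

  open Solver public using (solve; _:=_; _:+_; _:*_; _:-_; :-_; nat; :1; :0)

  ≤-refl : ∀ {x} → x ≤ x
  ≤-refl = <.irrefl refl

  -- The substitute for trichotomy. Cotransitivity of apartness makes `z` apart from `x` or from
  -- `y`; if the order is the unwanted one, transitivity with `x < y` settles the other alternative.
  <-cotrans : ∀ {x y} → x < y → ∀ z → x < z ⊎ z < y
  <-cotrans {x} {y} x<y z with #-cotrans (Equivalence.from #⇔<⊎> (inj₁ x<y)) z
  ... | inj₁ x#z = [ inj₁ , (λ z<x → inj₂ (<.trans z<x x<y)) ]′ (Equivalence.to #⇔<⊎> x#z)
  ... | inj₂ z#y = [ inj₂ , (λ y<z → inj₁ (<.trans x<y y<z)) ]′ (Equivalence.to #⇔<⊎> z#y)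

  ≤-trans : ∀ {x y z} → x ≤ y → y ≤ z → x ≤ z
  ≤-trans {y = y} x≤y y≤z z<x = [ y≤z , x≤y ]′ (<-cotrans z<x y)

  <-≤-trans : ∀ {x y z} → x < y → y ≤ z → x < z
  <-≤-trans {z = z} x<y y≤z = [ id , (λ z<y → ⊥-elim (y≤z z<y)) ]′ (<-cotrans x<y z)

  ≤-<-trans : ∀ {x y z} → x ≤ y → y < z → x < z
  ≤-<-trans {x} x≤y y<z = [ (λ y<x → ⊥-elim (x≤y y<x)) , id ]′ (<-cotrans y<z x)

  <⇒≤ : ∀ {x y} → x < y → x ≤ y
  <⇒≤ = <.asym

  ≤-reflexive : ∀ {x y} → x ≈ y → x ≤ y
  ≤-reflexive x≈y = <.irrefl (sym x≈y)

  ≤-antisym : ∀ {x y} → x ≤ y → y ≤ x → x ≈ y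
  ≤-antisym x≤y y≤x = proj₁ (tight _ _) λ x#y → [ y≤x , x≤y ]′ (Equivalence.to #⇔<⊎> x#y)

  ≤-resp-≈ : ∀ {x y u v} → x ≈ u → y ≈ v → x ≤ y → u ≤ v
  ≤-resp-≈ x≈u y≈v x≤y v<u = x≤y (<.<-respˡ-≈ (sym y≈v) (<.<-respʳ-≈ (sym x≈u) v<u))

  <-resp-≈ : ∀ {x y u v} → x ≈ u → y ≈ v → x < y → u < v
  <-resp-≈ x≈u y≈v x<y = <.<-respˡ-≈ x≈u (<.<-respʳ-≈ y≈v x<y)

  +-monoʳ-< : ∀ z {x y} → x < y → z + x < z + y
  +-monoʳ-< z p = <.<-respˡ-≈ (+-comm _ z) (<.<-respʳ-≈ (+-comm _ z) (+-monoˡ-< z p))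

  +-mono-< : ∀ {x y u v} → x < y → u < v → x + u < y + v
  +-mono-< {y = y} {u} p q = <.trans (+-monoˡ-< u p) (+-monoʳ-< y q)

  +-cancelʳ-< : ∀ z {x y} → x + z < y + z → x < y
  +-cancelʳ-< z {x} {y} p = <.<-respˡ-≈ (lemma x) (<.<-respʳ-≈ (lemma y) (+-monoˡ-< (- z) p))
    where lemma = λ w → solve 2 (λ w z → w :+ z :- z := w) refl w z

  +-monoˡ-≤ : ∀ z {x y} → x ≤ y → x + z ≤ y + z
  +-monoˡ-≤ z x≤y p = x≤y (+-cancelʳ-< z p)

  +-monoʳ-≤ : ∀ z {x y} → x ≤ y → z + x ≤ z + y
  +-monoʳ-≤ z x≤y p = x≤y (+-cancelʳ-< z (<.<-respˡ-≈ (+-comm z _) (<.<-respʳ-≈ (+-comm z _) p)))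

  +-mono-≤ : ∀ {x y u v} → x ≤ y → u ≤ v → x + u ≤ y + v
  +-mono-≤ {y = y} {u} p q = ≤-trans (+-monoˡ-≤ u p) (+-monoʳ-≤ y q)

  +-mono-≤-< : ∀ {x y u v} → x ≤ y → u < v → x + u < y + v
  +-mono-≤-< {y = y} {u} p q = ≤-<-trans (+-monoˡ-≤ u p) (+-monoʳ-< y q)

  x≤x+y : ∀ {x y} → 0# ≤ y → x ≤ x + y
  x≤x+y 0≤y = ≤-resp-≈ (+-identityʳ _) refl (+-monoʳ-≤ _ 0≤y)

  x≤y+x : ∀ {x y} → 0# ≤ y → x ≤ y + x
  x≤y+x 0≤y = ≤-resp-≈ (+-identityˡ _) refl (+-monoˡ-≤ _ 0≤y)

  +-nonneg : ∀ {x y} → 0# ≤ x → 0# ≤ y → 0# ≤ x + y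
  +-nonneg 0≤x 0≤y = ≤-trans 0≤x (x≤x+y 0≤y)

  x<y⇒0<y-x : ∀ {x y} → x < y → 0# < y - x
  x<y⇒0<y-x {x} p = <.<-respˡ-≈ (-‿inverseʳ x) (+-monoˡ-< (- x) p)

  0<y-x⇒x<y : ∀ {x y} → 0# < y - x → x < y
  0<y-x⇒x<y {x} {y} p = <.<-respˡ-≈ (+-identityˡ x)
    (<.<-respʳ-≈ (solve 2 (λ x y → y :- x :+ x := y) refl x y) (+-monoˡ-< x p))

  x≤y⇒0≤y-x : ∀ {x y} → x ≤ y → 0# ≤ y - x
  x≤y⇒0≤y-x {x} {y} x≤y p = x≤y (<.<-respˡ-≈ (solve 2 (λ x y → y :- x :+ x := y) refl x y)
    (<.<-respʳ-≈ (+-identityˡ x) (+-monoˡ-< x p)))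

  0≤y-x⇒x≤y : ∀ {x y} → 0# ≤ y - x → x ≤ y
  0≤y-x⇒x≤y {x} q p = q (<.<-respʳ-≈ (-‿inverseʳ x) (+-monoˡ-< (- x) p))

  -‿anti-mono-< : ∀ {x y} → x < y → - y < - x
  -‿anti-mono-< {x} {y} p = 0<y-x⇒x<y (<.<-respʳ-≈
    (solve 2 (λ x y → y :- x := (:- x) :- (:- y)) refl x y) (x<y⇒0<y-x p))

  x-ε<x : ∀ {x ε} → 0# < ε → x - ε < x
  x-ε<x 0<ε = <-resp-≈ refl (+-identityʳ _) (+-monoʳ-< _ (<-resp-≈ refl -0#≈0# (-‿anti-mono-< 0<ε)))

  -‿anti-mono-≤ : ∀ {x y} → x ≤ y → - y ≤ - x
  -‿anti-mono-≤ {x} {y} x≤y p = x≤y (<.<-respˡ-≈ (-‿involutive y)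
    (<.<-respʳ-≈ (-‿involutive x) (-‿anti-mono-< p)))

  *-monoʳ-< : ∀ {z x y} → 0# < z → x < y → z * x < z * y
  *-monoʳ-< {z} {x} {y} 0<z x<y = 0<y-x⇒x<y (<.<-respʳ-≈
    (solve 3 (λ x y z → z :* (y :- x) := z :* y :- z :* x) refl x y z) (*-pos 0<z (x<y⇒0<y-x x<y)))

  -- If `w` inverts the product then `y * w` inverts `x`. This is how the sign of a factor becomes
  -- decidable once the product is known to be apart from zero.
  *-factor-# : ∀ {x y} → x * y # 0# → x # 0#
  *-factor-# {x} {y} xy#0 with #⇒invertible xy#0
  ... | w , _ , right = invertibleʳ⇒# (y * w , trans (*-congʳ (x-0≈x x))
    (trans (sym (*-assoc x y w)) (trans (*-congʳ (sym (x-0≈x (x * y)))) right)))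

  *-factor-<⊎> : ∀ {x y} → x * y # 0# → (x < 0# ⊎ 0# < x) × (y < 0# ⊎ 0# < y)
  *-factor-<⊎> {x} {y} p = to (*-factor-# p) , to
    (*-factor-# (to-# (<.<-respˡ-≈ (*-comm x y)) (<.<-respʳ-≈ (*-comm x y)) (to p)))
    where
    to : ∀ {x y} → x # y → x < y ⊎ y < x
    to = Equivalence.to #⇔<⊎>
    to-# : ∀ {u v w} → (u < w → v < w) → (w < u → w < v) → u < w ⊎ w < u → v # w
    to-# f g = Equivalence.from #⇔<⊎> ∘ [ inj₁ ∘ f , inj₂ ∘ g ]′

  -- As `≤` is a negation, the product may be assumed negative; then it is apart from zero and both
  -- factors have a definite sign.
  *-nonneg : ∀ {x y} → 0# ≤ x → 0# ≤ y → 0# ≤ x * y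
  *-nonneg 0≤x 0≤y xy<0 with *-factor-<⊎> (Equivalence.from #⇔<⊎> (inj₁ xy<0))
  ... | inj₁ x<0 , _        = 0≤x x<0
  ... | inj₂ _   , inj₁ y<0 = 0≤y y<0
  ... | inj₂ 0<x , inj₂ 0<y = <.asym xy<0 (*-pos 0<x 0<y)

  *-monoʳ-≤ : ∀ {z x y} → 0# ≤ z → x ≤ y → z * x ≤ z * y
  *-monoʳ-≤ {z} {x} {y} 0≤z x≤y = 0≤y-x⇒x≤y (≤-trans (*-nonneg 0≤z (x≤y⇒0≤y-x x≤y))
    (≤-reflexive (solve 3 (λ x y z → z :* (y :- x) := z :* y :- z :* x) refl x y z)))

  *-monoˡ-≤ : ∀ {z x y} → 0# ≤ z → x ≤ y → x * z ≤ y * z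
  *-monoˡ-≤ 0≤z x≤y = ≤-trans (≤-reflexive (*-comm _ _))
    (≤-trans (*-monoʳ-≤ 0≤z x≤y) (≤-reflexive (*-comm _ _)))

  *-mono-≤ : ∀ {x y u v} → 0# ≤ u → 0# ≤ y → x ≤ y → u ≤ v → x * u ≤ y * v
  *-mono-≤ 0≤u 0≤y x≤y u≤v = ≤-trans (*-monoˡ-≤ 0≤u x≤y) (*-monoʳ-≤ 0≤y u≤v)

  *-monoˡ-< : ∀ {z x y} → 0# < z → x < y → x * z < y * z
  *-monoˡ-< 0<z x<y = <.<-respˡ-≈ (*-comm _ _) (<.<-respʳ-≈ (*-comm _ _) (*-monoʳ-< 0<z x<y))

  *-cancelʳ-≤ : ∀ {z x y} → 0# < z → x * z ≤ y * z → x ≤ y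
  *-cancelʳ-≤ 0<z q y<x = q (*-monoˡ-< 0<z y<x)

  *-cancelˡ-≤ : ∀ {z x y} → 0# < z → z * x ≤ z * y → x ≤ y
  *-cancelˡ-≤ 0<z q y<x = q (*-monoʳ-< 0<z y<x)

  *-cancelˡ-≈ : ∀ {z x y} → 0# < z → z * x ≈ z * y → x ≈ y
  *-cancelˡ-≈ 0<z q = ≤-antisym (*-cancelˡ-≤ 0<z (≤-reflexive q)) (*-cancelˡ-≤ 0<z (≤-reflexive (sym q)))

  *-cancelˡ-< : ∀ {z x y} → 0# < z → z * x < z * y → x < y
  *-cancelˡ-< {z} {x} {y} 0<z zx<zy = [ ⊥-elim ∘ absurd , 0<y-x⇒x<y ]′
    (proj₂ (*-factor-<⊎> (Equivalence.from #⇔<⊎> (inj₂ 0<z[y-x]))))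
    where
    0<z[y-x] : 0# < z * (y - x)
    0<z[y-x] = <.<-respʳ-≈ (solve 3 (λ x y z → z :* y :- z :* x := z :* (y :- x)) refl x y z)
      (x<y⇒0<y-x zx<zy)
    absurd : ¬ (y - x < 0#)
    absurd y-x<0 = <.asym 0<z[y-x] (<.<-respʳ-≈ (zeroʳ z) (*-monoʳ-< 0<z y-x<0))

  square-cancel-≤ : ∀ {x y} → 0# ≤ y → x * x ≤ y * y → x ≤ y
  square-cancel-≤ {x} {y} 0≤y q y<x = q (≤-<-trans (*-monoʳ-≤ 0≤y (<⇒≤ y<x))
    (*-monoˡ-< (≤-<-trans 0≤y y<x) y<x))

  -- The positive number y² - x² factors as (y - x)(y + x), so y - x has a sign, and a negative one
  -- contradicts monotonicity of squaring.
  square-cancel-< : ∀ {x y} → 0# ≤ x → 0# ≤ y → x * x < y * y → x < y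
  square-cancel-< {x} {y} 0≤x 0≤y xx<yy = [ ⊥-elim ∘ absurd , 0<y-x⇒x<y ]′
    (proj₁ (*-factor-<⊎> (Equivalence.from #⇔<⊎> (inj₂ 0<[y-x][y+x]))))
    where
    0<[y-x][y+x] : 0# < (y - x) * (y + x)
    0<[y-x][y+x] = <.<-respʳ-≈ (solve 2 (λ x y → y :* y :- x :* x := (y :- x) :* (y :+ x)) refl x y)
      (x<y⇒0<y-x xx<yy)
    absurd : ¬ (y - x < 0#)
    absurd y-x<0 = *-mono-≤ 0≤y 0≤x y≤x y≤x xx<yy
      where
      y≤x : y ≤ x
      y≤x = ≤-resp-≈ (solve 2 (λ x y → y :- x :+ x := y) refl x y) (+-identityˡ x) (+-monoˡ-≤ x (<⇒≤ y-x<0))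

  square-nonneg : ∀ x → 0# ≤ x * x
  square-nonneg x xx<0 = [ (λ x<0 → <.asym xx<0 (<.<-respʳ-≈ -x*-x≈x*x (*-pos (0<-x x<0) (0<-x x<0)))) ,
    (λ 0<x → <.asym xx<0 (*-pos 0<x 0<x)) ]′
    (proj₁ (*-factor-<⊎> {x} {x} (Equivalence.from #⇔<⊎> (inj₁ xx<0))))
    where
    0<-x : x < 0# → 0# < - x
    0<-x x<0 = <.<-respˡ-≈ -0#≈0# (-‿anti-mono-< x<0)
    -x*-x≈x*x : (- x) * (- x) ≈ x * x
    -x*-x≈x*x = solve 1 (λ x → (:- x) :* (:- x) := x :* x) refl x

  fromℕ-homo-+ : ∀ m n → fromℕ (m ℕ.+ n) ≈ fromℕ m + fromℕ n
  fromℕ-homo-+ = ×-homo-+ 1#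

  fromℕ-homo-* : ∀ m n → fromℕ (m ℕ.* n) ≈ fromℕ m * fromℕ n
  fromℕ-homo-* = ×1-homo-*

  fromℕ-homo-^ : ∀ m n → fromℕ (m ℕ.^ n) ≈ fromℕ m ^ n
  fromℕ-homo-^ m zero    = +-identityʳ 1#
  fromℕ-homo-^ m (suc n) = trans (fromℕ-homo-* m (m ℕ.^ n)) (*-congˡ (fromℕ-homo-^ m n))

  suc-pos : ∀ n → 0# < fromℕ (suc n)
  suc-pos n = fromℕ-pos (suc n) (s≤s z≤n)

  fromℕ-nonneg : ∀ n → 0# ≤ fromℕ n
  fromℕ-nonneg zero    = ≤-refl
  fromℕ-nonneg (suc n) = <⇒≤ (suc-pos n)

  fromℕ-mono-≤ : ∀ {m n} → m ℕ.≤ n → fromℕ m ≤ fromℕ n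
  fromℕ-mono-≤ {n = n} z≤n = fromℕ-nonneg n
  fromℕ-mono-≤ (s≤s m≤n)   = +-monoʳ-≤ 1# (fromℕ-mono-≤ m≤n)

  fromℕ-1 : fromℕ 1 ≈ 1#
  fromℕ-1 = +-identityʳ 1#

  0≤1 : 0# ≤ 1#
  0≤1 = <⇒≤ 0<1

  recip : ℕ → Carrier
  recip n = 1# / fromℕ (suc n) ⟨ suc-pos n ⟩

  inverse : ∀ {y} → 0# < y → Carrier
  inverse 0<y = proj₁ (#⇒invertible (Equivalence.from #⇔<⊎> (inj₂ 0<y)))

  inverseˡ : ∀ {y} (0<y : 0# < y) → inverse 0<y * y ≈ 1#
  inverseˡ {y} 0<y = trans (*-congˡ (sym (x-0≈x y)))
    (proj₁ (proj₂ (#⇒invertible (Equivalence.from #⇔<⊎> (inj₂ 0<y)))))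

  inverse-pos : ∀ {y} (0<y : 0# < y) → 0# < inverse 0<y
  inverse-pos {y} 0<y = *-cancelˡ-< 0<y (<.<-respˡ-≈ (sym (zeroʳ y))
    (<.<-respʳ-≈ (trans (sym (inverseˡ 0<y)) (*-comm _ _)) 0<1))

  /-*-cancel : ∀ x {y} (0<y : 0# < y) → x / y ⟨ 0<y ⟩ * y ≈ x
  /-*-cancel x 0<y = trans (*-assoc x _ _) (trans (*-congˡ (inverseˡ 0<y)) (*-identityʳ x))

  /-pos : ∀ {x y} → 0# < x → (0<y : 0# < y) → 0# < x / y ⟨ 0<y ⟩
  /-pos 0<x 0<y = *-pos 0<x (inverse-pos 0<y)

  /-nonneg : ∀ {x y} → 0# ≤ x → (0<y : 0# < y) → 0# ≤ x / y ⟨ 0<y ⟩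
  /-nonneg 0≤x 0<y = *-nonneg 0≤x (<⇒≤ (inverse-pos 0<y))

  recip-cancel : ∀ n → recip n * fromℕ (suc n) ≈ 1#
  recip-cancel n = /-*-cancel 1# _

  recip-pos : ∀ n → 0# < recip n
  recip-pos n = /-pos 0<1 _

  half : Carrier → Carrier
  half x = x * recip 1

  half-+-half : ∀ x → half x + half x ≈ x
  half-+-half x = trans (solve 2 (λ x h → x :* h :+ x :* h := x :* (h :* nat 2)) refl x (recip 1))
    (trans (*-congˡ (recip-cancel 1)) (*-identityʳ x))

  half-pos : ∀ {x} → 0# < x → 0# < half x
  half-pos 0<x = *-pos 0<x (recip-pos 1)

  archimedean-recip : ∀ b {ε} → 0# < ε → ∃[ N ] (∀ n → N ℕ.≤ n → b < ε * fromℕ n)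
  archimedean-recip b {ε} 0<ε with archimedean (b / ε ⟨ 0<ε ⟩)
  ... | N , p = N , λ n N≤n → <.<-respˡ-≈ (trans (*-comm ε _) (/-*-cancel b 0<ε))
    (*-monoʳ-< 0<ε (<-≤-trans p (fromℕ-mono-≤ N≤n)))

  x≤x⊔y : ∀ x y → x ≤ x ⊔ y
  x≤x⊔y x y = proj₁ (⊔-supremum x y)

  y≤x⊔y : ∀ x y → y ≤ x ⊔ y
  y≤x⊔y x y = proj₁ (proj₂ (⊔-supremum x y))

  ⊔-least : ∀ {x y z} → x ≤ z → y ≤ z → x ⊔ y ≤ z
  ⊔-least {x} {y} p q = proj₂ (proj₂ (⊔-supremum x y)) _ p q

  midpoint : ∀ {x y} → x < y → ∃[ z ] (x < z × z < y)
  midpoint {x} {y} x<y = half (x + y) ,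
    <.<-respˡ-≈ (half-+-half x) (<.<-respʳ-≈ (sym (distribʳ _ x y)) (+-monoʳ-< (half x) h<h)) ,
    <.<-respʳ-≈ (half-+-half y) (<.<-respˡ-≈ (sym (distribʳ _ x y)) (+-monoˡ-< (half y) h<h))
    where
    h<h : half x < half y
    h<h = *-monoˡ-< (recip-pos 1) x<y

  -- The supremum is specified through `≤` only. A midpoint `w` leaves a gap `z < w` with which `x`
  -- and `y` can be compared; were both below `w`, then `w` would be an upper bound below the least
  -- one.
  <⊔⇒<⊎< : ∀ {x y z} → z < x ⊔ y → z < x ⊎ z < y
  <⊔⇒<⊎< {x} {y} {z} z<x⊔y = between (midpoint z<x⊔y)
    where
    between : ∃[ w ] (z < w × w < x ⊔ y) → z < x ⊎ z < y
    between (w , z<w , w<x⊔y) = [ inj₁ , (λ x<w → [ inj₂ , (λ y<w →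
      ⊥-elim (⊔-least (<⇒≤ x<w) (<⇒≤ y<w) w<x⊔y)) ]′ (<-cotrans z<w y)) ]′ (<-cotrans z<w x)

  -- The only obstruction is a supremum strictly above both arguments, and by `<⊔⇒<⊎<` that would
  -- order the two both ways.
  ⊔-least-< : ∀ {x y z} → x < z → y < z → x ⊔ y < z
  ⊔-least-< {x} {y} {z} x<z y<z = [ (λ x<x⊔y → [ ⊥-elim ∘ absurd x<x⊔y , id ]′ (<-cotrans y<z (x ⊔ y)))
    , id ]′ (<-cotrans x<z (x ⊔ y))
    where
    absurd : x < x ⊔ y → ¬ (y < x ⊔ y)
    absurd p q = [ ≤-refl , (λ x<y → [ <.asym x<y , ≤-refl ]′ (<⊔⇒<⊎< q)) ]′ (<⊔⇒<⊎< p)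

  ∣x-y∣<ε : ∀ {x y ε} → x < y + ε → y < x + ε → ∣ x - y ∣ < ε
  ∣x-y∣<ε {x} {y} {ε} p q = ⊔-least-<
    (<.<-respʳ-≈ (solve 2 (λ y e → y :+ e :- y := e) refl y ε) (+-monoˡ-< (- y) p))
    (<.<-respˡ-≈ (solve 2 (λ x y → y :- x := :- (x :- y)) refl x y)
      (<.<-respʳ-≈ (solve 2 (λ x e → x :+ e :- x := e) refl x ε) (+-monoˡ-< (- x) q)))

  ∣x-y∣<ε⇒x<y+ε : ∀ {x y ε} → ∣ x - y ∣ < ε → x < y + ε
  ∣x-y∣<ε⇒x<y+ε {x} {y} {ε} p = <.<-respˡ-≈ (solve 2 (λ x y → y :+ (x :- y) := x) refl x y)
    (+-monoʳ-< y (≤-<-trans (x≤x⊔y _ _) p))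

  ∣x-y∣<ε⇒y<x+ε : ∀ {x y ε} → ∣ x - y ∣ < ε → y < x + ε
  ∣x-y∣<ε⇒y<x+ε {x} {y} {ε} p = <.<-respˡ-≈ (solve 2 (λ x y → x :+ (:- (x :- y)) := y) refl x y)
    (+-monoʳ-< x (≤-<-trans (y≤x⊔y _ _) p))

  ∣x-y∣≤ε : ∀ {x y ε} → x ≤ y + ε → y ≤ x + ε → ∣ x - y ∣ ≤ ε
  ∣x-y∣≤ε {x} {y} {ε} p q = ⊔-least
    (≤-trans (+-monoˡ-≤ (- y) p) (≤-reflexive (solve 2 (λ y e → y :+ e :- y := e) refl y ε)))
    (≤-trans (≤-reflexive (solve 2 (λ x y → :- (x :- y) := y :- x) refl x y))
      (≤-trans (+-monoˡ-≤ (- x) q) (≤-reflexive (solve 2 (λ x e → x :+ e :- x := e) refl x ε))))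

  ≤-ε : ∀ {x y} → (∀ ε → 0# < ε → x ≤ y + ε) → x ≤ y
  ≤-ε {x} {y} f y<x = absurd (midpoint y<x)
    where
    absurd : ¬ (∃[ w ] (y < w × w < x))
    absurd (w , y<w , w<x) = f (w - y) (x<y⇒0<y-x y<w) (<.<-respˡ-≈ w≈y+[w-y] w<x)
      where
      w≈y+[w-y] : w ≈ y + (w - y)
      w≈y+[w-y] = solve 2 (λ y w → w := y :+ (w :- y)) refl y w

-- Limits of sequences

module Limits {c ℓ₁ ℓ₂} (ℝ : RealField c ℓ₁ ℓ₂) where
  open RealField ℝ
  open Analysis ℝ
  open OrderedField ℝ

  -- Replaces `∣ x - y ∣ < ε` by two inequalities without `⊔`, which add and scale directly.
  Within : Carrier → Carrier → Carrier → Set ℓ₂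
  Within ε x y = x < y + ε × y < x + ε

  WithinEventually : (ℕ → Carrier) → Carrier → Carrier → Set ℓ₂
  WithinEventually s x ε = ∃[ N ] (∀ k → N ℕ.≤ k → Within ε (s k) x)

  ⟶⇒Within : ∀ {s x} → s ⟶ x → ∀ {ε} → 0# < ε → WithinEventually s x ε
  ⟶⇒Within {s} {x} lim {ε} 0<ε = convert (lim ε 0<ε)
    where
    convert : ∃[ N ] (∀ k → N ℕ.≤ k → ∣ s k - x ∣ < ε) → WithinEventually s x ε
    convert (N , p) = N , λ k N≤k → ∣x-y∣<ε⇒x<y+ε (p k N≤k) , ∣x-y∣<ε⇒y<x+ε (p k N≤k)

  Within⇒⟶ : ∀ {s x} → (∀ ε → 0# < ε → WithinEventually s x ε) → s ⟶ x
  Within⇒⟶ {s} {x} w ε 0<ε = convert (w ε 0<ε)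
    where
    convert : WithinEventually s x ε → ∃[ N ] (∀ k → N ℕ.≤ k → ∣ s k - x ∣ < ε)
    convert (N , p) = N , λ k N≤k → ∣x-y∣<ε (proj₁ (p k N≤k)) (proj₂ (p k N≤k))

  Within-+ : ∀ {ε a b x y} → Within (half ε) a x → Within (half ε) b y → Within ε (a + b) (x + y)
  Within-+ {ε} {a} {b} {x} {y} (a<x , x<a) (b<y , y<b) =
    <-resp-≈ refl (regroup x y) (+-mono-< a<x b<y) , <-resp-≈ refl (regroup a b) (+-mono-< x<a y<b)
    where
    regroup : ∀ x y → (x + half ε) + (y + half ε) ≈ x + y + ε
    regroup x y = trans (solve 3 (λ x y h → (x :+ h) :+ (y :+ h) := x :+ y :+ (h :+ h)) refl x y
      (half ε)) (+-congˡ (half-+-half ε))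

  ⟶-+ : ∀ {s t x y} → s ⟶ x → t ⟶ y → (λ k → s k + t k) ⟶ (x + y)
  ⟶-+ {s} {t} {x} {y} lims limt = Within⇒⟶ λ ε 0<ε →
    both (⟶⇒Within lims (half-pos 0<ε)) (⟶⇒Within limt (half-pos 0<ε))
    where
    both : ∀ {ε} → WithinEventually s x (half ε) → WithinEventually t y (half ε) →
      WithinEventually (λ k → s k + t k) (x + y) ε
    both (M , p) (N , q) = M ℕ.+ N , λ k M+N≤k →
      Within-+ (p k (ℕ.≤-trans (ℕ.m≤m+n M N) M+N≤k)) (q k (ℕ.≤-trans (ℕ.m≤n+m N M) M+N≤k))

  ⟶-* : ∀ {c s x} → 0# < c → s ⟶ x → (λ k → c * s k) ⟶ (c * x)
  ⟶-* {c} {s} {x} 0<c lim = Within⇒⟶ λ ε 0<ε → scale (⟶⇒Within lim (/-pos 0<ε 0<c))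
    where
    expand : ∀ y ε → c * (y + ε / c ⟨ 0<c ⟩) ≈ c * y + ε
    expand y ε = trans (distribˡ c y _) (+-congˡ (trans (*-comm c _) (/-*-cancel ε 0<c)))
    scale : ∀ {ε} → WithinEventually s x (ε / c ⟨ 0<c ⟩) → WithinEventually (λ k → c * s k) (c * x) ε
    scale {ε} (N , p) = N , λ k N≤k →
      <-resp-≈ refl (expand x ε) (*-monoʳ-< 0<c (proj₁ (p k N≤k))) ,
      <-resp-≈ refl (expand (s k) ε) (*-monoʳ-< 0<c (proj₂ (p k N≤k)))

  ⟶-cong : ∀ {s t x y} → (∀ k → s k ≈ t k) → x ≈ y → s ⟶ x → t ⟶ y
  ⟶-cong {s} {t} {x} {y} s≈t x≈y lim = Within⇒⟶ λ ε 0<ε → convert (⟶⇒Within lim 0<ε)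
    where
    convert : ∀ {ε} → WithinEventually s x ε → WithinEventually t y ε
    convert (N , p) = N , λ k N≤k → <-resp-≈ (s≈t k) (+-congʳ x≈y) (proj₁ (p k N≤k)) , <-resp-≈ x≈y
      (+-congʳ (s≈t k)) (proj₂ (p k N≤k))

  ⟶-squeeze : ∀ {s t x} N → (∀ k → N ℕ.≤ k → s k ≤ x + t k × x ≤ s k + t k) → t ⟶ 0# → s ⟶ x
  ⟶-squeeze {s} {t} {x} N bounds lim = Within⇒⟶ λ ε 0<ε → convert (⟶⇒Within lim 0<ε)
    where
    convert : ∀ {ε} → WithinEventually t 0# ε → WithinEventually s x ε
    convert {ε} (M , p) = N ℕ.+ M , λ k N+M≤k →
      let bound = bounds k (ℕ.≤-trans (ℕ.m≤m+n N M) N+M≤k)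
          t<ε   = <-resp-≈ refl (+-identityˡ ε) (proj₁ (p k (ℕ.≤-trans (ℕ.m≤n+m M N) N+M≤k)))
      in ≤-<-trans (proj₁ bound) (+-monoʳ-< x t<ε) , ≤-<-trans (proj₂ bound) (+-monoʳ-< (s k) t<ε)

  ⟶-≤ : ∀ {s x b} N → s ⟶ x → (∀ k → N ℕ.≤ k → s k ≤ b) → x ≤ b
  ⟶-≤ {s} {x} {b} N lim s≤b = ≤-ε λ ε 0<ε → convert (⟶⇒Within lim 0<ε)
    where
    convert : ∀ {ε} → WithinEventually s x ε → x ≤ b + ε
    convert {ε} (M , p) = <⇒≤ (<-≤-trans (proj₂ (p (N ℕ.+ M) (ℕ.m≤n+m M N)))
      (+-monoˡ-≤ ε (s≤b (N ℕ.+ M) (ℕ.m≤m+n N M))))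

  ⟶-≥ : ∀ {s x b} N → s ⟶ x → (∀ k → N ℕ.≤ k → b ≤ s k) → b ≤ x
  ⟶-≥ {s} {x} {b} N lim b≤s = ≤-ε λ ε 0<ε → convert (⟶⇒Within lim 0<ε)
    where
    convert : ∀ {ε} → WithinEventually s x ε → b ≤ x + ε
    convert {ε} (M , p) = <⇒≤ (≤-<-trans (b≤s (N ℕ.+ M) (ℕ.m≤m+n N M)) (proj₁ (p (N ℕ.+ M) (ℕ.m≤n+m M N))))

  -- Applied to partial sums, this makes the terms of a convergent series tend to zero.
  ⟶-difference : ∀ {s x} → s ⟶ x → (λ k → s (suc k) - s k) ⟶ 0#
  ⟶-difference {s} {x} lim = Within⇒⟶ λ ε 0<ε → convert (⟶⇒Within lim (half-pos 0<ε))
    where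
    close : ∀ {ε a b} → Within (half ε) a x → Within (half ε) b x → a - b < ε
    close {ε} {a} {b} (a<x , _) (_ , x<b) = <-resp-≈
      (solve 3 (λ a b x → a :+ x :- (x :+ b) := a :- b) refl a b x)
      (trans (solve 3 (λ x b h → (x :+ h) :+ (b :+ h) :- (x :+ b) := h :+ h) refl x b (half ε))
        (half-+-half ε))
      (+-monoˡ-< (- (x + b)) (+-mono-< a<x x<b))
    convert : ∀ {ε} → WithinEventually s x (half ε) → WithinEventually (λ k → s (suc k) - s k) 0# ε
    convert {ε} (N , p) = N , λ k N≤k →
      let here = p k N≤k ; next = p (suc k) (ℕ.m≤n⇒m≤1+n N≤k) in
      <-resp-≈ refl (sym (+-identityˡ ε)) (close next here) ,
      <-resp-≈ (solve 2 (λ a b → (a :- b) :+ (b :- a) := :0) refl (s (suc k)) (s k)) refl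
        (+-monoʳ-< (s (suc k) - s k) (close here next))

  O[1/n]⟶0 : ∀ {t} b N → (∀ k → N ℕ.≤ k → 0# ≤ t k) → (∀ k → N ℕ.≤ k → t k * fromℕ k ≤ b) → t ⟶ 0#
  O[1/n]⟶0 {t} b N 0≤t t≤ = Within⇒⟶ λ ε 0<ε → convert 0<ε (archimedean-recip b 0<ε)
    where
    convert : ∀ {ε} → 0# < ε → ∃[ M ] (∀ n → M ℕ.≤ n → b < ε * fromℕ n) → WithinEventually t 0# ε
    -- The successor forces `k` to be positive, so that `fromℕ k` can be cancelled.
    convert {ε} 0<ε (M , p) = suc (N ℕ.+ M) , λ k large →
      let N≤k = ℕ.≤-trans (ℕ.m≤m+n N M) (ℕ.<⇒≤ large)
          M≤k = ℕ.≤-trans (ℕ.m≤n+m M N) (ℕ.<⇒≤ large)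
          0<k = fromℕ-pos k (ℕ.≤-trans (s≤s z≤n) large)
          t<ε = *-cancelˡ-< 0<k (<-resp-≈ (*-comm (t k) _) (*-comm ε _) (≤-<-trans (t≤ k N≤k) (p k M≤k)))
      in <-resp-≈ refl (sym (+-identityˡ ε)) t<ε ,
         <-≤-trans 0<ε (x≤y+x (0≤t k N≤k))

  -- Both `s j` and `s k` are compared with the same `s N`, each at the cost of `e N`, which is
  -- below ε/2.
  Cauchy-from-tails : ∀ {s e} → (∀ n k → s (n ℕ.+ k) ≤ s n + e n × s n ≤ s (n ℕ.+ k) + e n) → e ⟶ 0# →
    IsCauchy s
  Cauchy-from-tails {s} {e} tail lim ε 0<ε = convert (⟶⇒Within lim (half-pos 0<ε))
    where
    convert : WithinEventually e 0# (half ε) → ∃[ N ] (∀ j k → N ℕ.≤ j → N ℕ.≤ k → ∣ s j - s k ∣ < ε)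
    convert (N , p) = N , λ j k N≤j N≤k → ∣x-y∣<ε (close j k N≤j N≤k) (close k j N≤k N≤j)
      where
      e<ε/2 : e N < half ε
      e<ε/2 = <-resp-≈ refl (+-identityˡ _) (proj₁ (p N ℕ.≤-refl))
      upper : ∀ j → N ℕ.≤ j → s j ≤ s N + e N × s N ≤ s j + e N
      upper j N≤j = ≡.subst (λ i → s i ≤ s N + e N × s N ≤ s i + e N) (ℕ.m+[n∸m]≡n N≤j) (tail N (j ℕ.∸ N))
      close : ∀ j k → N ℕ.≤ j → N ℕ.≤ k → s j < s k + ε
      close j k N≤j N≤k = ≤-<-trans (proj₁ (upper j N≤j))
        (<-resp-≈ refl (trans (+-assoc _ _ _) (+-congˡ (half-+-half ε)))
          (+-mono-≤-< (≤-trans (proj₂ (upper k N≤k)) (+-monoʳ-≤ (s k) (<⇒≤ e<ε/2))) e<ε/2))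

  ⟶-unique : ∀ {s x y} → s ⟶ x → s ⟶ y → x ≈ y
  ⟶-unique {s} {x} {y} limx limy = ≤-antisym (le limx limy) (le limy limx)
    where
    le : ∀ {x y} → s ⟶ x → s ⟶ y → x ≤ y
    le {x} {y} limx limy = ≤-ε λ ε 0<ε → both (⟶⇒Within limx (half-pos 0<ε)) (⟶⇒Within limy (half-pos 0<ε))
      where
      both : ∀ {ε} → WithinEventually s x (half ε) → WithinEventually s y (half ε) → x ≤ y + ε
      both {ε} (M , p) (N , q) = <⇒≤ (<-resp-≈ refl (trans (+-assoc _ _ _) (+-congˡ (half-+-half ε)))
        (<-≤-trans (proj₂ (p (M ℕ.+ N) (ℕ.m≤m+n M N)))
          (+-monoˡ-≤ (half ε) (<⇒≤ (proj₁ (q (M ℕ.+ N) (ℕ.m≤n+m N M)))))))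

  -- From a² - b² = (a - b)(a + b): once `s k < x + 1` the second factor is below 2x + 1, so
  -- closeness ε/(2x + 1) suffices.
  ⟶-square : ∀ {s x} → (∀ k → 0# ≤ s k) → 0# ≤ x → s ⟶ x → (λ k → s k * s k) ⟶ (x * x)
  ⟶-square {s} {x} 0≤s 0≤x lim = Within⇒⟶ λ ε 0<ε → combine (/-pos 0<ε 0<2x+1) (/-*-cancel ε 0<2x+1)
      (⟶⇒Within lim 0<1) (⟶⇒Within lim (/-pos 0<ε 0<2x+1))
    where
    0<2x+1 : 0# < x + x + 1#
    0<2x+1 = <-resp-≈ (+-identityˡ 0#) refl (+-mono-≤-< (+-nonneg 0≤x 0≤x) 0<1)
    close : ∀ {δ} a b → 0# < δ → 0# ≤ a → 0# ≤ b → a + b < x + x + 1# → a < b + δ →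
      a * a < b * b + δ * (x + x + 1#)
    close {δ} a b 0<δ 0≤a 0≤b a+b< a<b+δ = <-resp-≈
      (solve 2 (λ a b → b :* b :+ (a :- b) :* (a :+ b) := a :* a) refl a b) refl
      (+-monoʳ-< (b * b) (≤-<-trans
        (*-monoˡ-≤ (+-nonneg 0≤a 0≤b)
          (≤-resp-≈ refl (solve 2 (λ b d → b :+ d :- b := d) refl b δ) (+-monoˡ-≤ (- b) (<⇒≤ a<b+δ))))
        (*-monoʳ-< 0<δ a+b<)))
    combine : ∀ {ε δ} → 0# < δ → δ * (x + x + 1#) ≈ ε →
      WithinEventually s x 1# → WithinEventually s x δ → WithinEventually (λ k → s k * s k) (x * x) ε
    combine {ε} {δ} 0<δ δ[2x+1]≈ε (M , p) (N , q) = M ℕ.+ N , λ k M+N≤k →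
      let k≥M = ℕ.≤-trans (ℕ.m≤m+n M N) M+N≤k
          k≥N = ℕ.≤-trans (ℕ.m≤n+m N M) M+N≤k
          sum< = <-resp-≈ refl (sym (+-assoc x x 1#))
            (<-resp-≈ (+-comm x (s k)) refl (+-monoʳ-< x (proj₁ (p k k≥M))))
      in <-resp-≈ refl (+-congˡ δ[2x+1]≈ε) (close (s k) x 0<δ (0≤s k) 0≤x sum< (proj₁ (q k k≥N))) ,
         <-resp-≈ refl (+-congˡ δ[2x+1]≈ε) (close x (s k) 0<δ 0≤x (0≤s k)
           (<-resp-≈ (+-comm (s k) x) refl sum<) (proj₂ (q k k≥N)))

  -- A nonnegative sequence is Cauchy as soon as its squares converge: if a² < b² + ε² then a² < (b
  -- + ε)². Completeness thus produces the root, with no need for a lower bound on `x` away from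
  -- zero.
  sqrt-from-squares : ∀ {y x} → (∀ k → 0# ≤ y k) → (λ k → y k * y k) ⟶ x → ∃[ s ] IsSqrt s x
  sqrt-from-squares {y} {x} 0≤y y²⟶x = limit (complete y cauchy)
    where
    close : ∀ {ε} a b → 0# < ε → 0# ≤ a → 0# ≤ b → a * a < x + half (ε * ε) → x < b * b + half (ε * ε) →
      a < b + ε
    close {ε} a b 0<ε 0≤a 0≤b a²<x x<b² = square-cancel-< 0≤a (+-nonneg 0≤b (<⇒≤ 0<ε))
      (<-≤-trans a²<b²+ε² (≤-resp-≈ (+-identityʳ _) expand (+-monoʳ-≤ (b * b + ε * ε) 0≤2bε)))
      where
      a²<b²+ε² : a * a < b * b + ε * ε
      a²<b²+ε² = <-resp-≈ refl (trans (+-assoc _ _ _) (+-congˡ (half-+-half _)))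
        (<-≤-trans a²<x (+-monoˡ-≤ _ (<⇒≤ x<b²)))
      0≤2bε : 0# ≤ b * ε + b * ε
      0≤2bε = +-nonneg (*-nonneg 0≤b (<⇒≤ 0<ε)) (*-nonneg 0≤b (<⇒≤ 0<ε))
      expand : b * b + ε * ε + (b * ε + b * ε) ≈ (b + ε) * (b + ε)
      expand = solve 2 (λ b e → b :* b :+ e :* e :+ (b :* e :+ b :* e) := (b :+ e) :* (b :+ e)) refl b ε
    cauchy : IsCauchy y
    cauchy ε 0<ε = convert (⟶⇒Within y²⟶x (half-pos (*-pos 0<ε 0<ε)))
      where
      convert : WithinEventually (λ k → y k * y k) x (half (ε * ε)) →
        ∃[ N ] (∀ j k → N ℕ.≤ j → N ℕ.≤ k → ∣ y j - y k ∣ < ε)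
      convert (N , p) = N , λ j k N≤j N≤k → ∣x-y∣<ε
        (close (y j) (y k) 0<ε (0≤y j) (0≤y k) (proj₁ (p j N≤j)) (proj₂ (p k N≤k)))
        (close (y k) (y j) 0<ε (0≤y k) (0≤y j) (proj₁ (p k N≤k)) (proj₂ (p j N≤j)))
    limit : ∃[ s ] y ⟶ s → ∃[ s ] IsSqrt s x
    limit (s , y⟶s) = s , 0≤s , ⟶-unique (⟶-square 0≤y 0≤s y⟶s) y²⟶x
      where
      0≤s : 0# ≤ s
      0≤s = ⟶-≥ 0 y⟶s (λ k _ → 0≤y k)


-- Binomial coefficients: unimodality and the middle coefficients

module Binomial where
  open ≡.≡-Reasoning

  -- Absorption, by induction along Pascal's rule. It yields both the unimodality of the rows and
  -- the recurrence for odd middle coefficients.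
  C-absorb : ∀ n k → suc k ℕ.* (suc n C suc k) ≡ suc n ℕ.* (n C k)
  C-absorb zero    zero    = ≡.refl
  C-absorb zero    (suc k) = ≡.trans (≡.cong (suc (suc k) ℕ.*_) (k>n⇒nCk≡0 {1} {2 ℕ.+ k} (s≤s (s≤s z≤n))))
    (≡.trans (ℕ.*-zeroʳ (suc (suc k))) (≡.sym (≡.cong (1 ℕ.*_) (k>n⇒nCk≡0 {0} {suc k} (s≤s z≤n)))))
  C-absorb (suc n) zero    = ≡.trans (ℕ.*-identityˡ _)
    (≡.trans (nC1≡n (suc (suc n))) (≡.sym (ℕ.*-identityʳ _)))
  C-absorb (suc n) (suc k) = begin
    (2 ℕ.+ k) ℕ.* (suc (suc n) C suc (suc k))
      ≡⟨ ≡.cong ((2 ℕ.+ k) ℕ.*_) (≡.sym (nCk+nC[k+1]≡[n+1]C[k+1] (suc n) (suc k))) ⟩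
    (2 ℕ.+ k) ℕ.* (c ℕ.+ (suc n C suc (suc k)))
      ≡⟨ expand k c (suc n C suc (suc k)) ⟩
    c ℕ.+ suc k ℕ.* c ℕ.+ (2 ℕ.+ k) ℕ.* (suc n C suc (suc k))
      ≡⟨ ≡.cong₂ (λ x y → c ℕ.+ x ℕ.+ y) (C-absorb n k) (C-absorb n (suc k)) ⟩
    c ℕ.+ suc n ℕ.* (n C k) ℕ.+ suc n ℕ.* (n C suc k)
      ≡⟨ collect c n (n C k) (n C suc k) ⟩
    c ℕ.+ suc n ℕ.* ((n C k) ℕ.+ (n C suc k))
      ≡⟨ ≡.cong (λ x → c ℕ.+ suc n ℕ.* x) (nCk+nC[k+1]≡[n+1]C[k+1] n k) ⟩
    suc (suc n) ℕ.* c ∎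
    where
    c = suc n C suc k
    expand : ∀ k c d → (2 ℕ.+ k) ℕ.* (c ℕ.+ d) ≡ c ℕ.+ suc k ℕ.* c ℕ.+ (2 ℕ.+ k) ℕ.* d
    expand = solve-∀
    collect : ∀ c n d e → c ℕ.+ suc n ℕ.* d ℕ.+ suc n ℕ.* e ≡ c ℕ.+ suc n ℕ.* (d ℕ.+ e)
    collect = solve-∀

  -- Absorption and Pascal's rule give (k+1)(C(n,k) + C(n,k+1)) = (n+1) C(n,k), which is at least
  -- 2(k+1) C(n,k).
  C-step : ∀ n k → suc k ℕ.+ suc k ℕ.≤ suc n → n C k ℕ.≤ n C suc k
  C-step n k p = ℕ.*-cancelˡ-≤ (suc k) (ℕ.+-cancelˡ-≤ (suc k ℕ.* (n C k)) _ _ (ℕ.≤-trans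
    (ℕ.≤-reflexive (≡.sym (ℕ.*-distribʳ-+ (n C k) (suc k) (suc k)))) (ℕ.≤-trans
    (ℕ.*-monoˡ-≤ (n C k) p) (ℕ.≤-reflexive (≡.trans (≡.sym (C-absorb n k)) (≡.trans
    (≡.cong (suc k ℕ.*_) (≡.sym (nCk+nC[k+1]≡[n+1]C[k+1] n k)))
      (ℕ.*-distribˡ-+ (suc k) (n C k) (n C suc k))))))))

  C-mono : ∀ n k j → (k ℕ.+ j) ℕ.+ (k ℕ.+ j) ℕ.≤ suc n → n C k ℕ.≤ n C (k ℕ.+ j)
  C-mono n k zero    _ = ℕ.≤-reflexive (≡.cong (n C_) (≡.sym (ℕ.+-identityʳ k)))
  C-mono n k (suc j) p = ℕ.≤-trans (C-mono n k j (ℕ.≤-trans (ℕ.+-mono-≤ (ℕ.n≤1+n _) (ℕ.n≤1+n _)) p′))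
    (ℕ.≤-trans (C-step n (k ℕ.+ j) p′) (ℕ.≤-reflexive (≡.cong (n C_) (≡.sym (ℕ.+-suc k j)))))
    where
    p′ : suc (k ℕ.+ j) ℕ.+ suc (k ℕ.+ j) ℕ.≤ suc n
    p′ = ≡.subst (λ i → i ℕ.+ i ℕ.≤ suc n) (ℕ.+-suc k j) p

  -- Doubling is written `k ℕ.* 2` because `suc k ℕ.* 2` reduces to `2 ℕ.+ k ℕ.* 2`; the recurrences
  -- in steps of two below then type-check without transport.
  data Parity : ℕ → Set where
    even : ∀ k → Parity (k ℕ.* 2)
    odd  : ∀ k → Parity (1 ℕ.+ k ℕ.* 2)

  parity : ∀ n → Parity n
  parity zero = even 0
  parity (suc n) with parity n
  ... | even k = odd k
  ... | odd k  = even (suc k)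

  ⌊k*2/2⌋ : ∀ k → ℕ.⌊ k ℕ.* 2 /2⌋ ≡ k
  ⌊k*2/2⌋ zero    = ≡.refl
  ⌊k*2/2⌋ (suc k) = ≡.cong suc (⌊k*2/2⌋ k)

  ⌊1+k*2/2⌋ : ∀ k → ℕ.⌊ 1 ℕ.+ k ℕ.* 2 /2⌋ ≡ k
  ⌊1+k*2/2⌋ zero    = ≡.refl
  ⌊1+k*2/2⌋ (suc k) = ≡.cong suc (⌊1+k*2/2⌋ k)

  C-lower-half : ∀ n k → k ℕ.≤ ℕ.⌊ n /2⌋ → n C k ℕ.≤ n C ℕ.⌊ n /2⌋
  C-lower-half n k k≤ = ≡.subst (λ h → n C k ℕ.≤ n C h) k+j≡h
    (C-mono n k _ (≡.subst (λ h → h ℕ.+ h ℕ.≤ suc n) (≡.sym k+j≡h) 2h≤1+n))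
    where
    k+j≡h : k ℕ.+ (ℕ.⌊ n /2⌋ ℕ.∸ k) ≡ ℕ.⌊ n /2⌋
    k+j≡h = ℕ.m+[n∸m]≡n k≤
    2h≤1+n : ℕ.⌊ n /2⌋ ℕ.+ ℕ.⌊ n /2⌋ ℕ.≤ suc n
    2h≤1+n = ℕ.m≤n⇒m≤1+n (ℕ.≤-trans (ℕ.+-monoʳ-≤ ℕ.⌊ n /2⌋ (ℕ.⌊n/2⌋≤⌈n/2⌉ n))
      (ℕ.≤-reflexive (ℕ.⌊n/2⌋+⌈n/2⌉≡n n)))

  C-central-max : ∀ n k → n C k ℕ.≤ n C ℕ.⌊ n /2⌋
  C-central-max n k = [ below , above ]′ (ℕ.≤-<-connex k ℕ.⌊ n /2⌋)
    where
    below : k ℕ.≤ ℕ.⌊ n /2⌋ → n C k ℕ.≤ n C ℕ.⌊ n /2⌋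
    below = C-lower-half n k
    above : ℕ.⌊ n /2⌋ ℕ.< k → n C k ℕ.≤ n C ℕ.⌊ n /2⌋
    above h<k = [ reflect , (λ n<k → ℕ.≤-trans (ℕ.≤-reflexive (k>n⇒nCk≡0 n<k)) z≤n) ]′ (ℕ.≤-<-connex k n)
      where
      reflect : k ℕ.≤ n → n C k ℕ.≤ n C ℕ.⌊ n /2⌋
      -- Symmetry moves `k` to the lower half: n - k ≤ ⌊n/2⌋ because ⌈n/2⌉ ≤ ⌊n/2⌋ + 1 ≤ k.
      reflect k≤n = ℕ.≤-trans (ℕ.≤-reflexive (nCk≡nC[n∸k] k≤n)) (C-lower-half n (n ℕ.∸ k)
        (ℕ.m≤n+o⇒m∸n≤o n k (ℕ.≤-trans (ℕ.≤-reflexive (≡.sym (ℕ.⌊n/2⌋+⌈n/2⌉≡n n)))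
          (ℕ.≤-trans (ℕ.+-monoʳ-≤ ℕ.⌊ n /2⌋ (ceil≤ n))
            (ℕ.≤-trans (ℕ.≤-reflexive (ℕ.+-suc ℕ.⌊ n /2⌋ ℕ.⌊ n /2⌋)) (ℕ.+-monoˡ-≤ ℕ.⌊ n /2⌋ h<k))))))
        where
        ceil≤ : ∀ n → ℕ.⌈ n /2⌉ ℕ.≤ suc ℕ.⌊ n /2⌋
        ceil≤ zero          = z≤n
        ceil≤ (suc zero)    = ℕ.≤-refl
        ceil≤ (suc (suc n)) = s≤s (ceil≤ n)

  middle : ℕ → ℕ
  middle n = n C ℕ.⌊ n /2⌋

  C-sym-odd : ∀ k → (1 ℕ.+ k ℕ.* 2) C k ≡ (1 ℕ.+ k ℕ.* 2) C suc k
  C-sym-odd k = ≡.trans (nCk≡nC[n∸k] (ℕ.m≤n⇒m≤1+n (ℕ.m≤m*n k 2))) (≡.cong ((1 ℕ.+ k ℕ.* 2) C_)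
    (≡.trans (≡.cong (ℕ._∸ k) (1+k*2 k)) (ℕ.m+n∸m≡n k (suc k))))
    where
    1+k*2 : ∀ k → 1 ℕ.+ k ℕ.* 2 ≡ k ℕ.+ suc k
    1+k*2 = solve-∀

  -- The two summands in Pascal's rule are mirror images of each other. After division by powers of
  -- two, an even index therefore repeats the value at the preceding odd one.
  middle-even : ∀ k → middle (suc k ℕ.* 2) ≡ 2 ℕ.* middle (1 ℕ.+ k ℕ.* 2)
  middle-even k = begin
    middle (suc k ℕ.* 2)                                     ≡⟨ ≡.cong ((2 ℕ.+ k ℕ.* 2) C_)
      (⌊k*2/2⌋ (suc k)) ⟩
    (2 ℕ.+ k ℕ.* 2) C suc k                                  ≡⟨ ≡.sym
      (nCk+nC[k+1]≡[n+1]C[k+1] (1 ℕ.+ k ℕ.* 2) k) ⟩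
    ((1 ℕ.+ k ℕ.* 2) C k) ℕ.+ ((1 ℕ.+ k ℕ.* 2) C suc k)       ≡⟨ ≡.cong₂ ℕ._+_ ≡.refl (≡.sym (C-sym-odd k)) ⟩
    ((1 ℕ.+ k ℕ.* 2) C k) ℕ.+ ((1 ℕ.+ k ℕ.* 2) C k)           ≡⟨ ≡.cong (((1 ℕ.+ k ℕ.* 2) C k) ℕ.+_)
      (≡.sym (ℕ.+-identityʳ _)) ⟩
    2 ℕ.* ((1 ℕ.+ k ℕ.* 2) C k)                              ≡⟨ ≡.cong (λ h →
      2 ℕ.* ((1 ℕ.+ k ℕ.* 2) C h)) (≡.sym (⌊1+k*2/2⌋ k)) ⟩
    2 ℕ.* middle (1 ℕ.+ k ℕ.* 2)                             ∎

  middle-odd : ∀ k → suc k ℕ.* middle (1 ℕ.+ k ℕ.* 2) ≡ (1 ℕ.+ k ℕ.* 2) ℕ.* middle (k ℕ.* 2)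
  middle-odd k = begin
    suc k ℕ.* middle (1 ℕ.+ k ℕ.* 2)            ≡⟨ ≡.cong (λ h → suc k ℕ.* ((1 ℕ.+ k ℕ.* 2) C h))
      (⌊1+k*2/2⌋ k) ⟩
    suc k ℕ.* ((1 ℕ.+ k ℕ.* 2) C k)             ≡⟨ ≡.cong (suc k ℕ.*_) (C-sym-odd k) ⟩
    suc k ℕ.* ((1 ℕ.+ k ℕ.* 2) C suc k)         ≡⟨ C-absorb (k ℕ.* 2) k ⟩
    (1 ℕ.+ k ℕ.* 2) ℕ.* ((k ℕ.* 2) C k)         ≡⟨ ≡.cong (λ h → (1 ℕ.+ k ℕ.* 2) ℕ.* ((k ℕ.* 2) C h))
      (≡.sym (⌊k*2/2⌋ k)) ⟩
    (1 ℕ.+ k ℕ.* 2) ℕ.* middle (k ℕ.* 2)        ∎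

-- From Leibniz's series to Wallis's product

module Wallis {c ℓ₁ ℓ₂} (ℝ : RealField c ℓ₁ ℓ₂) where
  open RealField ℝ
  open Analysis ℝ
  open OrderedField ℝ
  open Limits ℝ

  -- Unlike `sum`, this grows at the last term, so passing to the next partial sum is a reduction.
  Σ< : ℕ → (ℕ → Carrier) → Carrier
  Σ< zero    f = 0#
  Σ< (suc n) f = Σ< n f + f n

  Σ<-cong : ∀ n {f g} → (∀ k → f k ≈ g k) → Σ< n f ≈ Σ< n g
  Σ<-cong zero    f≈g = refl
  Σ<-cong (suc n) f≈g = +-cong (Σ<-cong n f≈g) (f≈g n)

  Σ<-head : ∀ n f → Σ< (suc n) f ≈ f 0 + Σ< n (f ∘ suc)
  Σ<-head zero    f = +-comm 0# (f 0)
  Σ<-head (suc n) f = trans (+-congʳ (Σ<-head n f)) (+-assoc _ _ _)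

  Σ<-sum : ∀ n f → sum {n} (f ∘ toℕ) ≈ Σ< n f
  Σ<-sum zero    f = refl
  Σ<-sum (suc n) f = trans (+-congˡ (Σ<-sum n (f ∘ suc))) (sym (Σ<-head n f))

  Σ<-split : ∀ m n f → Σ< (m ℕ.+ n) f ≈ Σ< m f + Σ< n (λ k → f (m ℕ.+ k))
  Σ<-split m zero    f = trans (reflexive (≡.cong (λ i → Σ< i f) (ℕ.+-identityʳ m))) (sym (+-identityʳ _))
  Σ<-split m (suc n) f = trans (reflexive (≡.cong (λ i → Σ< i f) (ℕ.+-suc m n)))
    (trans (+-congʳ (Σ<-split m n f)) (+-assoc _ _ _))

  Σ<-neg : ∀ n f → Σ< n (λ k → - f k) ≈ - Σ< n f
  Σ<-neg zero    f = sym -0#≈0#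
  Σ<-neg (suc n) f = trans (+-congʳ (Σ<-neg n f))
    (solve 2 (λ a b → (:- a) :+ (:- b) := :- (a :+ b)) refl (Σ< n f) (f n))

  Σ<-mono : ∀ n {f g} → (∀ k → k ℕ.< n → f k ≤ g k) → Σ< n f ≤ Σ< n g
  Σ<-mono zero    f≤g = ≤-refl
  Σ<-mono (suc n) f≤g = +-mono-≤ (Σ<-mono n (λ k k<n → f≤g k (ℕ.m≤n⇒m≤1+n k<n))) (f≤g n (ℕ.≤-refl))

  -- Stated through the quotient -q of consecutive terms, the condition mentions no sign and is
  -- stable under shifts and negation.
  Alternating : (ℕ → Carrier) → Set _
  Alternating x = ∀ k → ∃[ q ] (0# ≤ q × q ≤ 1# × x (suc k) ≈ - (q * x k))

  Alternating-neg : ∀ {x} → Alternating x → Alternating (λ k → - x k)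
  Alternating-neg {x} alt k = step (alt k)
    where
    step : ∃[ q ] (0# ≤ q × q ≤ 1# × x (suc k) ≈ - (q * x k)) →
      ∃[ q ] (0# ≤ q × q ≤ 1# × - x (suc k) ≈ - (q * - x k))
    step (q , 0≤q , q≤1 , eq) = q , 0≤q , q≤1 , trans (-‿cong eq)
      (solve 2 (λ q x → :- (:- (q :* x)) := :- (q :* (:- x))) refl q (x k))

  -- Leibniz's estimate. The sum is x₀ minus the sum of the negated tail, which again alternates
  -- from a nonnegative first term and by induction lies between 0 and -x₁ = q x₀ ≤ x₀.
  alternating-sum : ∀ {x} → Alternating x → 0# ≤ x 0 → ∀ n → 0# ≤ Σ< n x × Σ< n x ≤ x 0
  alternating-sum         alt 0≤x₀ zero    = ≤-refl , 0≤x₀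
  alternating-sum {x} alt 0≤x₀ (suc n) = step (alt 0)
    where
    step : ∃[ q ] (0# ≤ q × q ≤ 1# × x 1 ≈ - (q * x 0)) → 0# ≤ Σ< (suc n) x × Σ< (suc n) x ≤ x 0
    step (q , 0≤q , q≤1 , eq) =
        ≤-trans (x≤y⇒0≤y-x (≤-trans (proj₂ tail) -x₁≤x₀)) (≤-reflexive (sym total)) ,
        ≤-trans (≤-reflexive total) (≤-resp-≈ refl (trans (+-congˡ -0#≈0#) (+-identityʳ _))
          (+-monoʳ-≤ (x 0) (-‿anti-mono-≤ (proj₁ tail))))
      where
      -x₁≈qx₀ : - x 1 ≈ q * x 0
      -x₁≈qx₀ = trans (-‿cong eq) (-‿involutive _)
      tail : 0# ≤ Σ< n (λ k → - x (suc k)) × Σ< n (λ k → - x (suc k)) ≤ - x 1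
      tail = alternating-sum (Alternating-neg (alt ∘ suc))
        (≤-trans (*-nonneg 0≤q 0≤x₀) (≤-reflexive (sym -x₁≈qx₀))) n
      -x₁≤x₀ : - x 1 ≤ x 0
      -x₁≤x₀ = ≤-resp-≈ (sym -x₁≈qx₀) (*-identityˡ _) (*-monoˡ-≤ 0≤x₀ q≤1)
      total : Σ< (suc n) x ≈ x 0 - Σ< n (λ k → - x (suc k))
      total = trans (Σ<-head n x) (+-congˡ (trans (sym (-‿involutive _)) (-‿cong (sym (Σ<-neg n (x ∘ suc))))))

  factor : ℕ → ℕ → Carrier
  factor a k = (fromℕ a - fromℕ (suc (2 ℕ.* k))) * recip (2 ℕ.+ a ℕ.+ 2 ℕ.* k)

  -- The hypergeometric terms  ∏_{j<k} (a - 1 - 2j) / (a + 3 + 2j).  For a = 0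
  -- these are Leibniz's (-1)ᵏ / (2k + 1).
  E : ℕ → ℕ → Carrier
  E a zero    = 1#
  E a (suc k) = E a k * factor a k

  fromℕ-1+2* : ∀ k → fromℕ (suc (2 ℕ.* k)) ≈ 1# + fromℕ 2 * fromℕ k
  fromℕ-1+2* k = +-congˡ (fromℕ-homo-* 2 k)

  -- The denominator of `factor` as a polynomial in `fromℕ a` and `fromℕ k`, the form the solver can
  -- use.
  den : ℕ → ℕ → Carrier
  den a k = fromℕ 3 + fromℕ a + fromℕ 2 * fromℕ k

  den-fromℕ : ∀ a k → fromℕ (suc (2 ℕ.+ a ℕ.+ 2 ℕ.* k)) ≈ den a k
  den-fromℕ a k = trans (fromℕ-homo-+ (3 ℕ.+ a) (2 ℕ.* k)) (+-cong (fromℕ-homo-+ 3 a) (fromℕ-homo-* 2 k))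

  den-pos : ∀ a k → 0# < den a k
  den-pos a k = <-resp-≈ refl (den-fromℕ a k) (suc-pos (2 ℕ.+ a ℕ.+ 2 ℕ.* k))

  factor-den : ∀ a k → factor a k * den a k ≈ fromℕ a - (1# + fromℕ 2 * fromℕ k)
  factor-den a k = trans (*-assoc _ _ _) (trans
    (*-congˡ (trans (*-congˡ (sym (den-fromℕ a k))) (recip-cancel (2 ℕ.+ a ℕ.+ 2 ℕ.* k))))
    (trans (*-identityʳ _) (+-congˡ (-‿cong (fromℕ-1+2* k)))))

  E-suc : ∀ a k → E a (suc k) * den a k ≈ E a k * (fromℕ a - (1# + fromℕ 2 * fromℕ k))
  E-suc a k = trans (*-assoc _ _ _) (*-congˡ (factor-den a k))

  -- Raising a by two shifts both products by one place, so only end factors survive in the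
  -- quotient: (a+1)/(a+1-2k) from the numerators and (a+3)/(a+3+2k) from the denominators. The
  -- identity is cleared of denominators because a + 1 - 2k may vanish.
  E-contiguous : ∀ a k → E (2 ℕ.+ a) k * ((fromℕ a + 1# - fromℕ 2 * fromℕ k) * den a k) ≈ (fromℕ a + 1#)
    * (fromℕ a + fromℕ 3) * E a k
  E-contiguous a zero    = solve 1 (λ a → :1 :*
    ((a :+ :1 :- nat 2 :* nat 0) :* (nat 3 :+ a :+ nat 2 :* nat 0)) := (a :+ :1) :* (a :+ nat 3) :* :1)
    refl (fromℕ a)
  E-contiguous a (suc k) = *-cancelˡ-≈ (den-pos a k)
    (trans rearrange₁ (trans (*-congʳ step₁) (trans rearrange₂
    (trans (*-congʳ (E-contiguous a k)) (trans rearrange₃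
    (trans (*-congˡ (sym (E-suc a k))) rearrange₄))))))
    where
    A = fromℕ a
    K = fromℕ k
    e = E (2 ℕ.+ a) k
    e′ = E (2 ℕ.+ a) (suc k)
    rearrange₁ : den a k * (e′ * ((A + 1# - fromℕ 2 * (1# + K)) * (fromℕ 3 + A + fromℕ 2 * (1# + K))))
      ≈ (e′ * (fromℕ 3 + (1# + (1# + A)) + fromℕ 2 * K)) * ((A - (1# + fromℕ 2 * K)) * den a k)
    rearrange₁ = solve 3 (λ e A K → (nat 3 :+ A :+ nat 2 :* K) :*
      (e :* ((A :+ :1 :- nat 2 :* (:1 :+ K)) :* (nat 3 :+ A :+ nat 2 :* (:1 :+ K))))
      := (e :* (nat 3 :+ (:1 :+ (:1 :+ A)) :+ nat 2 :* K)) :*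
        ((A :- (:1 :+ nat 2 :* K)) :* (nat 3 :+ A :+ nat 2 :* K))) refl e′ A K
    step₁ : e′ * (fromℕ 3 + (1# + (1# + A)) + fromℕ 2 * K) ≈ e * ((1# + (1# + A)) - (1# + fromℕ 2 * K))
    step₁ = E-suc (2 ℕ.+ a) k
    rearrange₂ : (e * ((1# + (1# + A)) - (1# + fromℕ 2 * K))) * ((A - (1# + fromℕ 2 * K)) * den a k)
      ≈ (e * ((A + 1# - fromℕ 2 * K) * den a k)) * (A - (1# + fromℕ 2 * K))
    rearrange₂ = solve 3 (λ e A K → (e :* ((:1 :+ (:1 :+ A)) :- (:1 :+ nat 2 :* K))) :*
      ((A :- (:1 :+ nat 2 :* K)) :* (nat 3 :+ A :+ nat 2 :* K))
      := (e :* ((A :+ :1 :- nat 2 :* K) :* (nat 3 :+ A :+ nat 2 :* K))) :* (A :- (:1 :+ nat 2 :* K)))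
        refl e A K
    rearrange₃ : (A + 1#) * (A + fromℕ 3) * E a k * (A - (1# + fromℕ 2 * K)) ≈ (A + 1#) * (A + fromℕ 3)
      * (E a k * (A - (1# + fromℕ 2 * K)))
    rearrange₃ = *-assoc _ _ _
    rearrange₄ : (A + 1#) * (A + fromℕ 3) * (E a (suc k) * den a k) ≈ den a k *
      ((A + 1#) * (A + fromℕ 3) * E a (suc k))
    rearrange₄ = solve 3 (λ c e d → c :* (e :* d) := d :* (c :* e)) refl _ _ _

  S : ℕ → ℕ → Carrier
  S a N = Σ< N (E a)

  -- Creative telescoping for Kummer's sum ₂F₁(1, (1-a)/2; (3+a)/2; -1): the
  -- right-hand side vanishes as N grows.
  S-contiguous : ∀ a N → (fromℕ a + 1#) * ((fromℕ a + fromℕ 2) * S (2 ℕ.+ a) N - (fromℕ a + fromℕ 3) * S a N)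
    ≈ - (fromℕ N * (den a N * E (2 ℕ.+ a) N))
  S-contiguous a zero    = solve 2 (λ A d → (A :+ :1) :* ((A :+ nat 2) :* :0 :- (A :+ nat 3) :* :0) :=
    :- (:0 :* d)) refl (fromℕ a) _
  S-contiguous a (suc N) = trans rearrange₁ (trans
    (+-cong (+-congˡ (-‿cong (sym (E-contiguous a N)))) (S-contiguous a N))
    (trans rearrange₂ (-‿cong (trans (*-congˡ (trans (sym (E-suc (2 ℕ.+ a) N)) (*-comm _ _))) rearrange₃))))
    where
    A = fromℕ a
    K = fromℕ N
    e = E (2 ℕ.+ a) N
    rearrange₁ : (A + 1#) * ((A + fromℕ 2) * (S (2 ℕ.+ a) N + e) - (A + fromℕ 3) * (S a N + E a N))
      ≈ ((A + 1#) * (A + fromℕ 2) * e - (A + 1#) * (A + fromℕ 3) * E a N) + (A + 1#) *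
        ((A + fromℕ 2) * S (2 ℕ.+ a) N - (A + fromℕ 3) * S a N)
    rearrange₁ = solve 5 (λ A s e t f → (A :+ :1) :* ((A :+ nat 2) :* (s :+ e) :- (A :+ nat 3) :* (t :+ f))
      := ((A :+ :1) :* (A :+ nat 2) :* e :- (A :+ :1) :* (A :+ nat 3) :* f) :+ (A :+ :1) :*
        ((A :+ nat 2) :* s :- (A :+ nat 3) :* t)) refl A (S (2 ℕ.+ a) N) e (S a N) (E a N)
    rearrange₂ : ((A + 1#) * (A + fromℕ 2) * e - e * ((A + 1# - fromℕ 2 * K) * den a N)) - K * (den a N * e)
      ≈ - ((1# + K) * (e * ((1# + (1# + A)) - (1# + fromℕ 2 * K))))
    rearrange₂ = solve 3 (λ A K e → ((A :+ :1) :* (A :+ nat 2) :* e :- e :*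
      ((A :+ :1 :- nat 2 :* K) :* (nat 3 :+ A :+ nat 2 :* K))) :- K :* ((nat 3 :+ A :+ nat 2 :* K) :* e)
      := :- ((:1 :+ K) :* (e :* ((:1 :+ (:1 :+ A)) :- (:1 :+ nat 2 :* K))))) refl A K e
    rearrange₃ : (1# + K) * ((fromℕ 3 + (1# + (1# + A)) + fromℕ 2 * K) * E (2 ℕ.+ a) (suc N)) ≈ (1# + K)
      * ((fromℕ 3 + A + fromℕ 2 * (1# + K)) * E (2 ℕ.+ a) (suc N))
    rearrange₃ = solve 3 (λ A K e → (:1 :+ K) :* ((nat 3 :+ (:1 :+ (:1 :+ A)) :+ nat 2 :* K) :* e) :=
      (:1 :+ K) :* ((nat 3 :+ A :+ nat 2 :* (:1 :+ K)) :* e)) refl A K (E (2 ℕ.+ a) (suc N))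

  4+4K-nonneg : ∀ k → 0# ≤ fromℕ 4 + fromℕ 4 * fromℕ k
  4+4K-nonneg k = +-nonneg (fromℕ-nonneg 4) (*-nonneg (fromℕ-nonneg 4) (fromℕ-nonneg k))

  -- After cross-multiplication the two sides differ by 4 + 4k.
  factor-mono : ∀ a k → factor a k ≤ factor (suc a) k
  factor-mono a k = *-cancelʳ-≤ (den-pos a k) (*-cancelʳ-≤ (den-pos (suc a) k)
    (≤-resp-≈ (*-congʳ (sym (factor-den a k)))
      (trans (*-congʳ (sym (factor-den (suc a) k)))
        (solve 3 (λ x y z → (x :* y) :* z := (x :* z) :* y) refl (factor (suc a) k) (den (suc a) k)
        (den a k)))
      (≤-resp-≈ refl difference (x≤x+y (4+4K-nonneg k)))))
    where
    difference : (fromℕ a - (1# + fromℕ 2 * fromℕ k)) * den (suc a) k + (fromℕ 4 + fromℕ 4 * fromℕ k)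
      ≈ ((1# + fromℕ a) - (1# + fromℕ 2 * fromℕ k)) * den a k
    difference = solve 2 (λ A K → (A :- (:1 :+ nat 2 :* K)) :* (nat 3 :+ (:1 :+ A) :+ nat 2 :* K) :+
      (nat 4 :+ nat 4 :* K)
      := ((:1 :+ A) :- (:1 :+ nat 2 :* K)) :* (nat 3 :+ A :+ nat 2 :* K)) refl (fromℕ a) (fromℕ k)

  factor-nonneg : ∀ a k → 2 ℕ.* k ℕ.< a → 0# ≤ factor a k
  factor-nonneg a k 2k<a = *-nonneg (x≤y⇒0≤y-x (fromℕ-mono-≤ 2k<a)) (<⇒≤ (recip-pos (2 ℕ.+ a ℕ.+ 2 ℕ.* k)))

  -- The condition says exactly that every factor with index j < k has 2j < a, hence is nonnegative,
  -- and nonnegative factors can be compared one by one.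
  E-mono : ∀ a k → 2 ℕ.* k ℕ.≤ suc a → 0# ≤ E a k × E a k ≤ E (suc a) k
  E-mono a zero    _ = 0≤1 , ≤-refl
  E-mono a (suc k) p = *-nonneg (proj₁ ih) (factor-nonneg a k 2k<a) ,
    *-mono-≤ (factor-nonneg a k 2k<a) (≤-trans (proj₁ ih) (proj₂ ih)) (proj₂ ih) (factor-mono a k)
    where
    2k<a : 2 ℕ.* k ℕ.< a
    2k<a = ℕ.s≤s⁻¹ (≡.subst (ℕ._≤ suc a) (ℕ.*-suc 2 k) p)
    ih : 0# ≤ E a k × E a k ≤ E (suc a) k
    ih = E-mono a k (ℕ.m≤n⇒m≤1+n (ℕ.<⇒≤ 2k<a))

  -- The last numerator is (2n+1) - (2n+1).
  E-odd-vanishes : ∀ n → E (1 ℕ.+ n ℕ.* 2) (suc n) ≈ 0#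
  E-odd-vanishes n = trans (*-congˡ (trans (*-congʳ
    (trans (+-congʳ (reflexive (≡.cong (fromℕ ∘ suc) (ℕ.*-comm n 2)))) (-‿inverseʳ _))) (zeroˡ _)))
    (zeroʳ _)

  -- With a = 2n, the numerators are negative from index n on, and q = (1+2k-a)/(a+3+2k) falls short
  -- of 1 by 2(1+a) in the numerator.
  E-even-step : ∀ n k → n ℕ.≤ k → ∃[ q ] (0# ≤ q × q ≤ 1# × E (n ℕ.* 2) (suc k) ≈ - (q * E (n ℕ.* 2) k))
  E-even-step n k n≤k = - factor a k , 0≤q , q≤1 , solve 2 (λ e f → e :* f := :- ((:- f) :* e)) refl
    (E a k) (factor a k)
    where
    a = n ℕ.* 2
    A = fromℕ a
    K = fromℕ k
    0≤q : 0# ≤ - factor a k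
    0≤q = ≤-resp-≈ refl (solve 3 (λ x y z → (y :- x) :* z := :- ((x :- y) :* z)) refl A
      (fromℕ (suc (2 ℕ.* k))) (recip (2 ℕ.+ a ℕ.+ 2 ℕ.* k)))
      (*-nonneg (x≤y⇒0≤y-x (fromℕ-mono-≤ a≤1+2k)) (<⇒≤ (recip-pos (2 ℕ.+ a ℕ.+ 2 ℕ.* k))))
      where
      a≤1+2k : a ℕ.≤ suc (2 ℕ.* k)
      a≤1+2k = ℕ.m≤n⇒m≤1+n (≡.subst (a ℕ.≤_) (ℕ.*-comm k 2) (ℕ.*-monoˡ-≤ 2 n≤k))
    q≤1 : - factor a k ≤ 1#
    q≤1 = *-cancelʳ-≤ (den-pos a k) (≤-resp-≈
      (trans (-‿cong (sym (factor-den a k))) (-‿distribˡ-* _ _))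
      (trans (solve 2 (λ A K → :- (A :- (:1 :+ nat 2 :* K)) :+ nat 2 :* (:1 :+ A) := nat 3 :+ A :+ nat 2
        :* K) refl A K) (sym (*-identityˡ _)))
      (x≤x+y (*-nonneg (fromℕ-nonneg 2) (fromℕ-nonneg (suc a)))))

  E-alternating : ∀ n m → n ℕ.≤ m → Alternating (λ i → E (n ℕ.* 2) (m ℕ.+ i))
  E-alternating n m n≤m i = ≡.subst (λ j → ∃[ q ]
    (0# ≤ q × q ≤ 1# × E (n ℕ.* 2) j ≈ - (q * E (n ℕ.* 2) (m ℕ.+ i))))
    (≡.sym (ℕ.+-suc m i)) (E-even-step n (m ℕ.+ i) (ℕ.≤-trans n≤m (ℕ.m≤m+n m i)))

  E-even-nonneg : ∀ n → 0# ≤ E (n ℕ.* 2) n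
  E-even-nonneg n = proj₁ (E-mono (n ℕ.* 2) n (ℕ.m≤n⇒m≤1+n (ℕ.≤-reflexive (ℕ.*-comm 2 n))))

  -- From index n on the terms alternate, beginning with a nonnegative one, so the later partial
  -- sums stay between the first two.
  S-even-bounds : ∀ n k → n ℕ.≤ k → S (n ℕ.* 2) n ≤ S (n ℕ.* 2) k × S (n ℕ.* 2) k ≤ S (n ℕ.* 2) (suc n)
  S-even-bounds n k n≤k = ≡.subst (λ k → S a n ≤ S a k × S a k ≤ S a (suc n)) (ℕ.m+[n∸m]≡n n≤k)
    (bounds (k ℕ.∸ n))
    where
    a = n ℕ.* 2
    E[n+0] : E a (n ℕ.+ 0) ≈ E a n
    E[n+0] = reflexive (≡.cong (E a) (ℕ.+-identityʳ n))
    bounds : ∀ m → S a n ≤ S a (n ℕ.+ m) × S a (n ℕ.+ m) ≤ S a (suc n)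
    bounds m = ≤-resp-≈ refl (sym (Σ<-split n m (E a))) (x≤x+y (proj₁ tail)) ,
      ≤-resp-≈ (sym (Σ<-split n m (E a))) (+-congˡ E[n+0]) (+-monoʳ-≤ (S a n) (proj₂ tail))
      where
      tail : 0# ≤ Σ< m (λ i → E a (n ℕ.+ i)) × Σ< m (λ i → E a (n ℕ.+ i)) ≤ E a (n ℕ.+ 0)
      tail = alternating-sum (E-alternating n n ℕ.≤-refl) (≤-resp-≈ refl (sym E[n+0]) (E-even-nonneg n)) m

  -- The complete sum at the odd parameter 2n + 1, whose terms vanish from index n + 1 on.
  T : ℕ → Carrier
  T n = S (1 ℕ.+ n ℕ.* 2) (suc n)

  -- The cut at `suc n` serves both comparisons: it is the upper end in `S-even-bounds n` and the
  -- lower end in `S-even-bounds (suc n)`, and up to there all terms increase with the parameter.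
  S-even≤T : ∀ n → S (n ℕ.* 2) (suc n) ≤ T n
  S-even≤T n = Σ<-mono (suc n) λ k k≤n → proj₂ (E-mono (n ℕ.* 2) k
    (ℕ.m≤n⇒m≤1+n (≡.subst (ℕ._≤ n ℕ.* 2) (ℕ.*-comm k 2) (ℕ.*-monoˡ-≤ 2 (ℕ.s≤s⁻¹ k≤n)))))

  T≤S-even : ∀ n → T n ≤ S (suc n ℕ.* 2) (suc n)
  T≤S-even n = Σ<-mono (suc n) λ k k≤n → proj₂ (E-mono (1 ℕ.+ n ℕ.* 2) k
    (ℕ.m≤n⇒m≤1+n (ℕ.m≤n⇒m≤1+n (≡.subst (ℕ._≤ n ℕ.* 2) (ℕ.*-comm k 2) (ℕ.*-monoˡ-≤ 2 (ℕ.s≤s⁻¹ k≤n))))))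

  -- Cut at N = n + 2, `S-contiguous` is exact: its right-hand side contains a term that vanishes by
  -- `E-odd-vanishes`.
  T-suc : ∀ n → (fromℕ (1 ℕ.+ n ℕ.* 2) + fromℕ 2) * T (suc n) ≈ (fromℕ (1 ℕ.+ n ℕ.* 2) + fromℕ 3) * T n
  T-suc n = *-cancelˡ-≈ 0<A+1 (trans split (trans (+-congʳ contiguous)
    (trans (+-identityˡ _) (*-congˡ (*-congˡ last)))))
    where
    a = 1 ℕ.+ n ℕ.* 2
    A = fromℕ a
    0<A+1 : 0# < A + 1#
    0<A+1 = <-≤-trans (suc-pos (n ℕ.* 2)) (x≤x+y 0≤1)
    S′ = S (2 ℕ.+ a) (2 ℕ.+ n)
    split : (A + 1#) * ((A + fromℕ 2) * S′) ≈ (A + 1#) *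
      ((A + fromℕ 2) * S′ - (A + fromℕ 3) * S a (2 ℕ.+ n)) + (A + 1#) * ((A + fromℕ 3) * S a (2 ℕ.+ n))
    split = solve 3 (λ c x y → c :* x := c :* (x :- y) :+ c :* y) refl _ _ _
    contiguous : (A + 1#) * ((A + fromℕ 2) * S′ - (A + fromℕ 3) * S a (2 ℕ.+ n)) ≈ 0#
    contiguous = trans (S-contiguous a (2 ℕ.+ n))
      (trans (-‿cong (trans (*-congˡ (trans (*-congˡ (E-odd-vanishes (suc n))) (zeroʳ _))) (zeroʳ _)))
      -0#≈0#)
    last : S a (2 ℕ.+ n) ≈ T n
    last = trans (+-congˡ (E-odd-vanishes n)) (+-identityʳ _)

  E-0 : ∀ k → E 0 k ≈ (- 1#) ^ k * recip (2 ℕ.* k)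
  E-0 k = *-cancelˡ-≈ (suc-pos (2 ℕ.* k)) (trans (cleared k) (sym (trans
    (solve 3 (λ s r d → d :* (s :* r) := s :* (r :* d)) refl ((- 1#) ^ k) (recip (2 ℕ.* k))
      (fromℕ (suc (2 ℕ.* k))))
    (trans (*-congˡ (recip-cancel (2 ℕ.* k))) (*-identityʳ _)))))
    where
    cleared : ∀ k → fromℕ (suc (2 ℕ.* k)) * E 0 k ≈ (- 1#) ^ k
    cleared zero    = trans (*-identityʳ _) fromℕ-1
    cleared (suc k) = trans (*-congʳ den₀) (trans (*-comm _ _)
      (trans (E-suc 0 k) (trans rearrange (*-congˡ (trans (*-congʳ (sym (fromℕ-1+2* k))) (cleared k))))))
      where
      den₀ : fromℕ (suc (2 ℕ.* suc k)) ≈ den 0 k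
      den₀ = trans (fromℕ-1+2* (suc k)) (solve 1 (λ K →
        :1 :+ nat 2 :* (:1 :+ K) := nat 3 :+ :0 :+ nat 2 :* K) refl (fromℕ k))
      rearrange : E 0 k * (0# - (1# + fromℕ 2 * fromℕ k)) ≈ (- 1#) * ((1# + fromℕ 2 * fromℕ k) * E 0 k)
      rearrange = solve 2 (λ e K → e :* (:0 :- (:1 :+ nat 2 :* K)) := (:- :1) :*
        ((:1 :+ nat 2 :* K) :* e)) refl (E 0 k) (fromℕ k)

  leibniz-S : ∀ n → leibniz n ≈ fromℕ 4 * S 0 n
  leibniz-S n = *-congˡ (trans (Σ<-sum n (λ k → (- 1#) ^ k / fromℕ (suc (2 ℕ.* k)) ⟨ suc-pos (2 ℕ.* k) ⟩))
    (Σ<-cong n λ k → trans (*-congˡ (sym (*-identityˡ _))) (sym (E-0 k))))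

  -1^-sign : ∀ k → (- 1#) ^ k ≈ 1# ⊎ (- 1#) ^ k ≈ - 1#
  -1^-sign zero    = inj₁ refl
  -1^-sign (suc k) = [ (λ p → inj₂ (trans (*-congˡ p) (*-identityʳ _))) , (λ p →
    inj₁ (trans (*-congˡ p) (solve 0 ((:- :1) :* (:- :1) := :1) refl))) ]′ (-1^-sign k)

  -- The tail alternates and is bounded by its first term, of modulus 1/(2n+1). Its sign depends on
  -- n, and in the negative case the estimate is applied to the negated tail.
  S-0-tail : ∀ n m → S 0 (n ℕ.+ m) ≤ S 0 n + recip (2 ℕ.* n) × S 0 n ≤ S 0 (n ℕ.+ m) + recip (2 ℕ.* n)
  S-0-tail n m = [ positive , negative ]′ (-1^-sign n)
    where
    r = recip (2 ℕ.* n)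
    0≤r : 0# ≤ r
    0≤r = <⇒≤ (recip-pos (2 ℕ.* n))
    x : ℕ → Carrier
    x i = E 0 (n ℕ.+ i)
    x₀ : x 0 ≈ E 0 n
    x₀ = reflexive (≡.cong (E 0) (ℕ.+-identityʳ n))
    split : S 0 (n ℕ.+ m) ≈ S 0 n + Σ< m x
    split = Σ<-split n m (E 0)
    alternating : Alternating x
    alternating = E-alternating 0 n z≤n
    Bounds : Set _
    Bounds = S 0 (n ℕ.+ m) ≤ S 0 n + r × S 0 n ≤ S 0 (n ℕ.+ m) + r
    positive : (- 1#) ^ n ≈ 1# → Bounds
    positive p = ≤-resp-≈ (sym split) refl (+-monoʳ-≤ (S 0 n) (≤-trans (proj₂ tail) (≤-reflexive x₀≈r))) ,
      ≤-trans (≤-resp-≈ refl (sym split) (x≤x+y (proj₁ tail))) (x≤x+y 0≤r)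
      where
      x₀≈r : x 0 ≈ r
      x₀≈r = trans x₀ (trans (E-0 n) (trans (*-congʳ p) (*-identityˡ r)))
      tail : 0# ≤ Σ< m x × Σ< m x ≤ x 0
      tail = alternating-sum alternating (≤-trans 0≤r (≤-reflexive (sym x₀≈r))) m
    negative : (- 1#) ^ n ≈ - 1# → Bounds
    negative p = ≤-trans (≤-resp-≈ (sym split) (+-identityʳ _) (+-monoʳ-≤ (S 0 n) Σx≤0)) (x≤x+y 0≤r) ,
      ≤-resp-≈ (solve 2 (λ s e → s :+ e :- e := s) refl (S 0 n) (Σ< m x)) (sym (+-congʳ split))
        (+-monoʳ-≤ (S 0 n + Σ< m x) -Σx≤r)
      where
      -x₀≈r : - x 0 ≈ r
      -x₀≈r = trans (-‿cong (trans x₀ (trans (E-0 n) (*-congʳ p))))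
        (solve 1 (λ r → :- ((:- :1) :* r) := r) refl r)
      tail : 0# ≤ Σ< m (λ i → - x i) × Σ< m (λ i → - x i) ≤ - x 0
      tail = alternating-sum (Alternating-neg alternating) (≤-trans 0≤r (≤-reflexive (sym -x₀≈r))) m
      -Σx≤r : - Σ< m x ≤ r
      -Σx≤r = ≤-resp-≈ (Σ<-neg m x) -x₀≈r (proj₂ tail)
      Σx≤0 : Σ< m x ≤ 0#
      Σx≤0 = ≤-resp-≈ (trans (-‿cong (Σ<-neg m x)) (-‿involutive _)) -0#≈0# (-‿anti-mono-≤ (proj₁ tail))

  S-0-Cauchy : IsCauchy (S 0)
  S-0-Cauchy = Cauchy-from-tails S-0-tail (O[1/n]⟶0 1# 0 (λ k _ → <⇒≤ (recip-pos (2 ℕ.* k)))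
    λ k _ → ≤-resp-≈ refl (recip-cancel (2 ℕ.* k))
      (*-monoʳ-≤ (<⇒≤ (recip-pos (2 ℕ.* k))) (fromℕ-mono-≤ (ℕ.m≤n⇒m≤1+n (ℕ.m≤m+n k _)))))

  π/4 : Carrier
  π/4 = proj₁ (complete (S 0) S-0-Cauchy)

  S-0⟶π/4 : S 0 ⟶ π/4
  S-0⟶π/4 = proj₂ (complete (S 0) S-0-Cauchy)

  -- The factor g may vary with k. Multiplication by it keeps only non-strict bounds, so strictness
  -- is recovered from ε/2 < ε.
  ⟶0-damped : ∀ {s t} N → s ⟶ 0# → (∀ k → N ℕ.≤ k → ∃[ g ] (0# ≤ g × g ≤ 1# × t k ≈ g * s k)) → t ⟶ 0#
  ⟶0-damped {s} {t} N lim damped = Within⇒⟶ λ ε 0<ε → convert 0<ε (⟶⇒Within lim (half-pos 0<ε))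
    where
    half<ε : ∀ {ε} → 0# < ε → half ε < ε
    half<ε {ε} 0<ε = <-resp-≈ (+-identityʳ _) (half-+-half ε) (+-monoʳ-< (half ε) (half-pos 0<ε))
    bound : ∀ {ε g x} → 0# < ε → 0# ≤ g → g ≤ 1# → x < half ε → g * x < ε
    bound {ε} {g} 0<ε 0≤g g≤1 x< = ≤-<-trans (≤-trans (*-monoʳ-≤ 0≤g (<⇒≤ x<))
      (≤-resp-≈ refl (*-identityˡ _) (*-monoˡ-≤ (<⇒≤ (half-pos 0<ε)) g≤1))) (half<ε 0<ε)
    convert : ∀ {ε} → 0# < ε → WithinEventually s 0# (half ε) → WithinEventually t 0# ε
    convert {ε} 0<ε (M , p) = N ℕ.+ M , λ k N+M≤k →
      within (p k (ℕ.≤-trans (ℕ.m≤n+m M N) N+M≤k)) (damped k (ℕ.≤-trans (ℕ.m≤m+n N M) N+M≤k))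
      where
      within : ∀ {k} → Within (half ε) (s k) 0# → ∃[ g ] (0# ≤ g × g ≤ 1# × t k ≈ g * s k) → Within ε (t k) 0#
      within {k} (s<ε , 0<s+ε) (g , 0≤g , g≤1 , eq) =
        <-resp-≈ (sym eq) (sym (+-identityˡ ε)) (bound 0<ε 0≤g g≤1 (<-resp-≈ refl (+-identityˡ _) s<ε)) ,
        <-resp-≈ (-‿inverseʳ (t k)) refl (+-monoʳ-< (t k)
          (<-resp-≈ (trans (sym (-‿distribʳ-* g (s k))) (-‿cong (sym eq))) refl
          (bound 0<ε 0≤g g≤1 (<-resp-≈ (+-identityˡ _)
            (solve 2 (λ s h → s :+ h :- s := h) refl (s k) (half ε)) (+-monoˡ-< (- s k) 0<s+ε)))))

  ratio : ℕ → Carrier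
  ratio n = fromℕ (3 ℕ.+ n ℕ.* 2) * recip (1 ℕ.+ n ℕ.* 2)

  ratio-cancel : ∀ n → fromℕ (2 ℕ.+ n ℕ.* 2) * ratio n ≈ fromℕ (3 ℕ.+ n ℕ.* 2)
  ratio-cancel n = trans (solve 3 (λ a b r → a :* (b :* r) := b :* (r :* a)) refl
    (fromℕ (2 ℕ.+ n ℕ.* 2)) (fromℕ (3 ℕ.+ n ℕ.* 2)) (recip (1 ℕ.+ n ℕ.* 2)))
    (trans (*-congˡ (recip-cancel (1 ℕ.+ n ℕ.* 2))) (*-identityʳ _))

  ratio-pos : ∀ n → 0# < ratio n
  ratio-pos n = *-pos (suc-pos (2 ℕ.+ n ℕ.* 2)) (recip-pos (1 ℕ.+ n ℕ.* 2))

  -- P n = ∏_{1≤j≤n} (2j + 1) / (2j)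
  P : ℕ → Carrier
  P zero    = 1#
  P (suc n) = ratio n * P n

  P-pos : ∀ n → 0# < P n
  P-pos zero    = 0<1
  P-pos (suc n) = *-pos (ratio-pos n) (P-pos n)

  -- With a = 2n, the defect at finite N of the limit relation (a+2) S(a+2) = (a+3) S(a), divided by
  -- a + 3.
  S-even-remainder : ℕ → ℕ → Carrier
  S-even-remainder n N = recip (2 ℕ.+ n ℕ.* 2) * (fromℕ (2 ℕ.+ n ℕ.* 2) * S (suc n ℕ.* 2) N) - S (n ℕ.* 2) N

  S-even-remainder-spec : ∀ n N → S (suc n ℕ.* 2) N ≈ ratio n * (S (n ℕ.* 2) N + S-even-remainder n N)
  S-even-remainder-spec n N = sym (trans
    (solve 6 (λ a b r q s t → (b :* r) :* (s :+ (q :* (a :* t) :- s)) := (r :* a) :* (q :* b) :* t) refl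
      (fromℕ (2 ℕ.+ a)) (fromℕ (3 ℕ.+ a)) (recip (1 ℕ.+ a)) (recip (2 ℕ.+ a)) (S a N) (S (2 ℕ.+ a) N))
    (trans (*-congʳ (trans (*-cong (recip-cancel (1 ℕ.+ a)) (recip-cancel (2 ℕ.+ a))) (*-identityˡ 1#)))
      (*-identityˡ _)))
    where a = n ℕ.* 2

  -- By the two contiguity relations the remainder is k/(2k-a-1) times `E a k`. The quotient is at
  -- most 1 for k > a, and the terms tend to zero because the series converges.
  S-even-remainder⟶0 : ∀ n → S (n ℕ.* 2) ⟶ P n * π/4 → S-even-remainder n ⟶ 0#
  S-even-remainder⟶0 n lim = ⟶0-damped (suc a)
    (⟶-cong (λ k → solve 2 (λ s e → s :+ e :- s := e) refl (S a k) (E a k)) refl (⟶-difference lim)) damped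
    where
    a = n ℕ.* 2
    A = fromℕ a
    damped : ∀ k → suc a ℕ.≤ k → ∃[ g ] (0# ≤ g × g ≤ 1# × S-even-remainder n k ≈ g * E a k)
    damped k a<k = g , /-nonneg (fromℕ-nonneg k) 0<y , g≤1 , *-cancelˡ-≈
      (*-pos (*-pos (suc-pos a) 0<y) (suc-pos (2 ℕ.+ a)))
      (trans clear (trans (*-congˡ (S-contiguous a k))
        (trans flip (trans (*-congˡ (E-contiguous a k))
        (trans (*-congʳ (sym (/-*-cancel K 0<y))) collect)))))
      where
      K = fromℕ k
      y : Carrier
      y = K + (K - fromℕ (suc a))
      K≤y : K ≤ y
      K≤y = x≤x+y (x≤y⇒0≤y-x (fromℕ-mono-≤ a<k))
      0<y : 0# < y
      0<y = <-≤-trans (fromℕ-pos k (ℕ.≤-trans (s≤s z≤n) a<k)) K≤y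
      g : Carrier
      g = K / y ⟨ 0<y ⟩
      g≤1 : g ≤ 1#
      g≤1 = *-cancelʳ-≤ 0<y (≤-resp-≈ (sym (/-*-cancel K 0<y)) (sym (*-identityˡ y)) K≤y)
      s′ = S (2 ℕ.+ a) k
      s = S a k
      e′ = E (2 ℕ.+ a) k
      clear : fromℕ (suc a) * y * fromℕ (3 ℕ.+ a) * S-even-remainder n k ≈ y *
        ((A + 1#) * ((A + fromℕ 2) * s′ - (A + fromℕ 3) * s))
      clear = trans
        (solve 5 (λ A y r s′ s → (:1 :+ A) :* y :* (:1 :+ (:1 :+ (:1 :+ A))) :*
          (r :* ((:1 :+ (:1 :+ A)) :* s′) :- s)
          := y :* ((A :+ :1) :* ((r :* (:1 :+ (:1 :+ (:1 :+ A)))) :* ((A :+ nat 2) :* s′) :-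
            (A :+ nat 3) :* s))) refl A y (recip (2 ℕ.+ a)) s′ s)
        (*-congˡ (*-congˡ (+-congʳ (trans (*-congʳ (recip-cancel (2 ℕ.+ a))) (*-identityˡ _)))))
      flip : y * - (K * (den a k * e′)) ≈ K * (e′ * ((A + 1# - fromℕ 2 * K) * den a k))
      flip = solve 4 (λ A K d e → (K :+ (K :- (:1 :+ A))) :* (:- (K :* (d :* e))) := K :*
        (e :* ((A :+ :1 :- nat 2 :* K) :* d))) refl A K (den a k) e′
      collect : g * y * ((A + 1#) * (A + fromℕ 3) * E a k) ≈ fromℕ (suc a) * y * fromℕ (3 ℕ.+ a) * (g * E a k)
      collect = solve 4 (λ g y A e → g :* y :* ((A :+ :1) :* (A :+ nat 3) :* e) := (:1 :+ A) :* y :*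
        (:1 :+ (:1 :+ (:1 :+ A))) :* (g :* e)) refl g y A (E a k)

  S-even⟶ : ∀ n → S (n ℕ.* 2) ⟶ P n * π/4
  S-even⟶ zero    = ⟶-cong (λ _ → refl) (sym (*-identityˡ π/4)) S-0⟶π/4
  S-even⟶ (suc n) = ⟶-cong (λ N → sym (S-even-remainder-spec n N))
    (trans (*-congˡ (+-identityʳ _)) (sym (*-assoc _ _ _)))
    (⟶-* (ratio-pos n) (⟶-+ (S-even⟶ n) (S-even-remainder⟶0 n (S-even⟶ n))))

  P*π/4≤T : ∀ n → P n * π/4 ≤ T n
  P*π/4≤T n = ⟶-≤ n (S-even⟶ n) λ k n≤k → ≤-trans (proj₂ (S-even-bounds n k n≤k)) (S-even≤T n)

  T≤P*π/4 : ∀ n → T n ≤ P (suc n) * π/4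
  T≤P*π/4 n = ⟶-≥ (suc n) (S-even⟶ (suc n)) λ k n<k →
    ≤-trans (T≤S-even n) (proj₁ (S-even-bounds (suc n) k n<k))

  -- A step multiplies T by (2n+4)/(2n+3) and P by (2n+3)/(2n+2), hence the product by (n+2)/(n+1).
  -- Together with the squeeze of T between `P n * π/4` and `P (suc n) * π/4`, this encloses the
  -- square of P in terms of π.
  T*P : ∀ n → T n * P n ≈ fromℕ (suc n)
  T*P zero    = solve 0 ((:0 :+ :1) :* :1 := nat 1) refl
  T*P (suc n) = *-cancelˡ-≈ (*-pos (suc-pos (2 ℕ.+ a)) (suc-pos (1 ℕ.+ a)))
    (trans (solve 5 (λ b c t r p → b :* c :* (t :* (r :* p)) := (b :* t) :* (c :* r) :* p) refl
      (fromℕ (3 ℕ.+ a)) (fromℕ (2 ℕ.+ a)) (T (suc n)) (ratio n) (P n))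
    (trans (*-congʳ (*-cong T-suc′ (ratio-cancel n)))
    (trans (solve 4 (λ d t b p → (d :* t) :* b :* p := d :* b :* (t :* p)) refl (fromℕ (4 ℕ.+ a)) (T n)
      (fromℕ (3 ℕ.+ a)) (P n))
    (trans (*-congˡ (T*P n)) (trans (*-cong (*-congʳ (+-congˡ (+-congˡ (+-congˡ (+-congˡ double))))) refl)
      (trans (solve 2 (λ N b → (:1 :+ (:1 :+ (:1 :+ (:1 :+ nat 2 :* N)))) :* b :* (:1 :+ N) := b :*
        (:1 :+ (:1 :+ nat 2 :* N)) :* (:1 :+ (:1 :+ N))) refl (fromℕ n) (fromℕ (3 ℕ.+ a)))
        (*-congʳ (*-congˡ (sym (+-congˡ (+-congˡ double)))))))))))
    where
    a = n ℕ.* 2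
    double : fromℕ a ≈ fromℕ 2 * fromℕ n
    double = trans (fromℕ-homo-* n 2) (*-comm _ _)
    T-suc′ : fromℕ (3 ℕ.+ a) * T (suc n) ≈ fromℕ (4 ℕ.+ a) * T n
    T-suc′ = trans (solve 2 (λ A t → (:1 :+ (:1 :+ (:1 :+ A))) :* t := ((:1 :+ A) :+ nat 2) :* t) refl
      (fromℕ a) (T (suc n)))
      (trans (T-suc n) (solve 2 (λ A t → ((:1 :+ A) :+ nat 3) :* t := (:1 :+ (:1 :+ (:1 :+ (:1 :+ A))))
        :* t) refl (fromℕ a) (T n)))


-- Asymptotics of the limiting ratio

module Asymptotics {c ℓ₁ ℓ₂} (ℝ : RealField c ℓ₁ ℓ₂) where
  open RealField ℝ
  open Analysis ℝ
  open OrderedField ℝ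
  open Limits ℝ
  open Wallis ℝ
  open Binomial

  -- Indexed by n = m - 1, which removes the truncated subtraction.
  ρ : ℕ → Carrier
  ρ n = limitRatio (suc n)

  2^-pos : ∀ n → 0# < fromℕ (2 ℕ.^ n)
  2^-pos n = fromℕ-pos (2 ℕ.^ n) (ℕ.m^n>0 2 n)

  ρ-cancel : ∀ n → ρ n * fromℕ (2 ℕ.^ n) ≈ fromℕ (middle n)
  ρ-cancel n = /-*-cancel (fromℕ (middle n)) (2^-pos n)

  ρ-nonneg : ∀ n → 0# ≤ ρ n
  ρ-nonneg n = /-nonneg (fromℕ-nonneg (middle n)) (2^-pos n)

  ρ-even : ∀ k → ρ (2 ℕ.+ k ℕ.* 2) ≈ ρ (1 ℕ.+ k ℕ.* 2)
  ρ-even k = *-cancelˡ-≈ (2^-pos (2 ℕ.+ n)) (trans (*-comm _ _)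
    (trans (ρ-cancel (2 ℕ.+ n)) (trans (reflexive (≡.cong fromℕ (middle-even k)))
    (trans (fromℕ-homo-* 2 (middle (1 ℕ.+ n))) (trans (*-congˡ (sym (ρ-cancel (1 ℕ.+ n)))) (trans
      (solve 3 (λ two r p → two :* (r :* p) := (two :* p) :* r) refl (fromℕ 2) (ρ (1 ℕ.+ n))
        (fromℕ (2 ℕ.^ (1 ℕ.+ n))))
      (*-congʳ (sym (fromℕ-homo-* 2 (2 ℕ.^ (1 ℕ.+ n)))))))))))
    where n = k ℕ.* 2

  middle-odd-suc : ∀ k → (4 ℕ.+ k ℕ.* 2) ℕ.* middle (3 ℕ.+ k ℕ.* 2) ≡ 4 ℕ.*
    ((3 ℕ.+ k ℕ.* 2) ℕ.* middle (1 ℕ.+ k ℕ.* 2))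
  middle-odd-suc k = ≡.trans (double k (middle (3 ℕ.+ k ℕ.* 2)))
    (≡.trans (≡.cong (2 ℕ.*_) (middle-odd (suc k)))
    (≡.trans (≡.cong (λ c → 2 ℕ.* ((3 ℕ.+ k ℕ.* 2) ℕ.* c)) (middle-even k))
      (regroup (3 ℕ.+ k ℕ.* 2) (middle (1 ℕ.+ k ℕ.* 2)))))
    where
    double : ∀ k c → (4 ℕ.+ k ℕ.* 2) ℕ.* c ≡ 2 ℕ.* (suc (suc k) ℕ.* c)
    double = solve-∀
    regroup : ∀ a c → 2 ℕ.* (a ℕ.* (2 ℕ.* c)) ≡ 4 ℕ.* (a ℕ.* c)
    regroup = solve-∀

  -- Both sides start at 1 and gain the factor (2k+3)/(2k+2) in each step. This is where the central
  -- binomial coefficients meet Wallis's product.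
  ρ-P : ∀ k → fromℕ (2 ℕ.+ k ℕ.* 2) * ρ (1 ℕ.+ k ℕ.* 2) ≈ P k
  ρ-P zero    = trans (*-comm _ _) (trans (ρ-cancel 1) fromℕ-1)
  ρ-P (suc k) = *-cancelˡ-≈ (2^-pos (3 ℕ.+ n)) (trans
    (solve 3 (λ p a r → p :* (a :* r) := a :* (r :* p)) refl (fromℕ (2 ℕ.^ (3 ℕ.+ n))) (fromℕ (4 ℕ.+ n))
      (ρ (3 ℕ.+ n)))
    (trans (*-congˡ (ρ-cancel (3 ℕ.+ n))) (trans (sym (fromℕ-homo-* (4 ℕ.+ n) (middle (3 ℕ.+ n))))
      (trans (reflexive (≡.cong fromℕ (middle-odd-suc k)))
    (trans (fromℕ-homo-* 4 ((3 ℕ.+ n) ℕ.* middle (1 ℕ.+ n)))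
      (trans (*-congˡ (trans (fromℕ-homo-* (3 ℕ.+ n) (middle (1 ℕ.+ n)))
      (*-cong (sym (ratio-cancel k)) (sym (ρ-cancel (1 ℕ.+ n))))))
    (trans (solve 5 (λ q a r x p → q :* ((a :* r) :* (x :* p)) := (q :* p) :* (r :* (a :* x))) refl
      (fromℕ 4) (fromℕ (2 ℕ.+ n)) (ratio k) (ρ (1 ℕ.+ n)) (fromℕ (2 ℕ.^ (1 ℕ.+ n))))
      (*-cong (trans (sym (fromℕ-homo-* 4 (2 ℕ.^ (1 ℕ.+ n))))
        (reflexive (≡.cong fromℕ (quadruple (2 ℕ.^ (1 ℕ.+ n)))))) (*-congˡ (ρ-P k))))))))))
    where
    n = k ℕ.* 2
    quadruple : ∀ p → 4 ℕ.* p ≡ 2 ℕ.* (2 ℕ.* p)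
    quadruple = solve-∀

  π : Carrier
  π = fromℕ 4 * π/4

  π/4-pos : 0# < π/4
  π/4-pos = *-cancelˡ-< (P-pos 1) (<-resp-≈ (sym (zeroʳ (P 1))) refl
    (<-≤-trans (<-resp-≈ refl (sym (+-identityˡ 1#)) 0<1) (T≤P*π/4 0)))

  π-pos : 0# < π
  π-pos = *-pos (suc-pos 3) π/4-pos

  π-isPi : IsPi π
  π-isPi = ⟶-cong (λ n → sym (leibniz-S n)) refl (⟶-* (suc-pos 3) S-0⟶π/4)

  c≈2[k+1] : ∀ k → fromℕ (2 ℕ.+ k ℕ.* 2) ≈ fromℕ 2 * fromℕ (suc k)
  c≈2[k+1] k = trans (fromℕ-homo-* (suc k) 2) (*-comm _ _)

  -- Multiply `P*π/4≤T` by 4 P: the right side becomes 4(k+1) by `T*P`, the left one π P², and P is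
  -- (2k+2) ρ.
  ρ²-odd-upper : ∀ k → π * (fromℕ (2 ℕ.+ k ℕ.* 2) * (ρ (1 ℕ.+ k ℕ.* 2) * ρ (1 ℕ.+ k ℕ.* 2))) ≤ fromℕ 2
  ρ²-odd-upper k = *-cancelˡ-≤ (suc-pos (1 ℕ.+ k ℕ.* 2))
    (≤-resp-≈ left right (*-monoʳ-≤ (fromℕ-nonneg 4) (*-monoʳ-≤ (<⇒≤ (P-pos k)) (P*π/4≤T k))))
    where
    d = fromℕ (2 ℕ.+ k ℕ.* 2)
    r = ρ (1 ℕ.+ k ℕ.* 2)
    left : fromℕ 4 * (P k * (P k * π/4)) ≈ d * (π * (d * (r * r)))
    left = trans (*-congˡ (*-cong (sym (ρ-P k)) (*-congʳ (sym (ρ-P k)))))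
      (solve 4 (λ f q c r → f :* ((c :* r) :* ((c :* r) :* q)) := c :* ((f :* q) :* (c :* (r :* r))))
        refl (fromℕ 4) π/4 d r)
    right : fromℕ 4 * (P k * T k) ≈ d * fromℕ 2
    right = trans (*-congˡ (trans (*-comm _ _) (T*P k)))
      (trans (solve 1 (λ x → nat 4 :* x := (nat 2 :* x) :* nat 2) refl (fromℕ (suc k)))
      (*-congʳ (sym (c≈2[k+1] k))))

  -- The same with `T≤P*π/4`, where the extra `ratio k` inside `P (suc k)` raises 2k + 2 to 2k + 3.
  ρ²-odd-lower : ∀ k → fromℕ 2 ≤ π * (fromℕ (3 ℕ.+ k ℕ.* 2) * (ρ (1 ℕ.+ k ℕ.* 2) * ρ (1 ℕ.+ k ℕ.* 2)))
  ρ²-odd-lower k = *-cancelˡ-≤ (*-pos (suc-pos (1 ℕ.+ k ℕ.* 2)) (suc-pos (1 ℕ.+ k ℕ.* 2)))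
    (≤-resp-≈ left right (*-monoʳ-≤ (*-nonneg (fromℕ-nonneg 4) (fromℕ-nonneg (2 ℕ.+ k ℕ.* 2)))
      (*-monoʳ-≤ (<⇒≤ (P-pos k)) (T≤P*π/4 k))))
    where
    d = fromℕ (2 ℕ.+ k ℕ.* 2)
    r = ρ (1 ℕ.+ k ℕ.* 2)
    left : fromℕ 4 * d * (P k * T k) ≈ d * d * fromℕ 2
    left = trans (*-congˡ (trans (*-comm _ _) (T*P k)))
      (trans (solve 2 (λ c x → nat 4 :* c :* x := c :* (nat 2 :* x) :* nat 2) refl d (fromℕ (suc k)))
      (*-congʳ (*-congˡ (sym (c≈2[k+1] k)))))
    right : fromℕ 4 * d * (P k * (ratio k * P k * π/4)) ≈ d * d * (π * (fromℕ (3 ℕ.+ k ℕ.* 2) * (r * r)))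
    right = trans (*-congˡ (*-cong (sym (ρ-P k)) (*-congʳ (*-congˡ (sym (ρ-P k))))))
      (trans (solve 5 (λ f q c r t → f :* c :* ((c :* r) :* (t :* (c :* r) :* q)) := c :* c :*
        ((f :* q) :* ((c :* t) :* (r :* r)))) refl (fromℕ 4) π/4 d r (ratio k))
        (*-congˡ (*-congˡ (*-congʳ (ratio-cancel k)))))

  ρ²-mono : ∀ {m n} r → m ℕ.≤ n → π * (fromℕ m * (r * r)) ≤ π * (fromℕ n * (r * r))
  ρ²-mono r m≤n = *-monoʳ-≤ (<⇒≤ π-pos) (*-monoˡ-≤ (square-nonneg r) (fromℕ-mono-≤ m≤n))

  -- The bound at the odd index 2k + 1 has the factor 2k + 2, one more than the index; this spare
  -- unit is used up at the even index 2k + 2, where ρ has the same value.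
  ρ²-upper : ∀ n → π * (fromℕ (suc n) * (ρ (suc n) * ρ (suc n))) ≤ fromℕ 2
  ρ²-upper n = cases (parity n)
    where
    cases : ∀ {n} → Parity n → π * (fromℕ (suc n) * (ρ (suc n) * ρ (suc n))) ≤ fromℕ 2
    cases (even k) = ≤-trans (ρ²-mono (ρ (1 ℕ.+ k ℕ.* 2)) (ℕ.n≤1+n (1 ℕ.+ k ℕ.* 2))) (ρ²-odd-upper k)
    cases (odd k)  = ≤-resp-≈ (*-congˡ (*-congˡ (*-cong (sym (ρ-even k)) (sym (ρ-even k))))) refl
      (ρ²-odd-upper k)

  ρ²-lower : ∀ n → fromℕ 2 ≤ π * (fromℕ (3 ℕ.+ n) * (ρ (suc n) * ρ (suc n)))
  ρ²-lower n = cases (parity n)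
    where
    cases : ∀ {n} → Parity n → fromℕ 2 ≤ π * (fromℕ (3 ℕ.+ n) * (ρ (suc n) * ρ (suc n)))
    cases (even k) = ρ²-odd-lower k
    cases (odd k)  = ≤-trans (ρ²-odd-lower k)
      (≤-resp-≈ refl (*-congˡ (*-congˡ (*-cong (sym (ρ-even k)) (sym (ρ-even k)))))
      (ρ²-mono (ρ (1 ℕ.+ k ℕ.* 2)) (ℕ.n≤1+n (3 ℕ.+ k ℕ.* 2))))

  -- √(2 / (πn)) is the limit of M ρ(nM²) as M grows, since the squares of these
  -- numbers tend to 2 / (πn).
  n*-sqrt : ∀ n → ∃[ s ] (0# ≤ s × π * fromℕ (suc n) * (s * s) ≈ fromℕ 2)
  n*-sqrt n = extract (sqrt-from-squares 0≤y y²⟶x)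
    where
    D : Carrier
    D = π * fromℕ (suc n)
    0<D : 0# < D
    0<D = *-pos π-pos (suc-pos n)
    index : ℕ → ℕ
    index M = suc n ℕ.* (M ℕ.* M)
    y : ℕ → Carrier
    y M = fromℕ M * ρ (index M)
    0≤y : ∀ M → 0# ≤ y M
    0≤y M = *-nonneg (fromℕ-nonneg M) (ρ-nonneg (index M))
    e : ℕ → Carrier
    e M = π * (fromℕ 2 * (ρ (index M) * ρ (index M)))
    0≤e : ∀ M → 0# ≤ e M
    0≤e M = *-nonneg (<⇒≤ π-pos) (*-nonneg (fromℕ-nonneg 2) (square-nonneg (ρ (index M))))
    Dy² : ∀ M → D * (y M * y M) ≈ π * (fromℕ (index M) * (ρ (index M) * ρ (index M)))
    Dy² M = trans (solve 4 (λ p n m r → p :* n :* ((m :* r) :* (m :* r)) := p :*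
      ((n :* (m :* m)) :* (r :* r))) refl π (fromℕ (suc n)) (fromℕ M) (ρ (index M)))
      (*-congˡ (*-congʳ (sym (trans (fromℕ-homo-* (suc n) (M ℕ.* M)) (*-congˡ (fromℕ-homo-* M M))))))
    ρ²-bounds : ∀ i → 1 ℕ.≤ i → π * (fromℕ i * (ρ i * ρ i)) ≤ fromℕ 2 × fromℕ 2 ≤ π *
      (fromℕ (2 ℕ.+ i) * (ρ i * ρ i))
    ρ²-bounds (suc i) _ = ρ²-upper i , ρ²-lower i
    index-large : ∀ M → M ℕ.≤ index M
    index-large zero    = z≤n
    index-large (suc M) = ℕ.≤-trans (ℕ.m≤m*n (suc M) (suc M)) (ℕ.m≤n*m (suc M ℕ.* suc M) (suc n))
    Dy²-bounds : ∀ M → 1 ℕ.≤ M → D * (y M * y M) ≤ fromℕ 2 + e M × fromℕ 2 ≤ D * (y M * y M) + e M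
    Dy²-bounds M 1≤M = ≤-trans (≤-resp-≈ (sym (Dy² M)) refl (proj₁ bounds)) (x≤x+y (0≤e M)) ,
      ≤-trans (proj₂ bounds) (≤-reflexive (trans
        (solve 3 (λ p i r → p :* ((:1 :+ (:1 :+ i)) :* r) := p :* (i :* r) :+ p :* (nat 2 :* r)) refl π
          (fromℕ (index M)) (ρ (index M) * ρ (index M)))
        (+-congʳ (sym (Dy² M)))))
      where bounds = ρ²-bounds (index M) (ℕ.≤-trans 1≤M (index-large M))
    e⟶0 : e ⟶ 0#
    e⟶0 = O[1/n]⟶0 (fromℕ 2 * fromℕ 2) 1 (λ M _ → 0≤e M) λ M 1≤M → ≤-trans
      (≤-reflexive (solve 3 (λ p r m → p :* (nat 2 :* r) :* m := nat 2 :* (p :* (m :* r))) refl π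
        (ρ (index M) * ρ (index M)) (fromℕ M)))
      (*-monoʳ-≤ (fromℕ-nonneg 2) (≤-trans (ρ²-mono (ρ (index M)) (index-large M))
        (proj₁ (ρ²-bounds (index M) (ℕ.≤-trans 1≤M (index-large M))))))
    x : Carrier
    x = inverse 0<D * fromℕ 2
    y²⟶x : (λ M → y M * y M) ⟶ x
    y²⟶x = ⟶-cong (λ M → trans (sym (*-assoc _ _ _)) (trans (*-congʳ (inverseˡ 0<D)) (*-identityˡ _))) refl
      (⟶-* (inverse-pos 0<D) (⟶-squeeze 1 Dy²-bounds e⟶0))
    extract : ∃[ s ] IsSqrt s x → ∃[ s ] (0# ≤ s × D * (s * s) ≈ fromℕ 2)
    extract (s , 0≤s , s²≈x) = s , 0≤s , trans (*-congˡ s²≈x)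
      (trans (sym (*-assoc _ _ _)) (trans (*-congʳ (trans (*-comm _ _) (inverseˡ 0<D))) (*-identityˡ _)))

  -- The root of 2/(π(m-1)), with value zero for m < 2, where the radicand would have a zero
  -- denominator.
  s : ℕ → Carrier
  s (suc (suc n)) = proj₁ (n*-sqrt n)
  s _             = 0#

  s-nonneg : ∀ n → 0# ≤ s (suc (suc n))
  s-nonneg n = proj₁ (proj₂ (n*-sqrt n))

  s-square : ∀ n → π * fromℕ (suc n) * (s (suc (suc n)) * s (suc (suc n))) ≈ fromℕ 2
  s-square n = proj₂ (proj₂ (n*-sqrt n))

  s-isSqrt : ∀ m → (2≤m : 2 ℕ.≤ m) →
    IsSqrt (s m) (fromℕ 2 / (π * fromℕ (m ℕ.∸ 1)) ⟨ *-pos π-pos (fromℕ-pos (m ℕ.∸ 1) (ℕ.m<n⇒0<n∸m 2≤m)) ⟩)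
  s-isSqrt (suc (suc n)) 2≤m@(s≤s (s≤s z≤n)) = s-nonneg n ,
    *-cancelˡ-≈ 0<D (trans (s-square n) (sym (trans (*-comm _ _) (/-*-cancel (fromℕ 2) 0<D))))
    where
    0<D : 0# < π * fromℕ (suc n)
    0<D = *-pos π-pos (fromℕ-pos (suc n) (ℕ.m<n⇒0<n∸m 2≤m))

  ρ≤s : ∀ n → ρ (suc n) ≤ s (suc (suc n))
  ρ≤s n = square-cancel-≤ (s-nonneg n) (*-cancelˡ-≤ (*-pos π-pos (suc-pos n))
    (≤-resp-≈ (sym (*-assoc _ _ _)) (sym (s-square n)) (ρ²-upper n)))

  -- Compare squares: with N = n + 1, π N² s² = 2N ≤ π N (N+2) ρ² ≤ π (N+2)² ρ².
  n*s≤[n+2]*ρ : ∀ n → fromℕ (suc n) * s (suc (suc n)) ≤ fromℕ (3 ℕ.+ n) * ρ (suc n)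
  n*s≤[n+2]*ρ n = square-cancel-≤ (*-nonneg (fromℕ-nonneg (3 ℕ.+ n)) (ρ-nonneg (suc n))) (*-cancelˡ-≤ π-pos
    (≤-trans (≤-resp-≈ left middle′ (*-monoʳ-≤ (fromℕ-nonneg (suc n)) (ρ²-lower n)))
      (*-monoʳ-≤ (<⇒≤ π-pos) (≤-resp-≈ refl right
        (*-monoˡ-≤ (*-nonneg (fromℕ-nonneg (3 ℕ.+ n)) (square-nonneg r))
        (fromℕ-mono-≤ (ℕ.m≤n+m (suc n) 2)))))))
    where
    N = fromℕ (suc n)
    M = fromℕ (3 ℕ.+ n)
    r = ρ (suc n)
    t = s (suc (suc n))
    left : N * fromℕ 2 ≈ π * (N * t * (N * t))
    left = trans (*-congˡ (sym (s-square n)))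
      (solve 3 (λ p n t → n :* (p :* n :* (t :* t)) := p :* (n :* t :* (n :* t))) refl π N t)
    middle′ : N * (π * (M * (r * r))) ≈ π * (N * (M * (r * r)))
    middle′ = solve 3 (λ p n x → n :* (p :* x) := p :* (n :* x)) refl π N (M * (r * r))
    right : M * (M * (r * r)) ≈ M * r * (M * r)
    right = solve 2 (λ m r → m :* (m :* (r :* r)) := m :* r :* (m :* r)) refl M r

  -- From N s ≤ (N+2) ρ and ρ ≤ s the gap s - ρ is at most 2s/N, which is below ε s once 2 < ε N.
  limitRatio∼s : limitRatio ∼ s
  limitRatio∼s ε 0<ε = convert (archimedean-recip (fromℕ 2) 0<ε)
    where
    convert : ∃[ N ] (∀ n → N ℕ.≤ n → fromℕ 2 < ε * fromℕ n) →
      ∃[ N ] (∀ k → N ℕ.≤ k → ∣ limitRatio k - s k ∣ ≤ ε * ∣ s k ∣)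
    convert (N , p) = 2 ℕ.+ N , close
      where
      close : ∀ k → 2 ℕ.+ N ℕ.≤ k → ∣ limitRatio k - s k ∣ ≤ ε * ∣ s k ∣
      close (suc (suc n)) (s≤s (s≤s N≤n)) = ∣x-y∣≤ε
        (≤-trans (ρ≤s n) (x≤x+y (≤-trans 0≤εt εt≤)))
        (≤-trans (*-cancelˡ-≤ (suc-pos n) (≤-trans (n*s≤[n+2]*ρ n) M*r≤)) (+-monoʳ-≤ (ρ (suc n)) εt≤))
        where
        r = ρ (suc n)
        t = s (suc (suc n))
        0≤εt : 0# ≤ ε * t
        0≤εt = *-nonneg (<⇒≤ 0<ε) (s-nonneg n)
        εt≤ : ε * t ≤ ε * ∣ t ∣
        εt≤ = *-monoʳ-≤ (<⇒≤ 0<ε) (x≤x⊔y t (- t))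
        M*r≤ : fromℕ (3 ℕ.+ n) * r ≤ fromℕ (suc n) * (r + ε * t)
        M*r≤ = ≤-resp-≈
          (solve 2 (λ n r → n :* r :+ nat 2 :* r := (:1 :+ (:1 :+ n)) :* r) refl (fromℕ (suc n)) r)
          (solve 4 (λ n r e t → n :* r :+ e :* n :* t := n :* (r :+ e :* t)) refl (fromℕ (suc n)) r ε t)
          (+-monoʳ-≤ (fromℕ (suc n) * r) (*-mono-≤ (ρ-nonneg (suc n))
            (*-nonneg (<⇒≤ 0<ε) (fromℕ-nonneg (suc n)))
            (<⇒≤ (p (suc n) (ℕ.m≤n⇒m≤1+n N≤n))) (ρ≤s n)))

  ⟶0-from-squares : ∀ {t} → (∀ k → 0# ≤ t k) → (λ k → t k * t k) ⟶ 0# → t ⟶ 0#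
  ⟶0-from-squares {t} 0≤t lim = Within⇒⟶ λ ε 0<ε → convert 0<ε (⟶⇒Within lim (*-pos 0<ε 0<ε))
    where
    convert : ∀ {ε} → 0# < ε → WithinEventually (λ k → t k * t k) 0# (ε * ε) → WithinEventually t 0# ε
    convert {ε} 0<ε (N , p) = N , λ k N≤k →
      <-resp-≈ refl (sym (+-identityˡ ε)) (square-cancel-< (0≤t k) (<⇒≤ 0<ε)
        (<-resp-≈ refl (+-identityˡ _) (proj₁ (p k N≤k)))) ,
      <-≤-trans 0<ε (x≤y+x (0≤t k))

  -- The squares are at most 2/(π(m-1)) ≤ 4/(π m), by m ≤ 2(m-1) for m ≥ 2.
  limitRatio⟶0 : limitRatio ⟶ 0#
  limitRatio⟶0 = ⟶0-from-squares (λ m → ρ-nonneg (m ℕ.∸ 1)) (O[1/n]⟶0 (fromℕ 4 / π ⟨ π-pos ⟩) 2 (λ m _ →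
    square-nonneg (limitRatio m)) bound)
    where
    bound : ∀ m → 2 ℕ.≤ m → limitRatio m * limitRatio m * fromℕ m ≤ fromℕ 4 / π ⟨ π-pos ⟩
    bound (suc (suc n)) (s≤s (s≤s z≤n)) = *-cancelˡ-≤ π-pos (≤-trans
      (≤-resp-≈ (*-congˡ (*-comm _ _)) (trans
        (*-congˡ (trans (*-congʳ (fromℕ-homo-* 2 (suc n))) (*-assoc _ _ _)))
        (solve 2 (λ p x → p :* (nat 2 :* x) := nat 2 :* (p :* x)) refl π (fromℕ (suc n) * (r * r))))
        (ρ²-mono r 2+n≤2*[1+n]))
      (≤-resp-≈ refl (trans (solve 0 (nat 2 :* nat 2 := nat 4) refl)
        (sym (trans (*-comm _ _) (/-*-cancel (fromℕ 4) π-pos)))) (*-monoʳ-≤ (fromℕ-nonneg 2) (ρ²-upper n))))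
      where
      r = ρ (suc n)
      2+n≤2*[1+n] : 2 ℕ.+ n ℕ.≤ 2 ℕ.* suc n
      2+n≤2*[1+n] = s≤s (ℕ.≤-trans (ℕ.m≤n+m (suc n) n) (ℕ.+-monoʳ-≤ n (ℕ.m≤m+n (suc n) 0)))


-- Dynamic programming: the optimal online value

module Optimum {c ℓ₁ ℓ₂} (ℝ : RealField c ℓ₁ ℓ₂) where
  open RealField ℝ
  open Allocation ℝ
  open OrderedField ℝ
  open SemiringSum semiring public using (sum-cong-≋; ∑-distrib-+; *-distribˡ-sum; *-distribʳ-sum)

  sum-mono : ∀ {n} {f g : Fin n → Carrier} → (∀ i → f i ≤ g i) → sum f ≤ sum g
  sum-mono {zero}  f≤g = ≤-refl
  sum-mono {suc n} f≤g = +-mono-≤ (f≤g zero) (sum-mono (f≤g ∘ suc))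

  Allowed : ∀ {n} → (Fin n → Bool) → Maybe (Fin n) → Set
  Allowed ok nothing  = true ≡ true
  Allowed ok (just i) = ok i ≡ true

  maximum : ∀ {n} → (Fin n → Bool) → (Maybe (Fin n) → Carrier) → Carrier
  maximum {zero}  ok f = f nothing
  maximum {suc n} ok f = if ok zero then f (just zero) ⊔ rest else rest
    where rest = maximum (ok ∘ suc) (f ∘ Maybe.map suc)

  Allowed-suc : ∀ {n} (ok : Fin (suc n) → Bool) d → Allowed (ok ∘ suc) d → Allowed ok (Maybe.map suc d)
  Allowed-suc ok nothing  p = p
  Allowed-suc ok (just i) p = p

  ≤-maximum : ∀ {n} ok f (d : Maybe (Fin n)) → Allowed ok d → f d ≤ maximum ok f
  ≤-maximum {zero}  ok f nothing        p = ≤-refl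
  ≤-maximum {suc n} ok f (just zero)    p rewrite p = x≤x⊔y _ _
  ≤-maximum {suc n} ok f (just (suc i)) p = step (ok zero)
    (≤-maximum (ok ∘ suc) (f ∘ Maybe.map suc) (just i) p)
    where
    step : ∀ b {x y z} → x ≤ y → x ≤ (if b then z ⊔ y else y)
    step true  x≤y = ≤-trans x≤y (y≤x⊔y _ _)
    step false x≤y = x≤y
  ≤-maximum {suc n} ok f nothing        p = step (ok zero)
    (≤-maximum (ok ∘ suc) (f ∘ Maybe.map suc) nothing p)
    where
    step : ∀ b {x y z} → x ≤ y → x ≤ (if b then z ⊔ y else y)
    step true  x≤y = ≤-trans x≤y (y≤x⊔y _ _)
    step false x≤y = x≤y

  maximum-≤ : ∀ {n} ok (f : Maybe (Fin n) → Carrier) {B} → (∀ d → Allowed ok d → f d ≤ B) → maximum ok f ≤ B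
  maximum-≤ {zero}  ok f f≤B = f≤B nothing ≡.refl
  maximum-≤ {suc n} ok f {B} f≤B = step (ok zero) ≡.refl
    where
    rest≤ : maximum (ok ∘ suc) (f ∘ Maybe.map suc) ≤ B
    rest≤ = maximum-≤ (ok ∘ suc) (f ∘ Maybe.map suc) λ d p → f≤B (Maybe.map suc d) (Allowed-suc ok d p)
    step : ∀ b → ok zero ≡ b → (if b then f (just zero) ⊔ maximum (ok ∘ suc) (f ∘ Maybe.map suc) else
      maximum (ok ∘ suc) (f ∘ Maybe.map suc)) ≤ B
    step true  p = ⊔-least (f≤B (just zero) p) rest≤
    step false p = rest≤

  -- A maximiser cannot be computed, but below any strictly smaller level a decision can be located,
  -- since `<⊔⇒<⊎<` decides each binary maximum.
  <-maximum : ∀ {n} ok (f : Maybe (Fin n) → Carrier) {z} → z < maximum ok f → ∃[ d ] (Allowed ok d × z < f d)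
  <-maximum {zero}  ok f z< = nothing , ≡.refl , z<
  <-maximum {suc n} ok f {z} z< = step (ok zero) ≡.refl z<
    where
    rest = maximum (ok ∘ suc) (f ∘ Maybe.map suc)
    later : z < rest → ∃[ d ] (Allowed ok d × z < f d)
    later z<rest = shift (<-maximum (ok ∘ suc) (f ∘ Maybe.map suc) z<rest)
      where
      shift : ∃[ d ] (Allowed (ok ∘ suc) d × z < f (Maybe.map suc d)) → ∃[ d ] (Allowed ok d × z < f d)
      shift (d , p , z<fd) = Maybe.map suc d , Allowed-suc ok d p , z<fd
    step : ∀ b → ok zero ≡ b → z < (if b then f (just zero) ⊔ rest else rest) →
      ∃[ d ] (Allowed ok d × z < f d)
    step true  p z< = [ (λ z<f0 → just zero , p , z<f0) , later ]′ (<⊔⇒<⊎< z<)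
    step false p z< = later z<

  kronecker : ∀ {n} → Fin n → Fin n → Carrier
  kronecker zero    zero    = 1#
  kronecker zero    (suc j) = 0#
  kronecker (suc i) zero    = 0#
  kronecker (suc i) (suc j) = kronecker i j

  kronecker-nonneg : ∀ {n} (i j : Fin n) → 0# ≤ kronecker i j
  kronecker-nonneg zero    zero    = 0≤1
  kronecker-nonneg zero    (suc j) = ≤-refl
  kronecker-nonneg (suc i) zero    = ≤-refl
  kronecker-nonneg (suc i) (suc j) = kronecker-nonneg i j

  kronecker-off : ∀ {n} (i j : Fin n) → ¬ (i ≡ j) → kronecker i j ≈ 0#
  kronecker-off zero    zero    i≢j = ⊥-elim (i≢j ≡.refl)
  kronecker-off zero    (suc j) i≢j = refl
  kronecker-off (suc i) zero    i≢j = refl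
  kronecker-off (suc i) (suc j) i≢j = kronecker-off i j (i≢j ∘ ≡.cong suc)

  sum-zeroˡ : ∀ {n} (f : Fin n → Carrier) → sum (λ i → 0# * f i) ≈ 0#
  sum-zeroˡ f = trans (sym (*-distribˡ-sum 0# f)) (zeroˡ (sum f))

  kronecker-sum : ∀ {n} (i : Fin n) (f : Fin n → Carrier) → sum (λ j → kronecker i j * f j) ≈ f i
  kronecker-sum zero    f = trans (+-cong (*-identityˡ _) (sum-zeroˡ (f ∘ suc))) (+-identityʳ _)
  kronecker-sum (suc i) f = trans (+-cong (zeroˡ _) (kronecker-sum i (f ∘ suc))) (+-identityˡ _)

  point : ∀ {n} → Maybe (Fin n) → Maybe (Fin n) → Carrier
  point nothing  nothing  = 1#
  point nothing  (just j) = 0#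
  point (just i) nothing  = 0#
  point (just i) (just j) = kronecker i j

  point-nonneg : ∀ {n} (d e : Maybe (Fin n)) → 0# ≤ point d e
  point-nonneg nothing  nothing  = 0≤1
  point-nonneg nothing  (just j) = ≤-refl
  point-nonneg (just i) nothing  = ≤-refl
  point-nonneg (just i) (just j) = kronecker-nonneg i j

  point-average : ∀ {n} (d : Maybe (Fin n)) (f : Maybe (Fin n) → Carrier) →
    point d nothing * f nothing + sum (λ i → point d (just i) * f (just i)) ≈ f d
  point-average nothing  f = trans (+-cong (*-identityˡ _) (sum-zeroˡ (f ∘ just))) (+-identityʳ _)
  point-average (just i) f = trans (+-cong (zeroˡ _) (kronecker-sum i (f ∘ just))) (+-identityˡ _)

  point-total : ∀ {n} (d : Maybe (Fin n)) → point d nothing + sum (point d ∘ just) ≈ 1#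
  point-total d = trans (+-cong (sym (*-identityʳ _))
    (trans (sym (*-identityʳ _)) (*-distribʳ-sum 1# (point d ∘ just)))) (point-average d (λ _ → 1#))

  module _ {m} (I : Instance m) where
    open Instance I

    available : History m → Fin m → Bool
    available h i = sold h i ℕ.<ᵇ capacity i

    available-< : ∀ {h i} → available h i ≡ true → sold h i ℕ.< capacity i
    available-< {h} {i} p = ℕ.<ᵇ⇒< (sold h i) (capacity i) (Equivalence.from T-≡ p)

    available-≥ : ∀ {h i} → available h i ≡ false → capacity i ℕ.≤ sold h i
    available-≥ {h} {i} p = ℕ.≮⇒≥ λ sold<cap → case ≡.trans (≡.sym p) (dec-true (sold h i ℕ.<? capacity i) sold<cap) of λ ()

    -- The Bellman recursion, run on whole histories because policies may depend on them.
    value : ∀ {T} → (Fin T → Carrier) → History m → Carrier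
    value {zero}  p h = totalReward (sold h)
    value {suc T} p h = (1# - p zero) * value (p ∘ suc) (nothing ∷ h)
      + p zero * maximum (available h) (λ d → value (p ∘ suc) (just d ∷ h))

    IsProbability : ∀ {T} → (Fin T → Carrier) → Set _
    IsProbability p = ∀ t → 0# ≤ p t × p t ≤ 1#

    mixture-mono : ∀ {p x y u v} → 0# ≤ p → p ≤ 1# → x ≤ y → u ≤ v →
      (1# - p) * x + p * u ≤ (1# - p) * y + p * v
    mixture-mono 0≤p p≤1 x≤y u≤v = +-mono-≤ (*-monoʳ-≤ (x≤y⇒0≤y-x p≤1) x≤y) (*-monoʳ-≤ 0≤p u≤v)

    module _ (π : Policy I) where
      open Policy π

      -- An average with total weight one. Sold-out products, for which no bound on `f` is known,
      -- have weight zero.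
      decide-average : ∀ h (f : Decision m → Carrier) {B} → (∀ d → Allowed (available h) d → f d ≤ B) →
        decide h nothing * f nothing + sum (λ i → decide h (just i) * f (just i)) ≤ B
      decide-average h f {B} f≤B = ≤-resp-≈ refl total
        (+-mono-≤ (*-monoʳ-≤ (decide-nonneg h nothing) (f≤B nothing ≡.refl)) (sum-mono term))
        where
        total : decide h nothing * B + sum (λ i → decide h (just i) * B) ≈ B
        total = trans (+-congˡ (sym (*-distribʳ-sum B (decide h ∘ just))))
          (trans (sym (distribʳ B _ _)) (trans (*-congʳ (decide-total h)) (*-identityˡ B)))
        term : ∀ i → decide h (just i) * f (just i) ≤ decide h (just i) * B
        term i = step (available h i) ≡.refl
          where
          step : ∀ b → available h i ≡ b → decide h (just i) * f (just i) ≤ decide h (just i) * B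
          step true  p = *-monoʳ-≤ (decide-nonneg h (just i)) (f≤B (just i) p)
          step false p = ≤-reflexive (trans (*-congʳ excluded)
            (trans (zeroˡ _) (sym (trans (*-congʳ excluded) (zeroˡ _)))))
            where
            excluded : decide h (just i) ≈ 0#
            excluded = decide-feasible h i (available-≥ {h} {i} p)

      𝔼Rev-from≤value : ∀ {T} (p : Fin T → Carrier) h → IsProbability p → 𝔼Rev-from π p h ≤ value p h
      𝔼Rev-from≤value {zero}  p h prob = ≤-refl
      𝔼Rev-from≤value {suc T} p h prob = mixture-mono (proj₁ (prob zero)) (proj₂ (prob zero))
        (𝔼Rev-from≤value (p ∘ suc) (nothing ∷ h) (prob ∘ suc))
        (decide-average h (λ d → 𝔼Rev-from π (p ∘ suc) (just d ∷ h)) λ d allowed →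
          ≤-trans (𝔼Rev-from≤value (p ∘ suc) (just d ∷ h) (prob ∘ suc))
            (≤-maximum (available h) (λ d → value (p ∘ suc) (just d ∷ h)) d allowed))

    deterministic : (δ : History m → Decision m) → (∀ h → Allowed (available h) (δ h)) → Policy I
    deterministic δ allowed = record
      { decide          = λ h → point (δ h)
      ; decide-nonneg   = λ h → point-nonneg (δ h)
      ; decide-total    = λ h → point-total (δ h)
      ; decide-feasible = λ h i full → excluded h i full (δ h) (allowed h)
      }
      where
      excluded : ∀ h i → capacity i ℕ.≤ sold h i → ∀ d → Allowed (available h) d → point d (just i) ≈ 0#
      excluded h i full nothing  p = refl
      excluded h i full (just j) p = kronecker-off j i λ { ≡.refl → ℕ.<⇒≱ (available-< {h} {i} p) full }

    -- Every decision comes within ε of the maximum, so the total loss over T remaining periods is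
    -- at most Tε.
    module NearOptimal (ε : Carrier) (0<ε : 0# < ε) where

      Schedule : Set _
      Schedule = Σ[ T ∈ ℕ ] (Fin T → Carrier)

      -- A policy sees only the history, whose length is the number of elapsed periods. Bundling the
      -- horizon with the probabilities keeps this length out of the types; past the horizon nothing
      -- is left and `choice` rejects.
      afterwards : ℕ → Schedule → Schedule
      afterwards zero    s           = s
      afterwards (suc t) (zero , p)  = zero , p
      afterwards (suc t) (suc T , p) = afterwards t (T , p ∘ suc)

      afterwards-suc : ∀ t s {T p} → afterwards t s ≡ (suc T , p) → afterwards (suc t) s ≡ (T , p ∘ suc)
      afterwards-suc zero    (suc T , p) ≡.refl = ≡.refl
      afterwards-suc (suc t) (suc T , p) eq     = afterwards-suc t (T , p ∘ suc) eq

      candidate : ∀ {T} (p : Fin T → Carrier) h → let f = λ d → value p (just d ∷ h) in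
        ∃[ d ] (Allowed (available h) d × maximum (available h) f - ε < f d)
      candidate p h = <-maximum (available h) (λ d → value p (just d ∷ h)) (x-ε<x 0<ε)

      choice : Schedule → History m → Decision m
      choice (zero , p)  h = nothing
      choice (suc T , p) h = proj₁ (candidate (p ∘ suc) h)

      choice-allowed : ∀ s h → Allowed (available h) (choice s h)
      choice-allowed (zero , p)  h = ≡.refl
      choice-allowed (suc T , p) h = proj₁ (proj₂ (candidate (p ∘ suc) h))

      remaining : History m → Schedule
      remaining h = afterwards (length h) (horizon , arrivalProb)

      policy : Policy I
      policy = deterministic (λ h → choice (remaining h) h) (λ h → choice-allowed (remaining h) h)

      value≤𝔼Rev-from : ∀ {T} (p : Fin T → Carrier) h → IsProbability p → remaining h ≡ (T , p) →
        value p h ≤ 𝔼Rev-from policy p h + fromℕ T * ε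
      value≤𝔼Rev-from {zero}  p h prob eq = ≤-reflexive (sym (trans (+-congˡ (zeroˡ ε)) (+-identityʳ _)))
      value≤𝔼Rev-from {suc T} p h prob eq = ≤-trans
        (mixture-mono (proj₁ (prob zero)) (proj₂ (prob zero)) idle chosen)
        (≤-reflexive (trans
          (solve 5 (λ q x y t e → (:1 :- q) :* (x :+ (:1 :+ t) :* e) :+ q :* (y :+ (:1 :+ t) :* e) :=
            (:1 :- q) :* x :+ q :* y :+ (:1 :+ t) :* e)
            refl (p zero) (𝔼Rev-from policy (p ∘ suc) (nothing ∷ h)) (next δ) (fromℕ T) ε)
          (+-congʳ (+-congˡ (*-congˡ (sym (point-average δ next)))))))
        where
        δ : Decision m
        δ = choice (remaining h) h
        next : Decision m → Carrier
        next d = 𝔼Rev-from policy (p ∘ suc) (just d ∷ h)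
        eq′ : afterwards (suc (length h)) (horizon , arrivalProb) ≡ (T , p ∘ suc)
        eq′ = afterwards-suc (length h) (horizon , arrivalProb) eq
        ε-step : ∀ {x} → x + fromℕ T * ε ≤ x + fromℕ (suc T) * ε
        ε-step = +-monoʳ-≤ _ (*-monoˡ-≤ (<⇒≤ 0<ε) (fromℕ-mono-≤ (ℕ.n≤1+n T)))
        idle : value (p ∘ suc) (nothing ∷ h) ≤ 𝔼Rev-from policy (p ∘ suc) (nothing ∷ h) + fromℕ (suc T) * ε
        idle = ≤-trans (value≤𝔼Rev-from (p ∘ suc) (nothing ∷ h) (prob ∘ suc) eq′) ε-step
        best : Carrier
        best = maximum (available h) (λ d → value (p ∘ suc) (just d ∷ h))
        -- Generalised over the schedule, so that the equation for `remaining h` can be matched with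
        -- `refl`.
        near : ∀ s → s ≡ (suc T , p) → best - ε < value (p ∘ suc) (just (choice s h) ∷ h)
        near _ ≡.refl = proj₂ (proj₂ (candidate (p ∘ suc) h))
        chosen : best ≤ next δ + fromℕ (suc T) * ε
        chosen = ≤-resp-≈ (solve 2 (λ b e → b :- e :+ e := b) refl best ε)
          (solve 3 (λ x t e → x :+ t :* e :+ e := x :+ (:1 :+ t) :* e) refl (next δ) (fromℕ T) ε)
          (+-monoˡ-≤ ε (≤-trans (<⇒≤ (near (remaining h) eq))
            (value≤𝔼Rev-from (p ∘ suc) (just δ ∷ h) (prob ∘ suc) eq′)))

    optimum : Carrier
    optimum = value arrivalProb []

    optimum-isOPT : IsOPT I optimum
    optimum-isOPT = (λ π → 𝔼Rev-from≤value π arrivalProb [] prob) , λ ε 0<ε →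
      -- The loss allowed per period is η = ε/(1+T), which makes the total Tη strictly smaller than
      -- ε, even for an empty horizon.
      approximate (/-pos 0<ε 0<1+T) (/-*-cancel ε 0<1+T)
      where
      prob : IsProbability arrivalProb
      prob t = arrivalProb-nonneg t , arrivalProb-≤1 t
      0<1+T : 0# < fromℕ (suc horizon)
      0<1+T = suc-pos horizon
      approximate : ∀ {ε η} → 0# < η → η * fromℕ (suc horizon) ≈ ε → ∃[ π ] optimum - ε < 𝔼Rev {I = I} π
      approximate {ε} {η} 0<η η[1+T]≈ε = policy , <-resp-≈ (+-congˡ (-‿cong η[1+T]≈ε)) refl
        (≤-<-trans (+-monoˡ-≤ (- (η * fromℕ (suc horizon))) (value≤𝔼Rev-from arrivalProb [] prob ≡.refl))
          (<-resp-≈ (solve 3 (λ r t e → r :- e := r :+ t :* e :- e :* (:1 :+ t)) refl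
            (𝔼Rev {I = I} policy) (fromℕ horizon) η) refl (x-ε<x 0<η)))
        where open NearOptimal η 0<η


-- The hard instance and a potential bounding its online value

module HardInstance {c ℓ₁ ℓ₂} (ℝ : RealField c ℓ₁ ℓ₂) where
  open RealField ℝ
  open Allocation ℝ
  open OrderedField ℝ
  open Exp commutativeSemiring using (^-congˡ; ^-homo-*)
  open Wallis ℝ using (Σ<; Σ<-sum)
  open Optimum ℝ

  sold-nothing : ∀ {m} (h : History m) i → sold (nothing ∷ h) i ≡ sold h i
  sold-nothing h i = ≡.cong length (List.filter-reject (λ o → ≡-dec (≡-dec Fin._≟_) o (just (just i)))
    {nothing} {h} λ ())

  sold-reject : ∀ {m} (h : History m) i → sold (just nothing ∷ h) i ≡ sold h i
  sold-reject h i = ≡.cong length (List.filter-reject (λ o → ≡-dec (≡-dec Fin._≟_) o (just (just i)))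
    {just nothing} {h} λ ())

  sold-same : ∀ {m} (h : History m) i → sold (just (just i) ∷ h) i ≡ suc (sold h i)
  sold-same h i = ≡.cong length (List.filter-accept (λ o → ≡-dec (≡-dec Fin._≟_) o (just (just i)))
    {just (just i)} {h} ≡.refl)

  sold-other : ∀ {m} (h : History m) {i j} → ¬ (i ≡ j) → sold (just (just i) ∷ h) j ≡ sold h j
  sold-other h {i} {j} i≢j = ≡.cong length (List.filter-reject (λ o →
    ≡-dec (≡-dec Fin._≟_) o (just (just j))) {just (just i)} {h}
    (i≢j ∘ just-injective ∘ just-injective))

  if-nonneg : ∀ b {x} → 0# ≤ x → 0# ≤ (if b then x else 0#)
  if-nonneg true  0≤x = 0≤x
  if-nonneg false 0≤x = ≤-refl

  ^-nonneg : ∀ {x} n → 0# ≤ x → 0# ≤ x ^ n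
  ^-nonneg zero    0≤x = 0≤1
  ^-nonneg (suc n) 0≤x = *-nonneg 0≤x (^-nonneg n 0≤x)

  ^-pos : ∀ {x} n → 0# < x → 0# < x ^ n
  ^-pos zero    0<x = 0<1
  ^-pos (suc n) 0<x = *-pos 0<x (^-pos n 0<x)

  module Hard (n : ℕ) (p : Carrier) (0<p : 0# < p) (p<1 : p < 1#) where

    v : ℕ → Carrier
    v i = p ^ (n ℕ.∸ i)

    v-nonneg : ∀ i → 0# ≤ v i
    v-nonneg i = ^-nonneg (n ℕ.∸ i) (<⇒≤ 0<p)

    v*p^ : ∀ {i} → i ℕ.≤ n → v i * p ^ i ≈ p ^ n
    v*p^ {i} i≤n = trans (sym (^-homo-* p (n ℕ.∸ i) i)) (reflexive (≡.cong (p ^_) (ℕ.m∸n+n≡m i≤n)))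

    -- Monotonicity forces the bonus to persist after unit i + 1; the capacity i + 1 ensures that it
    -- is earned only once.
    hardBonus : ℕ → ℕ → Carrier
    hardBonus i k = if i ℕ.<ᵇ k then v i else 0#

    hardBonus-mono : ∀ i {k l} → k ℕ.≤ l → hardBonus i k ≤ hardBonus i l
    hardBonus-mono i {k} {l} k≤l = [ below , above ]′ (ℕ.<-≤-connex i k)
      where
      above : k ℕ.≤ i → hardBonus i k ≤ hardBonus i l
      above k≤i = ≤-trans (≤-reflexive (reflexive
        (≡.cong (λ b → if b then v i else 0#) (dec-false (i ℕ.<? k) (ℕ.≤⇒≯ k≤i)))))
        (if-nonneg (i ℕ.<ᵇ l) (v-nonneg i))
      below : i ℕ.< k → hardBonus i k ≤ hardBonus i l
      below i<k = ≤-reflexive (reflexive (≡.cong (λ b → if b then v i else 0#)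
        (≡.trans (dec-true (i ℕ.<? k) i<k) (≡.sym (dec-true (i ℕ.<? l) (ℕ.<-≤-trans i<k k≤l))))))

    hardProb : Fin (suc n) → Carrier
    hardProb zero    = 1#
    hardProb (suc _) = p

    -- Product i pays only for its last unit, the (i+1)-st.  Its reward p^(n-i)
    -- is p^(-i) scaled by pⁿ, which leaves the ratio unchanged and needs no
    -- inverse of p.
    hard : Instance (suc n)
    hard = record
      { capacity           = suc ∘ toℕ
      ; baseReward         = λ _ → 0#
      ; baseReward-nonneg  = λ _ → ≤-refl
      ; bonus              = hardBonus ∘ toℕ
      ; bonus-zero         = λ _ → refl
      ; bonus-nonneg       = λ i k → if-nonneg (toℕ i ℕ.<ᵇ k) (v-nonneg (toℕ i))
      ; bonus-mono         = λ i → hardBonus-mono (toℕ i)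
      ; horizon            = suc n
      ; arrivalProb        = hardProb
      ; arrivalProb-nonneg = λ { zero → 0≤1 ; (suc _) → <⇒≤ 0<p }
      ; arrivalProb-≤1     = λ { zero → ≤-refl ; (suc _) → <⇒≤ p<1 }
      }

    open Instance hard using (reward; totalReward; capacity)

    ·-0 : ∀ k → k · 0# ≈ 0#
    ·-0 zero    = refl
    ·-0 (suc k) = trans (+-identityˡ _) (·-0 k)

    reward-Σ< : ∀ i k → reward i k ≈ Σ< k (hardBonus (toℕ i) ∘ suc)
    reward-Σ< i k = trans (+-cong (·-0 k) (Σ<-sum k (hardBonus (toℕ i) ∘ suc))) (+-identityˡ _)

    hardBonus-low : ∀ {i k} → k ℕ.≤ i → hardBonus i k ≈ 0#
    hardBonus-low {i} {k} k≤i = reflexive (≡.cong (λ b → if b then v i else 0#)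
      (dec-false (i ℕ.<? k) (ℕ.≤⇒≯ k≤i)))

    Σ<-hardBonus : ∀ i k → k ℕ.≤ i → Σ< k (hardBonus i ∘ suc) ≈ 0#
    Σ<-hardBonus i zero    _   = refl
    Σ<-hardBonus i (suc k) k<i = trans (+-cong (Σ<-hardBonus i k (ℕ.<⇒≤ k<i)) (hardBonus-low k<i))
      (+-identityˡ _)

    reward-partial : ∀ i {k} → k ℕ.≤ toℕ i → reward i k ≈ 0#
    reward-partial i {k} k≤i = trans (reward-Σ< i k) (Σ<-hardBonus (toℕ i) k k≤i)

    reward-full : ∀ i → reward i (suc (toℕ i)) ≈ v (toℕ i)
    reward-full i = trans (reward-Σ< i (suc (toℕ i))) (trans (+-cong (Σ<-hardBonus (toℕ i) (toℕ i) ℕ.≤-refl)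
      (reflexive (≡.cong (λ b → if b then v (toℕ i) else 0#)
        (dec-true (toℕ i ℕ.<? suc (toℕ i)) (ℕ.n<1+n (toℕ i)))))) (+-identityˡ _))

    reward-cases : ∀ i {k} → k ℕ.≤ suc (toℕ i) →
      (k ≡ suc (toℕ i)) × reward i k ≈ v (toℕ i) ⊎ k ℕ.≤ toℕ i × reward i k ≈ 0#
    reward-cases i k≤ = [ (λ k<1+i → inj₂ (ℕ.s≤s⁻¹ k<1+i , reward-partial i (ℕ.s≤s⁻¹ k<1+i))) ,
      (λ { ≡.refl → inj₁ (≡.refl , reward-full i) }) ]′ (ℕ.m≤n⇒m<n∨m≡n k≤)

    reward-nonneg : ∀ i {k} → k ℕ.≤ suc (toℕ i) → 0# ≤ reward i k
    reward-nonneg i k≤ = [ (λ q → ≤-resp-≈ refl (sym (proj₂ q)) (v-nonneg (toℕ i))) , (λ q →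
      ≤-reflexive (sym (proj₂ q))) ]′ (reward-cases i k≤)

    need : History (suc n) → Fin (suc n) → ℕ
    need h i = suc (toℕ i) ℕ.∸ sold h i

    Within-capacity : History (suc n) → Set
    Within-capacity h = ∀ i → sold h i ℕ.≤ suc (toℕ i)

    -- The union bound for the probability that T periods bring at least j
    -- arrivals.
    w : ℕ → ℕ → Carrier
    w T j = fromℕ (T C j) * p ^ j

    w-nonneg : ∀ T j → 0# ≤ w T j
    w-nonneg T j = *-nonneg (fromℕ-nonneg (T C j)) (^-nonneg j (<⇒≤ 0<p))

    w-0 : ∀ T → w T 0 ≈ 1#
    w-0 T = trans (*-identityʳ _) fromℕ-1

    -- Dominates w both with and without a further sale, so that w-suc absorbs
    -- the maximum over decisions.
    w⁺ : ℕ → ℕ → Carrier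
    w⁺ T zero    = w T 0
    w⁺ T (suc j) = w T j + w T (suc j)

    w-suc : ∀ T j → (1# - p) * w T j + p * w⁺ T j ≈ w (suc T) j
    w-suc T zero    = solve 2 (λ p x → (:1 :- p) :* x :+ p :* x := x) refl p (w T 0)
    w-suc T (suc j) = trans
      (solve 4 (λ p a b q → (:1 :- p) :* (b :* (p :* q)) :+ p :* (a :* q :+ b :* (p :* q)) := (a :+ b)
        :* (p :* q)) refl p (fromℕ (T C j)) (fromℕ (T C suc j)) (p ^ j))
      (*-congʳ (trans (sym (fromℕ-homo-+ (T C j) (T C suc j)))
        (reflexive (≡.cong fromℕ (nCk+nC[k+1]≡[n+1]C[k+1] T j)))))

    w≤w⁺ : ∀ T j → w T j ≤ w⁺ T j
    w≤w⁺ T zero    = ≤-refl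
    w≤w⁺ T (suc j) = x≤y+x (w-nonneg T j)

    w-pred≤w⁺ : ∀ T j → w T (ℕ.pred j) ≤ w⁺ T j
    w-pred≤w⁺ T zero    = ≤-refl
    w-pred≤w⁺ T (suc j) = x≤x+y (w-nonneg T (suc j))

    -- Lets every product count all T future customers as its own, so the products no longer
    -- compete.
    Φ : ℕ → History (suc n) → Carrier
    Φ T h = sum λ i → v (toℕ i) * w T (need h i)

    Φ-cong : ∀ T {h h′} → (∀ i → sold h i ≡ sold h′ i) → Φ T h ≈ Φ T h′
    Φ-cong T eq = sum-cong-≋ λ i → reflexive (≡.cong (λ s → v (toℕ i) * w T (suc (toℕ i) ℕ.∸ s)) (eq i))

    after-capacity : ∀ h d → Allowed (available hard h) d → Within-capacity h → Within-capacity (just d ∷ h)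
    after-capacity h nothing  _       within i = ≡.subst (ℕ._≤ suc (toℕ i)) (≡.sym (sold-reject h i))
      (within i)
    after-capacity h (just j) allowed within i = step (j Fin.≟ i)
      where
      step : Dec (j ≡ i) → sold (just (just j) ∷ h) i ℕ.≤ suc (toℕ i)
      step (yes ≡.refl) = ≡.subst (ℕ._≤ suc (toℕ i)) (≡.sym (sold-same h i))
        (available-< hard {h} {i} allowed)
      step (no j≢i)     = ≡.subst (ℕ._≤ suc (toℕ i)) (≡.sym (sold-other h j≢i)) (within i)

    need-after : ∀ h d i → need (just d ∷ h) i ≡ need h i ⊎ need (just d ∷ h) i ≡ ℕ.pred (need h i)
    need-after h nothing  i = inj₁ (≡.cong (suc (toℕ i) ℕ.∸_) (sold-reject h i))
    need-after h (just j) i = step (j Fin.≟ i)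
      where
      step : Dec (j ≡ i) → need (just (just j) ∷ h) i ≡ need h i ⊎ need (just (just j) ∷ h) i ≡ ℕ.pred
        (need h i)
      step (yes ≡.refl) = inj₂ (≡.trans (≡.cong (suc (toℕ i) ℕ.∸_) (sold-same h i))
        (≡.sym (ℕ.pred[m∸n]≡m∸[1+n] (suc (toℕ i)) (sold h i))))
      step (no j≢i)     = inj₁ (≡.cong (suc (toℕ i) ℕ.∸_) (sold-other h j≢i))

    w-after : ∀ T h d i → w T (need (just d ∷ h) i) ≤ w⁺ T (need h i)
    w-after T h d i = [ (λ eq → ≤-trans (≤-reflexive (reflexive (≡.cong (w T) eq))) (w≤w⁺ T (need h i))) ,
      (λ eq → ≤-trans (≤-reflexive (reflexive (≡.cong (w T) eq))) (w-pred≤w⁺ T (need h i))) ]′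
        (need-after h d i)

    constProb : ∀ T → Fin T → Carrier
    constProb T _ = p

    -- Any decision leaves each `need` unchanged or lowers it by one. `w⁺` dominates both outcomes
    -- for all products at once, and `w-suc` says that averaging with it reproduces the potential
    -- one period earlier.
    value≤Φ : ∀ T h → Within-capacity h → value hard (constProb T) h ≤ Φ T h
    value≤Φ zero    h within = sum-mono λ i → [ full i , partial i ]′ (reward-cases i (within i))
      where
      full : ∀ i → sold h i ≡ suc (toℕ i) × reward i (sold h i) ≈ v (toℕ i) →
        reward i (sold h i) ≤ v (toℕ i) * w 0 (need h i)
      full i (eq , r) = ≤-reflexive (trans r (sym
        (trans (*-congˡ (trans (reflexive (≡.cong (w 0)
        (≡.trans (≡.cong (suc (toℕ i) ℕ.∸_) eq) (ℕ.n∸n≡0 (suc (toℕ i)))))) (w-0 0))) (*-identityʳ _))))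
      partial : ∀ i → sold h i ℕ.≤ toℕ i × reward i (sold h i) ≈ 0# →
        reward i (sold h i) ≤ v (toℕ i) * w 0 (need h i)
      partial i (_ , r) = ≤-trans (≤-reflexive r) (*-nonneg (v-nonneg (toℕ i)) (w-nonneg 0 (need h i)))
    value≤Φ (suc T) h within = ≤-trans (mixture-mono hard (<⇒≤ 0<p) (<⇒≤ p<1) idle
      (maximum-≤ (available hard h) _ chosen)) (≤-reflexive total)
      where
      Φ⁺ : Carrier
      Φ⁺ = sum λ i → v (toℕ i) * w⁺ T (need h i)
      idle : value hard (constProb T) (nothing ∷ h) ≤ Φ T h
      idle = ≤-trans (value≤Φ T (nothing ∷ h) (λ i →
        ≡.subst (ℕ._≤ suc (toℕ i)) (≡.sym (sold-nothing h i)) (within i)))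
        (≤-reflexive (Φ-cong T {nothing ∷ h} {h} (sold-nothing h)))
      chosen : ∀ d → Allowed (available hard h) d → value hard (constProb T) (just d ∷ h) ≤ Φ⁺
      chosen d allowed = ≤-trans (value≤Φ T (just d ∷ h) (after-capacity h d allowed within))
        (sum-mono λ i → *-monoʳ-≤ (v-nonneg (toℕ i)) (w-after T h d i))
      total : (1# - p) * Φ T h + p * Φ⁺ ≈ Φ (suc T) h
      total = trans (+-cong (*-distribˡ-sum (1# - p) (λ i → v (toℕ i) * w T (need h i)))
        (*-distribˡ-sum p (λ i → v (toℕ i) * w⁺ T (need h i))))
        (trans (sym (∑-distrib-+ (λ i → (1# - p) * (v (toℕ i) * w T (need h i))) (λ i →
          p * (v (toℕ i) * w⁺ T (need h i)))))
          (sum-cong-≋ λ i → trans (solve 4 (λ q p v x → q :* (v :* x) :+ p := v :* (q :* x) :+ p) refl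
            (1# - p) (p * (v (toℕ i) * w⁺ T (need h i))) (v (toℕ i)) (w T (need h i)))
            (trans (+-congˡ (solve 3 (λ p v x → p :* (v :* x) := v :* (p :* x)) refl p (v (toℕ i))
              (w⁺ T (need h i))))
              (trans (sym (distribˡ _ _ _)) (*-congˡ (w-suc T (need h i)))))))


-- Allocations to a single product

module Allocations where
  single : ∀ {m} → Fin m → ℕ → Vec ℕ m
  single {suc m} zero    x = x ∷ replicate m 0
  single {suc m} (suc i) x = 0 ∷ single i x

  sum-replicate-0 : ∀ m → Vec.sum (replicate m 0) ≡ 0
  sum-replicate-0 zero    = ≡.refl
  sum-replicate-0 (suc m) = sum-replicate-0 m

  sum-single : ∀ {m} (i : Fin m) x → Vec.sum (single i x) ≡ x
  sum-single {suc m} zero    x = ≡.trans (≡.cong (x ℕ.+_) (sum-replicate-0 m)) (ℕ.+-identityʳ x)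
  sum-single {suc m} (suc i) x = sum-single i x

  lookup-single : ∀ {m} (i : Fin m) x → lookup (single i x) i ≡ x
  lookup-single {suc m} zero    x = ≡.refl
  lookup-single {suc m} (suc i) x = lookup-single i x

  lookup-single-other : ∀ {m} (i : Fin m) x j → ¬ (i ≡ j) → lookup (single i x) j ≡ 0
  lookup-single-other {suc m} zero    x zero    i≢j = ⊥-elim (i≢j ≡.refl)
  lookup-single-other {suc m} zero    x (suc j) i≢j = Vec.lookup-replicate j 0
  lookup-single-other {suc m} (suc i) x zero    i≢j = ≡.refl
  lookup-single-other {suc m} (suc i) x (suc j) i≢j = lookup-single-other i x j (i≢j ∘ ≡.cong suc)

  lookup≤sum : ∀ {m} (x : Vec ℕ m) i → lookup x i ℕ.≤ Vec.sum x
  lookup≤sum (a ∷ x) zero    = ℕ.m≤m+n a (Vec.sum x)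
  lookup≤sum (a ∷ x) (suc i) = ℕ.≤-trans (lookup≤sum x i) (ℕ.m≤n+m (Vec.sum x) a)


-- Bounds for the expected offline benchmark

module OfflineBounds {c ℓ₁ ℓ₂} (ℝ : RealField c ℓ₁ ℓ₂) where
  open RealField ℝ
  open Allocation ℝ
  open OrderedField ℝ
  open HardInstance ℝ
  open Allocations

  ∈-allocationsWithin⁻ : ∀ {m} (b : Fin m → ℕ) {x} → x ∈ allocationsWithin b → ∀ i → lookup x i ℕ.≤ b i
  ∈-allocationsWithin⁻ {suc m} b x∈ i with ∈-cartesianProductWith⁻ _∷_ (upTo (suc (b zero))) (allocationsWithin (b ∘ suc)) x∈
  ∈-allocationsWithin⁻ {suc m} b x∈ zero    | a , y , a∈ , y∈ , ≡.refl = ℕ.s≤s⁻¹ (∈-upTo⁻ a∈)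
  ∈-allocationsWithin⁻ {suc m} b x∈ (suc i) | a , y , a∈ , y∈ , ≡.refl = ∈-allocationsWithin⁻ (b ∘ suc) y∈ i

  ∈-allocationsWithin⁺ : ∀ {m} (b : Fin m → ℕ) x → (∀ i → lookup x i ℕ.≤ b i) → x ∈ allocationsWithin b
  ∈-allocationsWithin⁺ {zero}  b []      _   = here ≡.refl
  ∈-allocationsWithin⁺ {suc m} b (a ∷ x) x≤b = ∈-cartesianProductWith⁺ _∷_ (∈-upTo⁺ (s≤s (x≤b zero)))
    (∈-allocationsWithin⁺ (b ∘ suc) x (x≤b ∘ suc))

  module _ {a} {A : Set a} (f : A → Carrier) where
    foldr-⊔-≤ : ∀ {B} xs → 0# ≤ B → (∀ {x} → x ∈ xs → f x ≤ B) → foldr _⊔_ 0# (map f xs) ≤ B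
    foldr-⊔-≤ []       0≤B f≤B = 0≤B
    foldr-⊔-≤ (x ∷ xs) 0≤B f≤B = ⊔-least (f≤B (here ≡.refl)) (foldr-⊔-≤ xs 0≤B (f≤B ∘ there))

    ≤-foldr-⊔ : ∀ {x xs} → x ∈ xs → f x ≤ foldr _⊔_ 0# (map f xs)
    ≤-foldr-⊔ (here ≡.refl) = x≤x⊔y _ _
    ≤-foldr-⊔ (there x∈)    = ≤-trans (≤-foldr-⊔ x∈) (y≤x⊔y _ _)

  module _ {m} (I : Instance m) where
    open Instance I

    U-≤ : ∀ ℓ {B} → 0# ≤ B → (∀ x → (∀ i → lookup x i ℕ.≤ capacity i) → Vec.sum x ℕ.≤ ℓ →
      totalReward (lookup x) ≤ B) → U I ℓ ≤ B
    U-≤ ℓ {B} 0≤B bound = foldr-⊔-≤ (λ x → totalReward (lookup x))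
      (filter (λ x → Vec.sum x ℕ.≤? ℓ) (allocationsWithin capacity)) 0≤B λ {x} x∈ →
      step x (∈-filter⁻ (λ x → Vec.sum x ℕ.≤? ℓ) {xs = allocationsWithin capacity} x∈)
      where
      step : ∀ x → x ∈ allocationsWithin capacity × Vec.sum x ℕ.≤ ℓ → totalReward (lookup x) ≤ B
      step x (x∈ , Σx≤ℓ) = bound x (∈-allocationsWithin⁻ capacity x∈) Σx≤ℓ

    ≤-U : ∀ ℓ x → (∀ i → lookup x i ℕ.≤ capacity i) → Vec.sum x ℕ.≤ ℓ → totalReward (lookup x) ≤ U I ℓ
    ≤-U ℓ x x≤b Σx≤ℓ = ≤-foldr-⊔ (λ x → totalReward (lookup x))
      (∈-filter⁺ (λ x → Vec.sum x ℕ.≤? ℓ) (∈-allocationsWithin⁺ capacity x x≤b) Σx≤ℓ)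

  sum-≤-const : ∀ {m} {f : Fin m → Carrier} {B} → (∀ i → f i ≤ B) → sum f ≤ fromℕ m * B
  sum-≤-const {zero}  {B = B} f≤B = ≤-reflexive (sym (zeroˡ B))
  sum-≤-const {suc m} {B = B} f≤B = ≤-trans (+-mono-≤ (f≤B zero) (sum-≤-const (f≤B ∘ suc)))
    (≤-reflexive (solve 2 (λ m b → b :+ m :* b := (:1 :+ m) :* b) refl (fromℕ m) B))

  -- Counting m small terms instead of m - 1 only enlarges the O(p) error.
  sum-one-large : ∀ {m} {f : Fin m → Carrier} {A B} j → 0# ≤ B → f j ≤ A → (∀ i → ¬ (i ≡ j) → f i ≤ B) →
    sum f ≤ A + fromℕ m * B
  sum-one-large {suc m} {f} {A} {B} zero    0≤B fj≤A f≤B =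
    +-mono-≤ fj≤A (≤-trans (sum-≤-const λ i → f≤B (suc i) λ ())
    (*-monoˡ-≤ 0≤B (fromℕ-mono-≤ (ℕ.n≤1+n m))))
  sum-one-large {suc m} {f} {A} {B} (suc j) 0≤B fj≤A f≤B =
    ≤-trans (+-mono-≤ (f≤B zero λ ()) (sum-one-large j 0≤B fj≤A λ i i≢j →
    f≤B (suc i) (i≢j ∘ Fin.suc-injective)))
    (≤-reflexive (solve 3 (λ a m b → b :+ (a :+ m :* b) := a :+ (:1 :+ m) :* b) refl A (fromℕ m) B))

  sum-nonneg : ∀ {m} {f : Fin m → Carrier} → (∀ i → 0# ≤ f i) → 0# ≤ sum f
  sum-nonneg {zero}  0≤f = ≤-refl
  sum-nonneg {suc m} 0≤f = +-nonneg (0≤f zero) (sum-nonneg (0≤f ∘ suc))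

  term≤sum : ∀ {m} {f : Fin m → Carrier} → (∀ i → 0# ≤ f i) → ∀ j → f j ≤ sum f
  term≤sum {suc m} 0≤f zero    = x≤x+y (sum-nonneg (0≤f ∘ suc))
  term≤sum {suc m} 0≤f (suc j) = ≤-resp-≈ (+-identityˡ _) refl (+-mono-≤ (0≤f zero) (term≤sum (0≤f ∘ suc) j))

  ^-antitone : ∀ {x} m n → 0# ≤ x → x ≤ 1# → m ℕ.≤ n → x ^ n ≤ x ^ m
  ^-antitone {x} zero    zero    0≤x x≤1 z≤n       = ≤-refl
  ^-antitone {x} zero    (suc n) 0≤x x≤1 z≤n       = ≤-resp-≈ refl (*-identityˡ 1#)
    (*-mono-≤ (^-nonneg n 0≤x) 0≤1 x≤1 (^-antitone zero n 0≤x x≤1 z≤n))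
  ^-antitone {x} (suc m) (suc n) 0≤x x≤1 (s≤s m≤n) = *-monoʳ-≤ 0≤x (^-antitone m n 0≤x x≤1 m≤n)

  arrivals≤T : ∀ {T} (a : Vec Bool T) → arrivals a ℕ.≤ T
  arrivals≤T = Vec.count≤n (Bool._≟ true)

  𝔼-mono : ∀ {T} (p : Fin T → Carrier) {f g} → (∀ t → 0# ≤ p t × p t ≤ 1#) → (∀ a → f a ≤ g a) → 𝔼 p f ≤ 𝔼 p g
  𝔼-mono {zero}  p prob f≤g = f≤g []
  𝔼-mono {suc T} p prob f≤g = +-mono-≤
    (*-monoʳ-≤ (proj₁ (prob zero)) (𝔼-mono (p ∘ suc) (prob ∘ suc) (f≤g ∘ (true ∷_))))
    (*-monoʳ-≤ (x≤y⇒0≤y-x (proj₂ (prob zero))) (𝔼-mono (p ∘ suc) (prob ∘ suc) (f≤g ∘ (false ∷_))))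

  𝔼-cong : ∀ {T} (p : Fin T → Carrier) {f g} → (∀ a → f a ≈ g a) → 𝔼 p f ≈ 𝔼 p g
  𝔼-cong {zero}  p f≈g = f≈g []
  𝔼-cong {suc T} p f≈g = +-cong (*-congˡ (𝔼-cong (p ∘ suc) (f≈g ∘ (true ∷_))))
    (*-congˡ (𝔼-cong (p ∘ suc) (f≈g ∘ (false ∷_))))

  𝔼-* : ∀ {T} (p : Fin T → Carrier) x f → 𝔼 p (λ a → x * f a) ≈ x * 𝔼 p f
  𝔼-* {zero}  p x f = refl
  𝔼-* {suc T} p x f = trans (+-cong (*-congˡ (𝔼-* (p ∘ suc) x (f ∘ (true ∷_))))
    (*-congˡ (𝔼-* (p ∘ suc) x (f ∘ (false ∷_)))))
    (solve 4 (λ p x u v → p :* (x :* u) :+ (:1 :- p) :* (x :* v) := x :* (p :* u :+ (:1 :- p) :* v))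
      refl (p zero) x (𝔼 (p ∘ suc) (f ∘ (true ∷_))) (𝔼 (p ∘ suc) (f ∘ (false ∷_))))

  -- The exponent counts the periods without a customer, so each period contributes independently
  -- the factor p · 1 + (1-p) · p.
  𝔼-power : ∀ T p → 𝔼 {T} (λ _ → p) (λ a → p ^ (T ℕ.∸ arrivals a)) ≈ (p * (1# + 1# - p)) ^ T
  𝔼-power zero    p = refl
  𝔼-power (suc T) p = trans (+-congˡ (*-congˡ missed)) (trans
    (solve 2 (λ p x → p :* x :+ (:1 :- p) :* (p :* x) := p :* (:1 :+ :1 :- p) :* x) refl p
      (𝔼 {T} (λ _ → p) (λ a → p ^ (T ℕ.∸ arrivals a))))
    (*-congˡ (𝔼-power T p)))
    where
    missed : 𝔼 {T} (λ _ → p) (λ a → p ^ (suc T ℕ.∸ arrivals a)) ≈ p * 𝔼 {T} (λ _ → p) (λ a →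
      p ^ (T ℕ.∸ arrivals a))
    missed = trans (𝔼-cong {T} (λ _ → p) λ a → reflexive (≡.cong (p ^_) (ℕ.+-∸-assoc 1 (arrivals≤T a))))
      (𝔼-* {T} (λ _ → p) p (λ a → p ^ (T ℕ.∸ arrivals a)))

  module HardOffline (n : ℕ) (p : Carrier) (0<p : 0# < p) (p<1 : p < 1#) where
    open Hard n p 0<p p<1
    open Instance hard using (totalReward; reward)

    v≤U : ∀ k → k ℕ.≤ n → v k ≤ U hard (suc k)
    v≤U k k≤n = ≡.subst (λ k → v k ≤ U hard (suc k)) (Fin.toℕ-fromℕ< (s≤s k≤n)) (bound (fromℕ< (s≤s k≤n)))
      where
      bound : ∀ (i : Fin (suc n)) → v (toℕ i) ≤ U hard (suc (toℕ i))
      bound i = ≤-trans earned (≤-U hard (suc (toℕ i)) x within (ℕ.≤-reflexive (sum-single i (suc (toℕ i)))))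
        where
        x : Vec ℕ (suc n)
        x = single i (suc (toℕ i))
        within : ∀ j → lookup x j ℕ.≤ suc (toℕ j)
        within j = step (i Fin.≟ j)
          where
          step : Dec (i ≡ j) → lookup x j ℕ.≤ suc (toℕ j)
          step (yes ≡.refl) = ℕ.≤-reflexive (lookup-single i (suc (toℕ i)))
          step (no i≢j)     = ℕ.≤-trans (ℕ.≤-reflexive (lookup-single-other i (suc (toℕ i)) j i≢j)) z≤n
        earned : v (toℕ i) ≤ totalReward (lookup x)
        earned = ≤-trans (≤-reflexive (sym (trans
          (reflexive (≡.cong (reward i) (lookup-single i (suc (toℕ i))))) (reward-full i))))
          (term≤sum (λ j → reward-nonneg j (within j)) i)

    -- With k + 1 customers no product beyond k can be completed, and one before k pays at most p
    -- times as much as product k.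
    U≤v : ∀ k → k ℕ.≤ n → U hard (suc k) ≤ v k + fromℕ (suc n) * (p * v k)
    U≤v k k≤n = ≡.subst (λ k → U hard (suc k) ≤ v k + fromℕ (suc n) * (p * v k))
      (Fin.toℕ-fromℕ< (s≤s k≤n)) (bound (fromℕ< (s≤s k≤n)))
      where
      bound : ∀ (i : Fin (suc n)) → U hard (suc (toℕ i)) ≤ v (toℕ i) + fromℕ (suc n) * (p * v (toℕ i))
      bound i = U-≤ hard (suc (toℕ i)) (≤-trans (v-nonneg (toℕ i))
        (x≤x+y (*-nonneg (fromℕ-nonneg (suc n)) 0≤pv)))
        λ x within Σx≤ → sum-one-large i 0≤pv (main x within) (minor x within Σx≤)
        where
        0≤pv : 0# ≤ p * v (toℕ i)
        0≤pv = *-nonneg (<⇒≤ 0<p) (v-nonneg (toℕ i))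
        main : ∀ x → (∀ j → lookup x j ℕ.≤ suc (toℕ j)) → reward i (lookup x i) ≤ v (toℕ i)
        main x within = [ (λ q → ≤-reflexive (proj₂ q)) , (λ q →
          ≤-trans (≤-reflexive (proj₂ q)) (v-nonneg (toℕ i))) ]′ (reward-cases i (within i))
        minor : ∀ x → (∀ j → lookup x j ℕ.≤ suc (toℕ j)) → Vec.sum x ℕ.≤ suc (toℕ i) → ∀ j → ¬ (j ≡ i) →
          reward j (lookup x j) ≤ p * v (toℕ i)
        minor x within Σx≤ j j≢i = [ (λ q → ≤-trans (≤-reflexive (proj₂ q)) (smaller (j<i (proj₁ q)))) ,
          (λ q → ≤-trans (≤-reflexive (proj₂ q)) 0≤pv) ]′ (reward-cases j (within j))
          where
          j<i : lookup x j ≡ suc (toℕ j) → toℕ j ℕ.< toℕ i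
          j<i full = ℕ.≤∧≢⇒< (ℕ.s≤s⁻¹ (ℕ.≤-trans (ℕ.≤-reflexive (≡.sym full))
            (ℕ.≤-trans (lookup≤sum x j) Σx≤))) (j≢i ∘ Fin.toℕ-injective)
          smaller : toℕ j ℕ.< toℕ i → v (toℕ j) ≤ p * v (toℕ i)
          smaller lt = ^-antitone (suc (n ℕ.∸ toℕ i)) (n ℕ.∸ toℕ j) (<⇒≤ 0<p) (<⇒≤ p<1)
            (ℕ.∸-monoʳ-< lt (ℕ.s≤s⁻¹ (Fin.toℕ<n i)))

    prob : ∀ {T} (t : Fin T) → 0# ≤ p × p ≤ 1#
    prob _ = <⇒≤ 0<p , <⇒≤ p<1

    base : Carrier
    base = (p * (1# + 1# - p)) ^ n

    𝔼U-later : 𝔼U hard ≈ 𝔼 {n} (λ _ → p) (λ a → U hard (suc (arrivals a)))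
    𝔼U-later = solve 2 (λ x y → :1 :* x :+ (:1 :- :1) :* y := x) refl _ _

    base≤𝔼U : base ≤ 𝔼U hard
    base≤𝔼U = ≤-resp-≈ (𝔼-power n p) (sym 𝔼U-later) (𝔼-mono {n} (λ _ → p) prob λ a →
      v≤U (arrivals a) (arrivals≤T a))

    𝔼U≤base : 𝔼U hard ≤ (1# + fromℕ (suc n) * p) * base
    𝔼U≤base = ≤-resp-≈ (sym 𝔼U-later) (trans (𝔼-* {n} (λ _ → p) (1# + fromℕ (suc n) * p) (λ a →
      v (arrivals a))) (*-congˡ (𝔼-power n p)))
      (𝔼-mono {n} (λ _ → p) prob λ a → ≤-trans (U≤v (arrivals a) (arrivals≤T a))
        (≤-reflexive (solve 3 (λ v m p → v :+ m :* (p :* v) := (:1 :+ m :* p) :* v) refl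
          (v (arrivals a)) (fromℕ (suc n)) p)))


-- Bounds for the online optimum of the hard instance

module OnlineBounds {c ℓ₁ ℓ₂} (ℝ : RealField c ℓ₁ ℓ₂) where
  open RealField ℝ
  open Allocation ℝ
  open OrderedField ℝ
  open Optimum ℝ
  open HardInstance ℝ
  open OfflineBounds ℝ
  open Binomial

  module HardOnline (n : ℕ) (p : Carrier) (0<p : 0# < p) (p<1 : p < 1#) where
    open Hard n p 0<p p<1
    open Instance hard using (totalReward; reward)

    μ : Carrier
    μ = fromℕ (middle n)

    μ-nonneg : 0# ≤ μ
    μ-nonneg = fromℕ-nonneg (middle n)

    first-value : optimum hard ≈ maximum (available hard []) (λ d → value hard (constProb n) (just d ∷ []))
    first-value = solve 2 (λ x y → (:1 :- :1) :* x :+ :1 :* y := y) refl _ _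

    pⁿμ-nonneg : 0# ≤ p ^ n * μ
    pⁿμ-nonneg = *-nonneg (^-nonneg n (<⇒≤ 0<p)) μ-nonneg

    v*w : ∀ i k → i ℕ.≤ n → v i * (fromℕ k * p ^ i) ≈ p ^ n * fromℕ k
    v*w i k i≤n = trans (solve 3 (λ v c q → v :* (c :* q) := (v :* q) :* c) refl (v i) (fromℕ k)
      (p ^ i)) (*-congʳ (v*p^ i≤n))

    v*w-chosen : ∀ (i : Fin (suc n)) → v (toℕ i) * w n (toℕ i) ≤ p ^ n * μ
    v*w-chosen i = ≤-resp-≈ (sym (v*w (toℕ i) (n C toℕ i) (ℕ.s≤s⁻¹ (Fin.toℕ<n i)))) refl
      (*-monoʳ-≤ (^-nonneg n (<⇒≤ 0<p)) (fromℕ-mono-≤ (C-central-max n (toℕ i))))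

    v*w-other : ∀ (i : Fin (suc n)) → v (toℕ i) * w n (suc (toℕ i)) ≤ p * (p ^ n * μ)
    v*w-other i = ≤-resp-≈
      (trans (*-congˡ (sym (v*w (toℕ i) (n C suc (toℕ i)) (ℕ.s≤s⁻¹ (Fin.toℕ<n i)))))
        (solve 4 (λ p v c q → p :* (v :* (c :* q)) := v :* (c :* (p :* q))) refl p (v (toℕ i))
          (fromℕ (n C suc (toℕ i))) (p ^ toℕ i)))
      refl
      (*-monoʳ-≤ (<⇒≤ 0<p) (*-monoʳ-≤ (^-nonneg n (<⇒≤ 0<p)) (fromℕ-mono-≤ (C-central-max n (suc (toℕ i))))))

    optimum-upper : optimum hard ≤ p ^ n * μ + fromℕ (suc n) * (p * (p ^ n * μ))
    optimum-upper = ≤-trans (≤-reflexive first-value) (maximum-≤ (available hard []) _ λ d allowed →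
      ≤-trans (value≤Φ n (just d ∷ []) (after-capacity [] d allowed λ i → z≤n)) (bound d))
      where
      0≤ppⁿμ : 0# ≤ p * (p ^ n * μ)
      0≤ppⁿμ = *-nonneg (<⇒≤ 0<p) pⁿμ-nonneg
      term-≡ : ∀ {d i k} → need (just d ∷ []) i ≡ k →
        v (toℕ i) * w n (need (just d ∷ []) i) ≈ v (toℕ i) * w n k
      term-≡ {d} {i} eq = reflexive (≡.cong (λ k → v (toℕ i) * w n k) eq)
      bound : ∀ d → Φ n (just d ∷ []) ≤ p ^ n * μ + fromℕ (suc n) * (p * (p ^ n * μ))
      bound nothing = ≤-trans (sum-≤-const λ i →
        ≤-trans (≤-reflexive (term-≡ {nothing} {i} (≡.cong (suc (toℕ i) ℕ.∸_) (sold-reject [] i))))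
        (v*w-other i))
        (x≤y+x pⁿμ-nonneg)
      bound (just j) = sum-one-large j 0≤ppⁿμ
        (≤-trans (≤-reflexive (term-≡ {just j} {j} (≡.cong (suc (toℕ j) ℕ.∸_) (sold-same [] j))))
          (v*w-chosen j))
        λ i i≢j → ≤-trans (≤-reflexive (term-≡ {just j} {i}
          (≡.cong (suc (toℕ i) ℕ.∸_) (sold-other [] (i≢j ∘ ≡.sym))))) (v*w-other i)

    q : Carrier
    q = 1# - p

    0≤q : 0# ≤ q
    0≤q = x≤y⇒0≤y-x (<⇒≤ p<1)

    q≤1 : q ≤ 1#
    q≤1 = ≤-resp-≈ (+-identityʳ _) (solve 1 (λ p → :1 :- p :+ p := :1) refl p) (+-monoʳ-≤ q (<⇒≤ 0<p))

    -- At most the probability C(T,j) p^j q^(T-j) of exactly j arrivals. The cruder exponent T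
    -- avoids subtraction and costs only a factor tending to 1 as p tends to 0.
    ψ : ℕ → ℕ → Carrier
    ψ T j = w T j * q ^ T

    ψ-nonneg : ∀ T j → 0# ≤ ψ T j
    ψ-nonneg T j = *-nonneg (w-nonneg T j) (^-nonneg T 0≤q)

    -- Pascal's rule would give equality for positive j with a further factor q in the arrival
    -- branch; dropping it is the whole loss.
    ψ-suc : ∀ T j → ψ (suc T) j ≤ q * ψ T j + p * ψ T (ℕ.pred j)
    ψ-suc T zero    = ≤-resp-≈ refl (solve 3 (λ p w q →
      :1 :* (w :* q) := (:1 :- p) :* (w :* q) :+ p :* (w :* q)) refl p (w T 0) (q ^ T))
      (≤-resp-≈ (solve 3 (λ w q x → q :* (w :* x) := w :* (q :* x)) refl (w T 0) q (q ^ T)) refl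
        (*-monoˡ-≤ (ψ-nonneg T 0) q≤1))
    ψ-suc T (suc j) = ≤-resp-≈
      (trans (solve 6 (λ q a b p x y → q :* (b :* (p :* x) :* y) :+ q :* (p :* (a :* x :* y)) :=
        (a :+ b) :* (p :* x) :* (q :* y)) refl q a b p (p ^ j) (q ^ T))
        (*-congʳ (*-congʳ (trans (sym (fromℕ-homo-+ (T C j) (T C suc j)))
          (reflexive (≡.cong fromℕ (nCk+nC[k+1]≡[n+1]C[k+1] T j)))))))
      refl
      (+-monoʳ-≤ (q * ψ T (suc j)) (≤-resp-≈ refl (*-identityˡ _)
        (*-monoˡ-≤ (*-nonneg (<⇒≤ 0<p) (ψ-nonneg T j)) q≤1)))
      where
      a = fromℕ (T C j)
      b = fromℕ (T C suc j)

    module _ (g : Fin (suc n)) where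

      -- The strategy behind the bound sells g to every customer until it is full and then rejects.
      -- It enters only as a competitor in each maximum of the Bellman recursion.
      ψ≤value : ∀ T h → Within-capacity h → v (toℕ g) * ψ T (need h g) ≤ value hard (constProb T) h
      ψ≤value zero h within = ≤-trans ([ full , partial ]′ (reward-cases g (within g)))
        (term≤sum (λ i → reward-nonneg i (within i)) g)
        where
        full : sold h g ≡ suc (toℕ g) × reward g (sold h g) ≈ v (toℕ g) →
          v (toℕ g) * ψ 0 (need h g) ≤ reward g (sold h g)
        full (eq , r) = ≤-reflexive (trans (*-congˡ
          (trans (reflexive (≡.cong (ψ 0) (≡.trans (≡.cong (suc (toℕ g) ℕ.∸_) eq) (ℕ.n∸n≡0 (suc (toℕ g))))))
          (trans (*-identityʳ _) (w-0 0)))) (trans (*-identityʳ _) (sym r)))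
        partial : sold h g ℕ.≤ toℕ g × reward g (sold h g) ≈ 0# →
          v (toℕ g) * ψ 0 (need h g) ≤ reward g (sold h g)
        partial (le , r) = ≤-reflexive (trans
          (*-congˡ (trans (reflexive (≡.cong (ψ 0) (ℕ.+-∸-assoc 1 le))) vanish)) (trans (zeroʳ _) (sym r)))
          where
          vanish : ψ 0 (suc (toℕ g ℕ.∸ sold h g)) ≈ 0#
          vanish = trans (*-congʳ (zeroˡ _)) (zeroˡ _)
      ψ≤value (suc T) h within = ≤-trans (*-monoʳ-≤ (v-nonneg (toℕ g)) (ψ-suc T (need h g)))
        (≤-trans (≤-reflexive (solve 5 (λ v p q x y →
          v :* (q :* x :+ p :* y) := q :* (v :* x) :+ p :* (v :* y)) refl (v (toℕ g)) p q
          (ψ T (need h g)) (ψ T (ℕ.pred (need h g)))))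
          (mixture-mono hard (<⇒≤ 0<p) (<⇒≤ p<1) idle (chosen (available hard h g) ≡.refl)))
        where
        idle : v (toℕ g) * ψ T (need h g) ≤ value hard (constProb T) (nothing ∷ h)
        idle = ≤-trans (≤-reflexive (reflexive
          (≡.cong (λ s → v (toℕ g) * ψ T (suc (toℕ g) ℕ.∸ s)) (≡.sym (sold-nothing h g)))))
          (ψ≤value T (nothing ∷ h) λ i → ≡.subst (ℕ._≤ suc (toℕ i)) (≡.sym (sold-nothing h i)) (within i))
        after : ∀ d → Allowed (available hard h) d → need (just d ∷ h) g ≡ ℕ.pred (need h g) →
          v (toℕ g) * ψ T (ℕ.pred (need h g)) ≤ maximum (available hard h) (λ d →
            value hard (constProb T) (just d ∷ h))
        after d allowed eq = ≤-trans (≤-reflexive (reflexive (≡.cong (λ k → v (toℕ g) * ψ T k) (≡.sym eq))))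
          (≤-trans (ψ≤value T (just d ∷ h) (after-capacity h d allowed within))
            (≤-maximum (available hard h) (λ d → value hard (constProb T) (just d ∷ h)) d allowed))
        chosen : ∀ b → available hard h g ≡ b →
          v (toℕ g) * ψ T (ℕ.pred (need h g)) ≤ maximum (available hard h) (λ d →
          value hard (constProb T) (just d ∷ h))
        chosen true  allowed = after (just g) allowed
          (≡.trans (≡.cong (suc (toℕ g) ℕ.∸_) (sold-same h g))
          (≡.sym (ℕ.pred[m∸n]≡m∸[1+n] (suc (toℕ g)) (sold h g))))
        -- Once g is sold out its need is 0, and truncated `pred` leaves it there, so rejecting
        -- matches the recursion for `ψ`.
        chosen false blocked = after nothing ≡.refl
          (≡.trans (≡.cong (suc (toℕ g) ℕ.∸_) (sold-reject h g))
          (≡.trans none (≡.sym (≡.cong ℕ.pred none))))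
          where
          sold-out : suc (toℕ g) ℕ.≤ sold h g
          sold-out = available-≥ hard {h} {g} blocked
          none : need h g ≡ 0
          none = ℕ.m≤n⇒m∸n≡0 sold-out

      commit : p ^ n * (fromℕ (n C toℕ g) * q ^ n) ≤ optimum hard
      commit = ≤-trans (≤-reflexive (sym (trans
        (*-congˡ (reflexive (≡.cong (ψ n) (≡.cong (suc (toℕ g) ℕ.∸_) (sold-same [] g)))))
          (trans (sym (*-assoc _ _ _)) (trans
            (*-congʳ (v*w (toℕ g) (n C toℕ g) (ℕ.s≤s⁻¹ (Fin.toℕ<n g)))) (*-assoc _ _ _))))))
        (≤-trans (ψ≤value n (just (just g) ∷ []) (after-capacity [] (just g) ≡.refl λ i → z≤n))
          (≤-trans (≤-maximum (available hard []) (λ d → value hard (constProb n) (just d ∷ []))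
            (just g) ≡.refl) (≤-reflexive (sym first-value))))

    optimum-lower : p ^ n * (μ * q ^ n) ≤ optimum hard
    optimum-lower = ≡.subst (λ k → p ^ n * (fromℕ (n C k) * q ^ n) ≤ optimum hard)
      (Fin.toℕ-fromℕ< half<) (commit (fromℕ< half<))
      where
      half< : ℕ.⌊ n /2⌋ ℕ.< suc n
      half< = s≤s (ℕ.⌊n/2⌋≤n n)


-- The limit of the ratio as p tends to zero

module CompetitiveRatio {c ℓ₁ ℓ₂} (ℝ : RealField c ℓ₁ ℓ₂) where
  open RealField ℝ
  open Analysis ℝ
  open Allocation ℝ
  open OrderedField ℝ
  open Exp commutativeSemiring using (^-congˡ; ^-distrib-*)
  open Optimum ℝ
  open HardInstance ℝ
  open OfflineBounds ℝ
  open OnlineBounds ℝ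
  open Binomial

  ^-mono : ∀ {x y} n → 0# ≤ x → x ≤ y → x ^ n ≤ y ^ n
  ^-mono zero    0≤x x≤y = ≤-refl
  ^-mono (suc n) 0≤x x≤y = *-mono-≤ (^-nonneg n 0≤x) (≤-trans 0≤x x≤y) x≤y (^-mono n 0≤x x≤y)

  1^n≈1 : ∀ n → 1# ^ n ≈ 1#
  1^n≈1 zero    = refl
  1^n≈1 (suc n) = trans (*-identityˡ _) (1^n≈1 n)

  -- A first-order estimate in which x ≥ 1 allows xⁿ instead of xⁿ⁻¹ in the error. It is applied at
  -- x = 2, for the benchmark, and at x = 1, for the factor qⁿ.
  bernoulli : ∀ {x p} n → 1# ≤ x → 0# ≤ p → 0# ≤ x - p → x ^ n ≤ (x - p) ^ n + fromℕ n * (p * x ^ n)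
  bernoulli {x} {p} zero    1≤x 0≤p 0≤x-p = ≤-reflexive (sym (trans (+-congˡ (zeroˡ _)) (+-identityʳ _)))
  bernoulli {x} {p} (suc n) 1≤x 0≤p 0≤x-p = ≤-trans (*-monoʳ-≤ 0≤x (bernoulli n 1≤x 0≤p 0≤x-p)) (≤-resp-≈
    (solve 5 (λ x p y z n → (x :- p) :* y :+ p :* y :+ n :* (p :* (x :* z)) := x :*
      (y :+ n :* (p :* z))) refl x p ((x - p) ^ n) (x ^ n) (fromℕ n))
    (solve 5 (λ x p y z n → (x :- p) :* y :+ p :* (x :* z) :+ n :* (p :* (x :* z)) := (x :- p) :* y :+
      (:1 :+ n) :* (p :* (x :* z))) refl x p ((x - p) ^ n) (x ^ n) (fromℕ n))
    (+-monoˡ-≤ _ (+-monoʳ-≤ _ (*-monoʳ-≤ 0≤p (≤-trans (^-mono n 0≤x-p x-p≤x)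
      (≤-resp-≈ (*-identityˡ _) refl (*-monoˡ-≤ (^-nonneg n 0≤x) 1≤x)))))))
    where
    0≤x : 0# ≤ x
    0≤x = ≤-trans 0≤1 1≤x
    x-p≤x : x - p ≤ x
    x-p≤x = ≤-resp-≈ (+-identityʳ _) (solve 2 (λ x p → x :- p :+ p := x) refl x p) (+-monoʳ-≤ (x - p) 0≤p)

  module _ (n : ℕ) (p : Carrier) (0<p : 0# < p) (p<1 : p < 1#) where
    open Hard n p 0<p p<1 using (hard)
    open HardOffline n p 0<p p<1
    open HardOnline n p 0<p p<1

    A : Carrier
    A = p ^ n

    A-nonneg : 0# ≤ A
    A-nonneg = ^-nonneg n (<⇒≤ 0<p)

    2-p : Carrier
    2-p = 1# + 1# - p

    D : Carrier
    D = 2-p ^ n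

    1≤2-p : 1# ≤ 2-p
    1≤2-p = ≤-resp-≈ (+-identityʳ 1#) (sym (+-assoc _ _ _)) (+-monoʳ-≤ 1# 0≤q)

    1≤D : 1# ≤ D
    1≤D = ≤-resp-≈ (1^n≈1 n) refl (^-mono n 0≤1 1≤2-p)

    2^n : Carrier
    2^n = (1# + 1#) ^ n

    D≤2^n : D ≤ 2^n
    D≤2^n = ^-mono n (≤-trans 0≤1 1≤2-p) (≤-resp-≈ (+-identityʳ _)
      (solve 1 (λ p → :1 :+ :1 :- p :+ p := :1 :+ :1) refl p) (+-monoʳ-≤ 2-p (<⇒≤ 0<p)))

    2^n-fromℕ : fromℕ (2 ℕ.^ n) ≈ 2^n
    2^n-fromℕ = trans (fromℕ-homo-^ 2 n) (^-congˡ n (+-congˡ (+-identityʳ 1#)))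

    base≈A*D : base ≈ A * D
    base≈A*D = ^-distrib-* p 2-p n

    𝔼U-pos : 0# < 𝔼U hard
    𝔼U-pos = <-≤-trans (^-pos n (*-pos 0<p (<-≤-trans 0<1 1≤2-p))) base≤𝔼U

    module _ (r : Carrier) (0≤r : 0# ≤ r) (r*2^n≈μ : r * fromℕ (2 ℕ.^ n) ≈ μ) where

      N M K : Carrier
      N = fromℕ n
      M = fromℕ (suc n)
      -- N comes from Bernoulli's estimate, M from the n + 1 products in the O(p) terms of both
      -- upper bounds.
      K = (N + M) * μ

      K-nonneg : 0# ≤ K
      K-nonneg = *-nonneg (+-nonneg (fromℕ-nonneg n) (fromℕ-nonneg (suc n))) μ-nonneg

      Kp-nonneg : 0# ≤ K * p
      Kp-nonneg = *-nonneg K-nonneg (<⇒≤ 0<p)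

      r*2^n : r * 2^n ≈ μ
      r*2^n = trans (*-congˡ (sym 2^n-fromℕ)) r*2^n≈μ

      1≤2 : 1# ≤ 1# + 1#
      1≤2 = x≤x+y 0≤1

      μ≤rD : μ ≤ r * D + N * (p * μ)
      μ≤rD = ≤-resp-≈ r*2^n (trans (solve 5 (λ r d n p t →
        r :* (d :+ n :* (p :* t)) := r :* d :+ n :* (p :* (r :* t))) refl r D N p 2^n)
        (+-congˡ (*-congˡ (*-congˡ r*2^n))))
        (*-monoʳ-≤ 0≤r (bernoulli n 1≤2 (<⇒≤ 0<p) (≤-trans 0≤1 1≤2-p)))

      μ≤μqⁿ : μ ≤ μ * q ^ n + N * (p * μ)
      μ≤μqⁿ = ≤-resp-≈ (trans (*-congˡ (1^n≈1 n)) (*-identityʳ μ))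
        (trans (*-congˡ (+-congˡ (*-congˡ (*-congˡ (1^n≈1 n)))))
          (solve 4 (λ m x n p → m :* (x :+ n :* (p :* :1)) := m :* x :+ n :* (p :* m)) refl μ (q ^ n) N p))
        (*-monoʳ-≤ μ-nonneg (bernoulli n ≤-refl (<⇒≤ 0<p) 0≤q))

      Kp≤KpD : K * p ≤ K * p * D
      Kp≤KpD = ≤-resp-≈ (*-identityʳ _) refl (*-monoʳ-≤ Kp-nonneg 1≤D)

      -- Without the factor pⁿ, `optimum-upper` is μ plus O(p), where μ = r 2ⁿ, while the target
      -- contains r D with D = (2-p)ⁿ. Bernoulli bridges the two, and D ≥ 1 lets the error be
      -- written as K p D, so that `base` factors out.
      optimum≤ : optimum hard ≤ (r + K * p) * 𝔼U hard
      optimum≤ = ≤-trans optimum-upper (≤-trans (≤-resp-≈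
          (solve 4 (λ a m k p → a :* (m :+ k :* (p :* m)) := a :* m :+ k :* (p :* (a :* m))) refl A μ M p)
          (trans (solve 4 (λ a r k d → a :* (r :* d :+ k :* d) := (r :+ k) :* (a :* d)) refl A r (K * p)
            D) (*-congˡ (sym base≈A*D)))
          (*-monoʳ-≤ A-nonneg inner))
        (*-monoʳ-≤ (+-nonneg 0≤r Kp-nonneg) base≤𝔼U))
        where
        inner : μ + M * (p * μ) ≤ r * D + K * p * D
        inner = ≤-trans (+-monoˡ-≤ (M * (p * μ)) μ≤rD) (≤-resp-≈
          (solve 5 (λ x n m p u → x :+ (n :+ m) :* u :* p := x :+ n :* (p :* u) :+ m :* (p :* u)) refl
            (r * D) N M p μ) refl
          (+-monoʳ-≤ (r * D) Kp≤KpD))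

      r*𝔼U≤ : r * 𝔼U hard ≤ optimum hard + K * p * 𝔼U hard
      r*𝔼U≤ = ≤-trans (*-monoʳ-≤ 0≤r 𝔼U≤base) (≤-trans
        (≤-resp-≈ (trans (solve 4 (λ a r d m → a :* (m :* (r :* d)) := r :* (m :* (a :* d))) refl A r D
          (1# + M * p)) (*-congˡ (*-congˡ (sym base≈A*D))))
          (trans (distribˡ A _ _) (+-congˡ (trans
            (solve 3 (λ a k d → a :* (k :* d) := k :* (a :* d)) refl A (K * p) D)
            (*-congˡ (sym base≈A*D)))))
          (*-monoʳ-≤ A-nonneg inner))
        (+-mono-≤ optimum-lower (*-monoʳ-≤ Kp-nonneg base≤𝔼U)))
        where
        rD≤μ : r * D ≤ μ
        rD≤μ = ≤-resp-≈ refl r*2^n (*-monoʳ-≤ 0≤r D≤2^n)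
        1+Mp-nonneg : 0# ≤ 1# + M * p
        1+Mp-nonneg = +-nonneg 0≤1 (*-nonneg (fromℕ-nonneg (suc n)) (<⇒≤ 0<p))
        inner : (1# + M * p) * (r * D) ≤ μ * q ^ n + K * p * D
        inner = ≤-trans (*-monoʳ-≤ 1+Mp-nonneg rD≤μ) (≤-trans
          (≤-resp-≈ (solve 3 (λ u m p → u :+ m :* (p :* u) := (:1 :+ m :* p) :* u) refl μ M p)
            (solve 5 (λ x n m p u → x :+ n :* (p :* u) :+ m :* (p :* u) := x :+ (n :+ m) :* u :* p) refl
              (μ * q ^ n) N M p μ)
            (+-monoˡ-≤ (M * (p * μ)) μ≤μqⁿ))
          (+-monoʳ-≤ _ Kp≤KpD))

      ratio-close : ∀ {ε} → K * p < ε → ∣ optimum hard / 𝔼U hard ⟨ 𝔼U-pos ⟩ - r ∣ < ε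
      ratio-close Kp<ε = ∣x-y∣<ε
        (≤-<-trans (*-cancelʳ-≤ 𝔼U-pos (≤-trans (≤-reflexive (/-*-cancel _ 𝔼U-pos)) optimum≤))
          (+-monoʳ-< r Kp<ε))
        (≤-<-trans (*-cancelʳ-≤ 𝔼U-pos (≤-trans r*𝔼U≤
          (≤-reflexive (sym (trans (distribʳ _ _ _) (+-congʳ (/-*-cancel _ 𝔼U-pos))))))) (+-monoʳ-< _ Kp<ε))

  hardFamily : ∀ n → Family (suc n)
  hardFamily n = record
    { at      = λ (p , 0<p , p<1) → Hard.hard n p 0<p p<1
    ; at-cong = λ p≈q → record
      { capacity-≡    = λ i → ≡.refl
      ; baseReward-≈  = λ i → refl
      ; bonus-≈       = λ i k → if-cong (toℕ i ℕ.<ᵇ k) (^-congˡ (n ℕ.∸ toℕ i) p≈q)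
      ; horizon-≡     = ≡.refl
      ; arrivalProb-≈ = λ { zero → refl ; (suc t) → p≈q }
      }
    }
    where
    if-cong : ∀ b {x y} → x ≈ y → (if b then x else 0#) ≈ (if b then y else 0#)
    if-cong true  x≈y = x≈y
    if-cong false x≈y = refl

  hardFamily-ratio : ∀ n →
    let open Family (hardFamily n) in
    (λ p → optimum (at p) / 𝔼U (at p) ⟨ 𝔼U-pos n (proj₁ p) (proj₁ (proj₂ p)) (proj₂ (proj₂ p)) ⟩) ⟶₀
      limitRatio (suc n)
  hardFamily-ratio n ε 0<ε = δ , /-pos 0<ε 0<1+K , λ (p , 0<p , p<1) p<δ →
    ratio-close n p 0<p p<1 r 0≤r r*2^n≈μ (≤-<-trans
      (≤-resp-≈ (+-identityˡ _) (solve 2 (λ k p → p :+ k :* p := (:1 :+ k) :* p) refl K₀ p)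
        (+-monoˡ-≤ (K₀ * p) (<⇒≤ 0<p)))
      (<-resp-≈ refl (trans (*-comm _ _) (/-*-cancel ε 0<1+K)) (*-monoʳ-< 0<1+K p<δ)))
    where
    r : Carrier
    r = limitRatio (suc n)
    0≤r : 0# ≤ r
    0≤r = Asymptotics.ρ-nonneg ℝ n
    r*2^n≈μ : r * fromℕ (2 ℕ.^ n) ≈ fromℕ (middle n)
    r*2^n≈μ = Asymptotics.ρ-cancel ℝ n
    K₀ : Carrier
    K₀ = (fromℕ n + fromℕ (suc n)) * fromℕ (middle n)
    -- Adding 1 makes the divisor positive without a lower bound for the binomial coefficient.
    0<1+K : 0# < 1# + K₀
    0<1+K = <-≤-trans 0<1 (x≤x+y (*-nonneg
      (+-nonneg (fromℕ-nonneg n) (fromℕ-nonneg (suc n))) (fromℕ-nonneg (middle n))))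
    δ : Carrier
    δ = ε / (1# + K₀) ⟨ 0<1+K ⟩

theorem3 : ∀ {c ℓ₁ ℓ₂} (ℝ : RealField c ℓ₁ ℓ₂) →
    let open RealField ℝ
        open Analysis ℝ
        open Allocation ℝ
        open Family using (at)
    in
      (∀ m → 2 ℕ.≤ m →
        Σ[ F ∈ Family m ]
        Σ[ OPT ∈ (OpenUnit → Carrier) ]
        (∀ p → IsOPT (at F p) (OPT p)) ×
        (Σ[ 𝔼U>0 ∈ (∀ p → 0# < 𝔼U (at F p)) ]
          (λ p → OPT p / 𝔼U (at F p) ⟨ 𝔼U>0 p ⟩) ⟶₀ limitRatio m))
    × (Σ[ π ∈ Carrier ] Σ[ 0<π ∈ 0# < π ] IsPi π ×
        (Σ[ s ∈ (ℕ → Carrier) ]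
          (∀ m → (2≤m : 2 ℕ.≤ m) →
            IsSqrt (s m) (fromℕ 2 / (π * fromℕ (m ℕ.∸ 1)) ⟨ *-pos 0<π (fromℕ-pos (m ℕ.∸ 1) (ℕ.m<n⇒0<n∸m 2≤m)) ⟩)) ×
          limitRatio ∼ s))
    × limitRatio ⟶ 0#
theorem3 ℝ =
  (λ { (suc n) _ → hardFamily n ,
    (λ p → optimum (Family.at (hardFamily n) p)) ,
    (λ p → optimum-isOPT (Family.at (hardFamily n) p)) ,
    (λ (p , 0<p , p<1) → 𝔼U-pos n p 0<p p<1) , hardFamily-ratio n }) ,
  (π , π-pos , π-isPi , s , s-isSqrt , limitRatio∼s) ,
  limitRatio⟶0
  where
  open Allocation ℝ
  open CompetitiveRatio ℝ
  open Optimum ℝ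
  open Asymptotics ℝ
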